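{- Let $m$ and $n$ be positive integers. Then, modulo $\Phi_n(q)^2$, \[ T_0(mn,(m-1)n,q)\equiv 2m-nm(2m-1)(1-q^n)+(-1)^n\bigl((1+(-1)^n)(m-1)+1\bigr)\bigl(m-nm(m-1)(1-q^n)+2m(\mathcal{A}_n(q)-1)\bigr). \]
   Context: For integers $n,k$ the $q$-binomial coefficient is ${n\brack k}={n\brack k}_q=\frac{(1-q^n)(1-q^{n-1})\cdots(1-q^{n-k+1})}{(1-q)(1-q^2)\cdots(1-q^k)}$ if $0\le k\le n$, and $0$ otherwise; ${n\brack k}_{q^2}$ denotes the same with $q$ replaced by $q^2$. The $q$-trinomial coefficient of Andrews and Baxter is \[ T_0(N,M,q)=\sum_{k=0}^{N}(-1)^k{N\brack k}_{q^2}{2N-2k\brack N-M-k}. \] $\Phi_n(q)$ is the $n$th cyclotomic polynomial. For rational functions $A(q),B(q)$ and a polynomial $P(q)\in\mathbb{Z}[q]$, $A(q)\equiv B(q)\pmod{P(q)}$ means that $A(q)-B(q)$, written as a quotient $A_1(q)/A_2(q)$, has numerator divisible by $P(q)$ and denominator coprime to $P(q)$. Define, for a positive integer $n$, \[ \mathcal{A}_n(q)=\begin{cases}(-1)^r(1+q^r)q^{r(3r-1)/2}, & n=3r,\\ (-1)^rq^{r(3r+1)/2}, & n=3r+1,\\ (-1)^{r+1}q^{(r+1)(3r+2)/2}, & n=3r+2.\end{cases} \] -}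

module Defs where

open import Data.Nat as ℕ using (ℕ; zero; suc; _∸_; _≤?_; _<?_)
open import Data.Nat.DivMod using (_/_; _%_)
open import Data.Nat.Divisibility using (_∣?_)
open import Data.Integer as ℤ using (ℤ; +_; -[1+_]; 0ℤ; 1ℤ)
open import Data.List using (List; []; _∷_; [_]; map; replicate; _++_; length)
open import Data.Bool using (if_then_else_)
open import Data.Product using (∃)
open import Relation.Nullary using (yes; no)
open import Relation.Nullary.Decidable using (⌊_⌋)
open import Relation.Binary.PropositionalEquality using (_≡_)

-- Polynomials in ℤ[q], as coefficient lists (constant term first).
-- Trailing zeros are allowed; equality is coefficientwise (_≈ᴾ_).
Poly : Set
Poly = List ℤ

coeff : Poly → ℕ → ℤ
coeff []      _       = 0ℤ
coeff (a ∷ p) zero    = a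
coeff (a ∷ p) (suc i) = coeff p i

infix 4 _≈ᴾ_
_≈ᴾ_ : Poly → Poly → Set
p ≈ᴾ r = ∀ i → coeff p i ≡ coeff r i

infixl 6 _⊕_ _⊖_
infixl 7 _⊗_

_⊕_ : Poly → Poly → Poly
[]      ⊕ r       = r
(a ∷ p) ⊕ []      = a ∷ p
(a ∷ p) ⊕ (b ∷ r) = (a ℤ.+ b) ∷ (p ⊕ r)

scale : ℤ → Poly → Poly
scale c p = map (c ℤ.*_) p

negᴾ : Poly → Poly
negᴾ p = map ℤ.-_ p

_⊖_ : Poly → Poly → Poly
p ⊖ r = p ⊕ negᴾ r

_⊗_ : Poly → Poly → Poly
[]      ⊗ r = []
(a ∷ p) ⊗ r = scale a r ⊕ (0ℤ ∷ (p ⊗ r))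

constᴾ : ℤ → Poly
constᴾ c = [ c ]

one : Poly
one = constᴾ 1ℤ

X^ : ℕ → Poly
X^ k = replicate k 0ℤ ++ [ 1ℤ ]

sub2 : Poly → Poly
sub2 []      = []
sub2 (a ∷ p) = a ∷ 0ℤ ∷ sub2 p

trim : Poly → Poly
trim [] = []
trim (a ∷ p) with trim p
... | [] with a ℤ.≟ 0ℤ
...   | yes _ = []
...   | no _  = a ∷ []
trim (a ∷ p) | b ∷ r = a ∷ b ∷ r

lastC : Poly → ℤ
lastC []          = 0ℤ
lastC (a ∷ [])    = a
lastC (a ∷ b ∷ p) = lastC (b ∷ p)

-- Long division by a monic polynomial d (quotient only), with fuel.
divFuel : ℕ → Poly → Poly → Poly
divFuel zero    r d = []
divFuel (suc f) r d with length (trim r) <? length (trim d)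
... | yes _ = []
... | no _  = t ⊕ divFuel f (r ⊖ (t ⊗ d)) d
  where
  t : Poly
  t = scale (lastC (trim r)) (X^ (length (trim r) ∸ length (trim d)))

divMonic : Poly → Poly → Poly
divMonic r d = divFuel (suc (length r)) r d

-- Cyclotomic polynomials via q^n - 1 = ∏_{d ∣ n} Φ_d :
-- Φ_n = (q^n - 1) / ∏_{d ∣ n, d < n} Φ_d.
-- prodDiv m T i = product of the entries of T (indexed from i) whose index divides m
prodDiv : ℕ → List Poly → ℕ → Poly
prodDiv m []      i = one
prodDiv m (φ ∷ T) i = (if ⌊ i ∣? m ⌋ then φ else one) ⊗ prodDiv m T (suc i)

cycTable : ℕ → List Poly
cycTable zero    = []
cycTable (suc n) = T ++ [ divMonic (X^ (suc n) ⊖ one) (prodDiv (suc n) T 1) ]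
  where
  T : List Poly
  T = cycTable n

lastP : List Poly → Poly
lastP []          = []
lastP (a ∷ [])    = a
lastP (a ∷ b ∷ p) = lastP (b ∷ p)

Φ : ℕ → Poly
Φ n = lastP (cycTable n)

-- q-binomial coefficient [n choose k]_q as the exact quotient
--   ∏_{i<k} (1 - q^{n-i}) / ∏_{i=1}^{k} (1 - q^i)
-- (written with the monic factors q^a - 1; the signs (-1)^k cancel), 0 unless 0 ≤ k ≤ n.
prodTop : ℕ → ℕ → Poly
prodTop n zero    = one
prodTop n (suc k) = prodTop n k ⊗ (X^ (n ∸ k) ⊖ one)

prodBot : ℕ → Poly
prodBot zero    = one
prodBot (suc k) = prodBot k ⊗ (X^ (suc k) ⊖ one)

qbin : ℕ → ℤ → Poly
qbin n (+ k) with k ≤? n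
... | yes _ = divMonic (prodTop n k) (prodBot k)
... | no _  = []
qbin n -[1+ _ ] = []

sgn : ℕ → ℤ
sgn zero    = 1ℤ
sgn (suc k) = ℤ.- sgn k

sumP : ℕ → (ℕ → Poly) → Poly
sumP zero    f = []
sumP (suc n) f = sumP n f ⊕ f n

T0 : ℕ → ℤ → Poly
T0 N M = sumP (suc N) λ k →
  scale (sgn k) (sub2 (qbin N (+ k)) ⊗ qbin (2 ℕ.* N ∸ 2 ℕ.* k) ((+ N) ℤ.- M ℤ.- (+ k)))

𝒜 : ℕ → Poly
𝒜 n with n % 3
... | 0 = scale (sgn r) ((one ⊕ X^ r) ⊗ X^ ((r ℕ.* (3 ℕ.* r ∸ 1)) / 2))
  where r = n / 3
... | 1 = scale (sgn r) (X^ ((r ℕ.* (3 ℕ.* r ℕ.+ 1)) / 2))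
  where r = n / 3
... | _ = scale (sgn (suc r)) (X^ (((r ℕ.+ 1) ℕ.* (3 ℕ.* r ℕ.+ 2)) / 2))
  where r = n / 3

CongMod : Poly → Poly → Poly → Set
CongMod A B P = ∃ λ (R : Poly) → A ⊖ B ≈ᴾ P ⊗ R

RHS : ℕ → ℕ → Poly
RHS m n =
  constᴾ (2ℤ ℤ.* M) ⊖ scale (N ℤ.* M ℤ.* (2ℤ ℤ.* M ℤ.- 1ℤ)) oneMinus
  ⊕ scale (sgn n ℤ.* ((1ℤ ℤ.+ sgn n) ℤ.* (M ℤ.- 1ℤ) ℤ.+ 1ℤ))
      (constᴾ M ⊖ scale (N ℤ.* M ℤ.* (M ℤ.- 1ℤ)) oneMinus
        ⊕ scale (2ℤ ℤ.* M) (𝒜 n ⊖ one))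
  where
  M N 2ℤ : ℤ
  M = + m
  N = + n
  2ℤ = + 2
  oneMinus : Poly
  oneMinus = one ⊖ X^ n

{-# OPTIONS --safe #-}
module Submission where

-- Put ε = 1 - qⁿ. Modulo Φₙ(q)² we have ε² = 0 and 1 - qᵏ is regular for n ∤ k,
-- and nothing else about Φₙ is needed.
-- In T₀(mn,(m-1)n,q) = Σₖ (-1)ᵏ [mn,k]_{q²} [2mn-2k,n-k] the terms k = 0 and k = n
-- follow from q-Vandermonde: [(a+1)n,n] = q^{n²} [an,n] + 1, all other terms being
-- multiples of ε². A term with 0 < k < n contains a factor ε, so the remaining
-- factors may be computed with qⁿ = 1 by q-Lucas; with j = n - k it becomes a
-- constant times (-1)ʲ q^{j(j-1)/2} (1-qⁿ)/(1-qⁿ⁻ʲ) [n-j,j].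
-- These are the summands of a q-Lucas number, whose value 𝒜ₙ(q) comes from
-- Fₙ₊₃ = -qⁿ⁺¹ Fₙ for the q-Fibonacci sums Fₙ = Σⱼ (-1)ʲ q^{j(j-1)/2} [n-j,j].
-- Regularity of 1 - qᵏ: Bézout reduces k to a proper divisor g of n, Φₙ divides
-- (qⁿ-1)/(qᵍ-1), which is n/g modulo qᵍ-1, and Φₙ is monic.

open import Defs
open import Algebra.Bundles using (CommutativeRing)
open import Algebra.Solver.Ring.AlmostCommutativeRing using (_-Raw-AlmostCommutative⟶_; fromCommutativeRing)
import Algebra.Solver.Ring as RingSolver
open import Data.Bool using (if_then_else_)
open import Data.Empty using (⊥-elim)
open import Data.Integer as ℤ using (ℤ; +_; -[1+_]; 0ℤ; 1ℤ)
import Data.Integer.Properties as ℤ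
import Data.Integer.Solver as ℤ
open import Data.List using ([]; _∷_; [_]; _++_; length)
open import Data.List.Properties using (length-++)
open import Data.Maybe using (Maybe; just; nothing)
open import Data.Nat as ℕ using (ℕ; zero; suc; _≤_; _<_; _<?_; z≤n; s≤s; z<s; s<s; _∸_)
import Data.Nat.Properties as ℕ
open import Data.Nat.Divisibility using (_∣_; _∤_; divides; _∣?_; _∣0; n∣n; ∣-trans; ∣⇒≤; >⇒∤; 0∣⇒≡0; ∣n⇒∣m*n; ∣m+n∣m⇒∣n; *-cancelˡ-∣)
open import Data.Nat.DivMod using (_/_; _%_; m≡m%n+[m/n]*n; m%n<n; m*n/n≡m)
open import Data.Nat.GCD using (gcd; gcd-GCD; module Bézout; gcd[m,n]∣m; gcd[m,n]∣n)
open import Data.Nat.Solver using (module +-*-Solver)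
open import Data.Product using (_×_; _,_; ∃; proj₁; proj₂)
open import Data.Sum using (_⊎_; inj₁; inj₂)
open import Level using (_⊔_; 0ℓ)
open import Relation.Binary.Definitions using (tri<; tri≈; tri>)
open import Relation.Binary.PropositionalEquality as ≡ using (_≡_; _≢_)
open import Relation.Nullary using (yes; no)
open import Relation.Nullary.Decidable using (⌊_⌋)

-- Finite sums and Gaussian binomials over a commutative ring

-- Nothing is inverted: the quotient ring has nilpotents, so q-binomial identities are kept with
-- denominators cleared, and a factor 1 - qᵏ is removed only by regularity. The obstacle is the
-- parity of n. The denominator 1 - q²ᵏ of [mn,k]_{q²} is regular for 0 < k < n except at k = n/2,
-- where it equals ε, so that term is treated apart. Moreover q² has order n for odd n but n/2 for
-- even n. In the odd case 1 - q²ⁿ is 2ε, and the constant in front of the q-Lucas summands is -2m.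
-- In the even case mn consists of 2m periods of length n/2, the q-Lucas step past the first period
-- contributes a further 2m-1, and the constant is (2m-1)2m. Divided by 2m, these constants are the
-- two values of (-1)ⁿ((1+(-1)ⁿ)(m-1)+1). The binomial lemmas are stated over any commutative ring
-- with a chosen element, since they serve at q and at q², in ℤ[q] and in its quotient. For Φₙ,
-- which is given by long division, exactness of the division and regularity modulo Φₙ rest on each
-- other at smaller indices, and one strong induction proves both.

module ℕS where
  open +-*-Solver public using (solve) renaming (_:+_ to _⊞_; _:*_ to _⊠_; _:=_ to _≗_; con to #)

module RingTools {c ℓ} (R : CommutativeRing c ℓ)
  (hom : ℤ.+-*-rawRing -Raw-AlmostCommutative⟶ fromCommutativeRing R) where

  open CommutativeRing R public hiding (zero)
  open import Algebra.Properties.Semiring.Exp semiring public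
  open import Algebra.Properties.Group +-group public using (x∙y⁻¹≈ε⇒x≈y; x≈y⇒x∙y⁻¹≈ε)
  open import Relation.Binary.Reasoning.Setoid setoid public
  open _-Raw-AlmostCommutative⟶_ hom public
    renaming (⟦_⟧ to ι; +-homo to ι-+; *-homo to ι-*; -‿homo to ι-neg; 0-homo to ι-0; 1-homo to ι-1)

  -- The solver evaluates constants with this variant of ι, so that con 0 and
  -- con 1 are 0# and 1# on the nose.
  private
    ι′ : ℤ → Carrier
    ι′ (+ 0) = 0#
    ι′ (+ 1) = 1#
    ι′ z     = ι z

    ι′≈ι : ∀ z → ι′ z ≈ ι z
    ι′≈ι (+ 0)           = sym ι-0
    ι′≈ι (+ 1)           = sym ι-1
    ι′≈ι (+ suc (suc _)) = refl
    ι′≈ι -[1+ _ ]        = refl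

    hom′ : ℤ.+-*-rawRing -Raw-AlmostCommutative⟶ fromCommutativeRing R
    hom′ = record
      { ⟦_⟧    = ι′
      ; +-homo = λ x y → trans (ι′≈ι (x ℤ.+ y)) (trans (ι-+ x y) (sym (+-cong (ι′≈ι x) (ι′≈ι y))))
      ; *-homo = λ x y → trans (ι′≈ι (x ℤ.* y)) (trans (ι-* x y) (sym (*-cong (ι′≈ι x) (ι′≈ι y))))
      ; -‿homo = λ x → trans (ι′≈ι (ℤ.- x)) (trans (ι-neg x) (sym (-‿cong (ι′≈ι x))))
      ; 0-homo = refl
      ; 1-homo = refl
      }

    ι′-≟ : ∀ x y → Maybe (ι′ x ≈ ι′ y)
    ι′-≟ x y with x ℤ.≟ y
    ... | yes x≡y = just (reflexive (≡.cong ι′ x≡y))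
    ... | no _    = nothing

  open RingSolver ℤ.+-*-rawRing (fromCommutativeRing R) hom′ ι′-≟ public
    using (solve; _:=_; con; _:+_; _:*_; _:-_; :-_)

  private
    scaled-zero : ∀ {l r} c → l ≈ r → c * (l - r) ≈ 0#
    scaled-zero c l≈r = trans (*-congˡ (x≈y⇒x∙y⁻¹≈ε l≈r)) (zeroʳ c)

  -- Certificates of ideal membership: `a - b` is exhibited as a combination of differences known to
  -- vanish, with the leading arguments as cofactors. What remains is a polynomial identity for the
  -- ring solver.
  lin₁ : ∀ {a b l r} c → l ≈ r → a - b ≈ c * (l - r) → a ≈ b
  lin₁ c e h = x∙y⁻¹≈ε⇒x≈y _ _ (trans h (scaled-zero c e))

  lin₂ : ∀ {a b l r l′ r′} c c′ → l ≈ r → l′ ≈ r′ →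
         a - b ≈ c * (l - r) + c′ * (l′ - r′) → a ≈ b
  lin₂ c c′ e e′ h = x∙y⁻¹≈ε⇒x≈y _ _
    (trans h (trans (+-cong (scaled-zero c e) (scaled-zero c′ e′)) (+-identityˡ 0#)))

  lin₃ : ∀ {a b l r l′ r′ l″ r″} c c′ c″ → l ≈ r → l′ ≈ r′ → l″ ≈ r″ →
         a - b ≈ c * (l - r) + c′ * (l′ - r′) + c″ * (l″ - r″) → a ≈ b
  lin₃ c c′ c″ e e′ e″ h = x∙y⁻¹≈ε⇒x≈y _ _
    (trans h (trans (+-cong (trans (+-cong (scaled-zero c e) (scaled-zero c′ e′)) (+-identityˡ 0#))
                            (scaled-zero c″ e″)) (+-identityˡ 0#)))

  zero-fac : ∀ {x} y → x ≈ 0# → y * x ≈ 0#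
  zero-fac y x≈0 = trans (*-congˡ x≈0) (zeroʳ y)

  zero-facˡ : ∀ {x} y → x ≈ 0# → x * y ≈ 0#
  zero-facˡ y x≈0 = trans (*-congʳ x≈0) (zeroˡ y)

  ν : ℕ → Carrier
  ν n = ι (+ n)

  ν-suc : ∀ n → ν (suc n) ≈ 1# + ν n
  ν-suc n = trans (ι-+ (+ 1) (+ n)) (+-congʳ ι-1)

  ν-+ : ∀ m n → ν (m ℕ.+ n) ≈ ν m + ν n
  ν-+ m n = ι-+ (+ m) (+ n)

  ν-* : ∀ m n → ν (m ℕ.* n) ≈ ν m * ν n
  ν-* m n = trans (reflexive (≡.cong ι (ℤ.pos-* m n))) (ι-* (+ m) (+ n))

  σ : ℕ → Carrier
  σ n = ι (sgn n)

  σ-suc : ∀ n → σ (suc n) ≈ - σ n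
  σ-suc n = ι-neg (sgn n)

  σ-+ : ∀ m n → σ (m ℕ.+ n) ≈ σ m * σ n
  σ-+ zero    n = sym (trans (*-congʳ ι-1) (*-identityˡ _))
  σ-+ (suc m) n = begin
    σ (suc (m ℕ.+ n))  ≈⟨ trans (σ-suc (m ℕ.+ n)) (-‿cong (σ-+ m n)) ⟩
    - (σ m * σ n)      ≈⟨ solve 2 (λ a b → :- (a :* b) := (:- a) :* b) refl (σ m) (σ n) ⟩
    (- σ m) * σ n      ≈⟨ *-congʳ (σ-suc m) ⟨
    σ (suc m) * σ n    ∎

  σ²≈1 : ∀ n → σ n * σ n ≈ 1#
  σ²≈1 zero    = trans (*-cong ι-1 ι-1) (*-identityˡ 1#)
  σ²≈1 (suc n) = begin
    σ (suc n) * σ (suc n)  ≈⟨ *-cong (σ-suc n) (σ-suc n) ⟩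
    (- σ n) * (- σ n)      ≈⟨ solve 1 (λ a → (:- a) :* (:- a) := a :* a) refl (σ n) ⟩
    σ n * σ n              ≈⟨ σ²≈1 n ⟩
    1#                     ∎

  Sum : ℕ → (ℕ → Carrier) → Carrier
  Sum zero    f = 0#
  Sum (suc n) f = Sum n f + f n

  Sum-cong : ∀ n {f g} → (∀ i → i < n → f i ≈ g i) → Sum n f ≈ Sum n g
  Sum-cong zero    h = refl
  Sum-cong (suc n) h = +-cong (Sum-cong n (λ i i<n → h i (ℕ.m<n⇒m<1+n i<n))) (h n (ℕ.n<1+n n))

  Sum-zero : ∀ n {f} → (∀ i → i < n → f i ≈ 0#) → Sum n f ≈ 0#
  Sum-zero zero    h = refl
  Sum-zero (suc n) h = trans (+-cong (Sum-zero n (λ i i<n → h i (ℕ.m<n⇒m<1+n i<n))) (h n (ℕ.n<1+n n))) (+-identityˡ 0#)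

  Sum-+ : ∀ n f g → Sum n (λ i → f i + g i) ≈ Sum n f + Sum n g
  Sum-+ zero    f g = sym (+-identityˡ 0#)
  Sum-+ (suc n) f g = trans (+-congʳ (Sum-+ n f g))
    (solve 4 (λ a b x y → a :+ b :+ (x :+ y) := a :+ x :+ (b :+ y)) refl (Sum n f) (Sum n g) (f n) (g n))

  Sum-* : ∀ n c f → Sum n (λ i → c * f i) ≈ c * Sum n f
  Sum-* zero    c f = sym (zeroʳ c)
  Sum-* (suc n) c f = trans (+-congʳ (Sum-* n c f)) (sym (distribˡ c _ _))

  Sum-head : ∀ n f → Sum (suc n) f ≈ f 0 + Sum n (λ i → f (suc i))
  Sum-head zero    f = +-comm 0# (f 0)
  Sum-head (suc n) f = trans (+-congʳ (Sum-head n f)) (+-assoc _ _ _)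

  Sum-rev : ∀ n f → Sum n f ≈ Sum n (λ i → f (n ∸ suc i))
  Sum-rev zero    f = refl
  Sum-rev (suc n) f = begin
    Sum n f + f n                                ≈⟨ +-comm _ _ ⟩
    f n + Sum n f                                ≈⟨ +-congˡ (Sum-rev n f) ⟩
    f n + Sum n (λ i → f (n ∸ suc i))            ≈⟨ Sum-head n (λ i → f (n ∸ i)) ⟨
    Sum (suc n) (λ i → f (suc n ∸ suc i))        ∎

  Sum-extend : ∀ m n {f} → (∀ i → m ≤ i → f i ≈ 0#) → Sum (m ℕ.+ n) f ≈ Sum m f
  Sum-extend m zero    {f} h = reflexive (≡.cong (λ k → Sum k f) (ℕ.+-identityʳ m))
  Sum-extend m (suc n) {f} h = begin
    Sum (m ℕ.+ suc n) f               ≡⟨ ≡.cong (λ k → Sum k f) (ℕ.+-suc m n) ⟩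
    Sum (m ℕ.+ n) f + f (m ℕ.+ n)     ≈⟨ +-cong (Sum-extend m n h) (h _ (ℕ.m≤m+n m n)) ⟩
    Sum m f + 0#                      ≈⟨ +-identityʳ _ ⟩
    Sum m f                           ∎

  -- G x n k is the Gaussian binomial coefficient [n choose k] at x.
  G : Carrier → ℕ → ℕ → Carrier
  G x n       zero    = 1#
  G x zero    (suc k) = 0#
  G x (suc n) (suc k) = G x n k + x ^ suc k * G x n (suc k)

  module Gauss (x : Carrier) where

    G-vanish : ∀ {n k} → n < k → G x n k ≈ 0#
    G-vanish {zero}  {suc k} _         = refl
    G-vanish {suc n} {suc k} (s≤s n<k) =
      trans (+-cong (G-vanish n<k) (zero-fac _ (G-vanish (ℕ.m<n⇒m<1+n n<k)))) (+-identityˡ 0#)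

    G-diag : ∀ n → G x n n ≈ 1#
    G-diag zero    = refl
    G-diag (suc n) = trans (+-cong (G-diag n) (zero-fac _ (G-vanish (ℕ.n<1+n n)))) (+-identityʳ 1#)

    -- The ratio of neighbouring coefficients, cleared of denominators because `1# - x ^ suc k` need
    -- not be invertible. In the inductive step both sides become
    -- `(1# - x ^ suc n) * G x n (suc k)`; where the subtraction in the exponent is truncated, the
    -- binomial vanishes.
    G-step : ∀ n k → (1# - x ^ suc k) * G x n (suc k) ≈ (1# - x ^ (n ∸ k)) * G x n k
    G-step zero k rewrite ℕ.0∸n≡0 k =
      solve 2 (λ a b → (con (+ 1) :- a) :* con (+ 0) := (con (+ 1) :- con (+ 1)) :* b) refl (x ^ suc k) (G x 0 k)
    G-step (suc n) zero = lin₁ (x * 1#) (G-step n zero)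
      (solve 3 (λ a b g → (con (+ 1) :- a :* con (+ 1)) :* (con (+ 1) :+ a :* con (+ 1) :* g) :- (con (+ 1) :- a :* b) :* con (+ 1)
          := a :* con (+ 1) :* ((con (+ 1) :- a :* con (+ 1)) :* g :- (con (+ 1) :- b) :* con (+ 1)))
        refl x (x ^ n) (G x n 1))
    G-step (suc n) (suc k) = begin
      (1# - x ^ suc (suc k)) * (g₁ + x ^ suc (suc k) * g₂)
        ≈⟨ lin₁ (x ^ suc (suc k)) (G-step n (suc k))
             (solve 4 (λ a b g h → (con (+ 1) :- a) :* (g :+ a :* h) :- (con (+ 1) :- a :* b) :* g
                := a :* ((con (+ 1) :- a) :* h :- (con (+ 1) :- b) :* g))
               refl (x ^ suc (suc k)) (x ^ (n ∸ suc k)) g₁ g₂) ⟩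
      (1# - x ^ suc (suc k) * x ^ (n ∸ suc k)) * g₁
        ≈⟨ exponents ⟩
      (1# - x ^ suc k * x ^ (n ∸ k)) * g₁
        ≈⟨ lin₁ 1# (G-step n k)
             (solve 4 (λ a b g h → (con (+ 1) :- a :* b) :* g :- (con (+ 1) :- b) :* (h :+ a :* g)
                := con (+ 1) :* ((con (+ 1) :- a) :* g :- (con (+ 1) :- b) :* h))
               refl (x ^ suc k) (x ^ (n ∸ k)) g₁ g₀) ⟩
      (1# - x ^ (n ∸ k)) * (g₀ + x ^ suc k * g₁) ∎
      where
      g₀ g₁ g₂ : Carrier
      g₀ = G x n k
      g₁ = G x n (suc k)
      g₂ = G x n (suc (suc k))
      exponents : (1# - x ^ suc (suc k) * x ^ (n ∸ suc k)) * g₁ ≈ (1# - x ^ suc k * x ^ (n ∸ k)) * g₁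
      exponents with suc k ℕ.≤? n
      ... | no  k≮n = trans (zero-fac _ (G-vanish (ℕ.≰⇒> k≮n))) (sym (zero-fac _ (G-vanish (ℕ.≰⇒> k≮n))))
      ... | yes k<n = *-congʳ (+-congˡ (-‿cong (begin
        x ^ suc (suc k) * x ^ (n ∸ suc k)   ≈⟨ ^-homo-* x (suc (suc k)) (n ∸ suc k) ⟨
        x ^ (suc (suc k) ℕ.+ (n ∸ suc k))   ≡⟨ ≡.cong (λ e → x ^ suc e) (≡.trans (ℕ.m+[n∸m]≡n k<n) (≡.sym (ℕ.m+[n∸m]≡n (ℕ.<⇒≤ k<n)))) ⟩
        x ^ (suc k ℕ.+ (n ∸ k))             ≈⟨ ^-homo-* x (suc k) (n ∸ k) ⟩
        x ^ suc k * x ^ (n ∸ k)             ∎)))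

    -- The difference between this Pascal rule and the defining one is exactly `G-step`.
    G-pascal′ : ∀ n k → G x (suc n) (suc k) ≈ x ^ (n ∸ k) * G x n k + G x n (suc k)
    G-pascal′ n k = lin₁ (- 1#) (G-step n k)
      (solve 4 (λ a b g h → g :+ a :* h :- (b :* g :+ h)
          := (:- con (+ 1)) :* ((con (+ 1) :- a) :* h :- (con (+ 1) :- b) :* g))
        refl (x ^ suc k) (x ^ (n ∸ k)) (G x n k) (G x n (suc k)))

    G-absorb : ∀ n k → (1# - x ^ suc k) * G x (suc n) (suc k) ≈ (1# - x ^ suc n) * G x n k
    G-absorb n k = begin
      (1# - x ^ suc k) * (G x n k + x ^ suc k * G x n (suc k))
        ≈⟨ lin₁ (x ^ suc k) (G-step n k)
             (solve 4 (λ a b g h → (con (+ 1) :- a) :* (g :+ a :* h) :- (con (+ 1) :- a :* b) :* g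
                := a :* ((con (+ 1) :- a) :* h :- (con (+ 1) :- b) :* g))
               refl (x ^ suc k) (x ^ (n ∸ k)) (G x n k) (G x n (suc k))) ⟩
      (1# - x ^ suc k * x ^ (n ∸ k)) * G x n k
        ≈⟨ exponents ⟩
      (1# - x ^ suc n) * G x n k ∎
      where
      exponents : (1# - x ^ suc k * x ^ (n ∸ k)) * G x n k ≈ (1# - x ^ suc n) * G x n k
      exponents with k ℕ.≤? n
      ... | no  k≰n = trans (zero-fac _ (G-vanish (ℕ.≰⇒> k≰n))) (sym (zero-fac _ (G-vanish (ℕ.≰⇒> k≰n))))
      ... | yes k≤n = *-congʳ (+-congˡ (-‿cong (begin
        x ^ suc k * x ^ (n ∸ k)   ≈⟨ ^-homo-* x (suc k) (n ∸ k) ⟨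
        x ^ (suc k ℕ.+ (n ∸ k))   ≡⟨ ≡.cong (λ e → x ^ suc e) (ℕ.m+[n∸m]≡n k≤n) ⟩
        x ^ suc n                 ∎)))

    -- Induction on `m`: the Pascal rule on the left gives two shorter convolutions, and the Pascal
    -- rule inside the summands on the right splits them into the same two, one of them shifted by
    -- an index.
    vandermonde : ∀ m n k → G x (m ℕ.+ n) k ≈ Sum (suc k) (λ i → x ^ ((m ∸ i) ℕ.* (k ∸ i)) * (G x m i * G x n (k ∸ i)))
    vandermonde zero n k = sym (begin
      Sum (suc k) f                     ≈⟨ Sum-head k f ⟩
      f 0 + Sum k (λ i → f (suc i))     ≈⟨ +-congˡ (Sum-zero k (λ i _ → zero-fac _ (zeroˡ _))) ⟩
      1# * (1# * G x n k) + 0#          ≈⟨ solve 1 (λ a → con (+ 1) :* (con (+ 1) :* a) :+ con (+ 0) := a) refl (G x n k) ⟩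
      G x n k ∎)
      where
      f : ℕ → Carrier
      f i = x ^ ((0 ∸ i) ℕ.* (k ∸ i)) * (G x 0 i * G x n (k ∸ i))
    vandermonde (suc m) n zero rewrite ℕ.*-zeroʳ m =
      solve 0 (con (+ 1) := con (+ 0) :+ con (+ 1) :* (con (+ 1) :* con (+ 1))) refl
    vandermonde (suc m) n (suc k) = begin
      G x (m ℕ.+ n) k + x ^ suc k * G x (m ℕ.+ n) (suc k)
        ≈⟨ +-cong (vandermonde m n k) (*-congˡ (vandermonde m n (suc k))) ⟩
      Sum (suc k) f + x ^ suc k * Sum (suc (suc k)) g
        ≈⟨ +-congˡ (Sum-* (suc (suc k)) (x ^ suc k) g) ⟨
      Sum (suc k) f + Sum (suc (suc k)) (λ i → x ^ suc k * g i)
        ≈⟨ +-congˡ (Sum-cong (suc (suc k)) (λ i i<2+k → h-eq i (ℕ.s≤s⁻¹ i<2+k))) ⟨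
      Sum (suc k) f + Sum (suc (suc k)) h
        ≈⟨ +-congˡ (Sum-head (suc k) h) ⟩
      Sum (suc k) f + (h 0 + Sum (suc k) (λ i → h (suc i)))
        ≈⟨ solve 3 (λ a b c → a :+ (b :+ c) := b :+ (a :+ c)) refl _ _ _ ⟩
      h 0 + (Sum (suc k) f + Sum (suc k) (λ i → h (suc i)))
        ≈⟨ +-congˡ (Sum-+ (suc k) f (λ i → h (suc i))) ⟨
      h 0 + Sum (suc k) (λ i → f i + h (suc i))
        ≈⟨ +-cong (solve 2 (λ a b → a :* (con (+ 1) :* con (+ 1) :* b) := a :* (con (+ 1) :* b)) refl _ _)
             (Sum-cong (suc k) (λ i _ →
               solve 5 (λ e p a b r → e :* (a :* b) :+ e :* (p :* r :* b) := e :* ((a :+ p :* r) :* b))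
                 refl (x ^ ((m ∸ i) ℕ.* (k ∸ i))) (x ^ suc i) (G x m i) (G x n (k ∸ i)) (G x m (suc i)))) ⟩
      t 0 + Sum (suc k) (λ i → t (suc i))
        ≈⟨ Sum-head (suc k) t ⟨
      Sum (suc (suc k)) t ∎
      where
      f g h t : ℕ → Carrier
      f i = x ^ ((m ∸ i) ℕ.* (k ∸ i)) * (G x m i * G x n (k ∸ i))
      g i = x ^ ((m ∸ i) ℕ.* (suc k ∸ i)) * (G x m i * G x n (suc k ∸ i))
      h i = x ^ ((suc m ∸ i) ℕ.* (suc k ∸ i)) * (x ^ i * G x m i * G x n (suc k ∸ i))
      t i = x ^ ((suc m ∸ i) ℕ.* (suc k ∸ i)) * (G x (suc m) i * G x n (suc k ∸ i))
      h-eq : ∀ i → i ≤ suc k → h i ≈ x ^ suc k * g i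
      h-eq i i≤1+k with i ℕ.≤? m
      -- The exponents agree only without truncation; beyond `m` the coefficient `G x m i` is zero.
      ... | no i≰m = trans (zero-fac _ (zero-facˡ _ (zero-fac _ (G-vanish (ℕ.≰⇒> i≰m)))))
                           (sym (zero-fac _ (zero-fac _ (zero-facˡ _ (G-vanish (ℕ.≰⇒> i≰m))))))
      ... | yes i≤m = begin
        x ^ e₁ * (x ^ i * G x m i * G x n (suc k ∸ i))
          ≈⟨ solve 4 (λ a b c d → a :* (b :* c :* d) := a :* b :* (c :* d)) refl _ _ _ _ ⟩
        x ^ e₁ * x ^ i * (G x m i * G x n (suc k ∸ i))
          ≈⟨ *-congʳ (trans (sym (^-homo-* x e₁ i)) (trans (^-congʳ x e-eq) (^-homo-* x (suc k) e₂))) ⟩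
        x ^ suc k * x ^ e₂ * (G x m i * G x n (suc k ∸ i))
          ≈⟨ *-assoc _ _ _ ⟩
        x ^ suc k * g i ∎
        where
        e₁ e₂ : ℕ
        e₁ = (suc m ∸ i) ℕ.* (suc k ∸ i)
        e₂ = (m ∸ i) ℕ.* (suc k ∸ i)
        e-eq : e₁ ℕ.+ i ≡ suc k ℕ.+ e₂
        e-eq = ≡R.begin
          (suc m ∸ i) ℕ.* (suc k ∸ i) ℕ.+ i             ≡R.≡⟨ ≡.cong (λ u → u ℕ.* (suc k ∸ i) ℕ.+ i) (ℕ.+-∸-assoc 1 i≤m) ⟩
          (suc k ∸ i) ℕ.+ e₂ ℕ.+ i                      ≡R.≡⟨ ℕS.solve 3 (λ a b c → a ⊞ b ⊞ c ≗ a ⊞ c ⊞ b) ≡.refl (suc k ∸ i) e₂ i ⟩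
          (suc k ∸ i) ℕ.+ i ℕ.+ e₂                      ≡R.≡⟨ ≡.cong (ℕ._+ e₂) (ℕ.m∸n+n≡m i≤1+k) ⟩
          suc k ℕ.+ e₂                                  ≡R.∎
          where
          module ≡R = ≡.≡-Reasoning
          open ℕS hiding (solve)

-- q-Fibonacci and q-Lucas sums

-- `tri k` is the binomial coefficient `k` choose 2, so the usual triangular numbers appear shifted
-- by one.
tri : ℕ → ℕ
tri zero    = 0
tri (suc k) = k ℕ.+ tri k

-- The exponents r(3r-1)/2 and r(3r+1)/2.
pent₀ pent₁ : ℕ → ℕ
pent₀ zero    = 0
pent₀ (suc r) = suc (r ℕ.* 3) ℕ.+ pent₀ r
pent₁ zero    = 0
pent₁ (suc r) = suc (suc (r ℕ.* 3)) ℕ.+ pent₁ r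

pent₁≡r+pent₀ : ∀ r → pent₁ r ≡ r ℕ.+ pent₀ r
pent₁≡r+pent₀ zero    = ≡.refl
pent₁≡r+pent₀ (suc r) rewrite pent₁≡r+pent₀ r =
  solve 3 (λ a b c → # 2 ⊞ a ⊞ (b ⊞ c) ≗ # 1 ⊞ b ⊞ (# 1 ⊞ a ⊞ c)) ≡.refl (r ℕ.* 3) r (pent₀ r)
  where open ℕS

module LucasSums {c ℓ} (R : CommutativeRing c ℓ)
  (hom : ℤ.+-*-rawRing -Raw-AlmostCommutative⟶ fromCommutativeRing R)
  (x : CommutativeRing.Carrier R) where

  open RingTools R hom
  open Gauss x

  -- The primed summand has an extra factor `x ^ j`. The Pascal rules lead out of the unprimed sums,
  -- and the primed ones close the system of recurrences.
  fibTerm fibTerm′ : ℕ → ℕ → Carrier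
  fibTerm  n j = σ j * x ^ tri j * G x (n ∸ j) j
  fibTerm′ n j = σ j * x ^ tri (suc j) * G x (n ∸ j) j

  fib fib′ : ℕ → Carrier
  fib  n = Sum (suc n) (fibTerm n)
  fib′ n = Sum (suc n) (fibTerm′ n)

  G-last : ∀ n k → G x (n ∸ n) (suc k) ≈ 0#
  G-last n k rewrite ℕ.n∸n≡0 n = refl

  fib-head : ∀ n → fib (suc n) ≈ fibTerm (suc n) 0 + Sum n (λ i → fibTerm (suc n) (suc i))
  fib-head n = trans (+-congˡ (zero-fac _ (G-last n n)))
    (trans (+-identityʳ _) (Sum-head n (fibTerm (suc n))))

  fib′-head : ∀ n → fib′ (suc n) ≈ fibTerm′ (suc n) 0 + Sum n (λ i → fibTerm′ (suc n) (suc i))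
  fib′-head n = trans (+-congˡ (zero-fac _ (G-last n n)))
    (trans (+-identityʳ _) (Sum-head n (fibTerm′ (suc n))))

  fib-rec : ∀ n → fib (suc (suc n)) ≈ fib′ (suc n) - fib′ n
  fib-rec n = begin
    fib (suc (suc n))
      ≈⟨ fib-head (suc n) ⟩
    fibTerm (suc (suc n)) 0 + Sum (suc n) (λ i → fibTerm (suc (suc n)) (suc i))
      ≈⟨ +-congˡ (Sum-cong (suc n) (λ i i<1+n → termwise i (ℕ.s≤s⁻¹ i<1+n))) ⟩
    fibTerm′ (suc n) 0 + Sum (suc n) (λ i → fibTerm′ (suc n) (suc i) + - 1# * fibTerm′ n i)
      ≈⟨ +-congˡ (trans (Sum-+ (suc n) _ _) (+-congˡ (Sum-* (suc n) (- 1#) (fibTerm′ n)))) ⟩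
    fibTerm′ (suc n) 0 + (Sum (suc n) (λ i → fibTerm′ (suc n) (suc i)) + - 1# * fib′ n)
      ≈⟨ solve 3 (λ a b c → a :+ (b :+ (:- con (+ 1)) :* c) := a :+ b :- c) refl _ _ _ ⟩
    fibTerm′ (suc n) 0 + Sum (suc n) (λ i → fibTerm′ (suc n) (suc i)) - fib′ n
      ≈⟨ +-congʳ (Sum-head (suc n) (fibTerm′ (suc n))) ⟨
    fib′ (suc n) - fib′ n ∎
    where
    termwise : ∀ i → i ≤ n → fibTerm (suc (suc n)) (suc i) ≈ fibTerm′ (suc n) (suc i) + - 1# * fibTerm′ n i
    termwise i i≤n rewrite ℕ.+-∸-assoc 1 i≤n = lin₂ (x ^ tri (suc i) * g) (- (σ (suc i) * G x (n ∸ i) (suc i)))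
        (σ-suc i) (^-homo-* x (suc i) (tri (suc i)))
        (solve 7 (λ s s′ p t g h w → s :* t :* (g :+ p :* h) :- (s :* w :* h :+ (:- con (+ 1)) :* (s′ :* t :* g))
            := t :* g :* (s :- (:- s′)) :+ (:- (s :* h)) :* (w :- p :* t))
          refl (σ (suc i)) (σ i) (x ^ suc i) (x ^ tri (suc i)) g (G x (n ∸ i) (suc i)) (x ^ (suc i ℕ.+ tri (suc i))))
      where
      g : Carrier
      g = G x (n ∸ i) i

  fib′-rec : ∀ n → fib′ (suc (suc n)) ≈ fib′ (suc n) - x ^ suc n * fib n
  fib′-rec n = begin
    fib′ (suc (suc n))
      ≈⟨ fib′-head (suc n) ⟩
    fibTerm′ (suc (suc n)) 0 + Sum (suc n) (λ i → fibTerm′ (suc (suc n)) (suc i))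
      ≈⟨ +-congˡ (Sum-cong (suc n) (λ i i<1+n → termwise i (ℕ.s≤s⁻¹ i<1+n))) ⟩
    fibTerm′ (suc n) 0 + Sum (suc n) (λ i → fibTerm′ (suc n) (suc i) + - (x ^ suc n) * fibTerm n i)
      ≈⟨ +-congˡ (trans (Sum-+ (suc n) _ _) (+-congˡ (Sum-* (suc n) (- (x ^ suc n)) (fibTerm n)))) ⟩
    fibTerm′ (suc n) 0 + (Sum (suc n) (λ i → fibTerm′ (suc n) (suc i)) + - (x ^ suc n) * fib n)
      ≈⟨ solve 4 (λ a b c y → a :+ (b :+ (:- y) :* c) := a :+ b :- y :* c) refl _ _ _ _ ⟩
    fibTerm′ (suc n) 0 + Sum (suc n) (λ i → fibTerm′ (suc n) (suc i)) - x ^ suc n * fib n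
      ≈⟨ +-congʳ (Sum-head (suc n) (fibTerm′ (suc n))) ⟨
    fib′ (suc n) - x ^ suc n * fib n ∎
    where
    exponents : ∀ i → x ^ tri (suc (suc i)) * (x ^ (n ∸ i ∸ i) * G x (n ∸ i) i)
                      ≈ x ^ suc n * (x ^ tri i * G x (n ∸ i) i)
    exponents i with i ℕ.≤? n ∸ i
    ... | no i≰n∸i = trans (zero-fac _ (zero-fac _ (G-vanish (ℕ.≰⇒> i≰n∸i))))
                           (sym (zero-fac _ (zero-fac _ (G-vanish (ℕ.≰⇒> i≰n∸i)))))
    ... | yes i≤n∸i = begin
      x ^ tri (suc (suc i)) * (x ^ (n ∸ i ∸ i) * G x (n ∸ i) i)  ≈⟨ *-assoc _ _ _ ⟨
      x ^ tri (suc (suc i)) * x ^ (n ∸ i ∸ i) * G x (n ∸ i) i    ≈⟨ *-congʳ (^-homo-* x (tri (suc (suc i))) (n ∸ i ∸ i)) ⟨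
      x ^ (tri (suc (suc i)) ℕ.+ (n ∸ i ∸ i)) * G x (n ∸ i) i    ≈⟨ *-congʳ (^-congʳ x e-eq) ⟩
      x ^ (suc n ℕ.+ tri i) * G x (n ∸ i) i                      ≈⟨ *-congʳ (^-homo-* x (suc n) (tri i)) ⟩
      x ^ suc n * x ^ tri i * G x (n ∸ i) i                      ≈⟨ *-assoc _ _ _ ⟩
      x ^ suc n * (x ^ tri i * G x (n ∸ i) i)                    ∎
      where
      e-eq : tri (suc (suc i)) ℕ.+ (n ∸ i ∸ i) ≡ suc n ℕ.+ tri i
      e-eq = ≡.trans
        (ℕS.solve 3 (λ a b d → # 1 ⊞ a ⊞ (a ⊞ b) ⊞ d ≗ # 1 ⊞ (d ⊞ a ⊞ a ⊞ b)) ≡.refl i (tri i) (n ∸ i ∸ i))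
        (≡.cong (λ u → suc (u ℕ.+ tri i)) (≡.trans (≡.cong (ℕ._+ i) (ℕ.m∸n+n≡m i≤n∸i))
          (ℕ.m∸n+n≡m (ℕ.≤-trans i≤n∸i (ℕ.m∸n≤m n i)))))
        where
        open ℕS hiding (solve)
    termwise : ∀ i → i ≤ n → fibTerm′ (suc (suc n)) (suc i) ≈ fibTerm′ (suc n) (suc i) + - (x ^ suc n) * fibTerm n i
    termwise i i≤n rewrite ℕ.+-∸-assoc 1 i≤n = lin₃ (σ (suc i) * x ^ tri (suc (suc i))) (σ (suc i))
        (x ^ suc n * x ^ tri i * G x (n ∸ i) i)
        (G-pascal′ (n ∸ i) i) (exponents i) (σ-suc i)
        (solve 9 (λ s s′ w P g h y z v → s :* w :* P :- (s :* w :* h :+ (:- y) :* (s′ :* z :* g))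
            := s :* w :* (P :- (v :* g :+ h)) :+ s :* (w :* (v :* g) :- y :* (z :* g)) :+ y :* z :* g :* (s :- (:- s′)))
          refl (σ (suc i)) (σ i) (x ^ tri (suc (suc i))) (G x (suc (n ∸ i)) (suc i)) (G x (n ∸ i) i)
               (G x (n ∸ i) (suc i)) (x ^ suc n) (x ^ tri i) (x ^ (n ∸ i ∸ i)))

  -- `fib-rec` comes from one Pascal rule and `fib′-rec` from the other. Substituting the second
  -- into the first cancels `fib′ (suc n)`, so the companion sums disappear and a one-term
  -- recurrence of period 3 is left.
  fib-step : ∀ n → fib (suc (suc (suc n))) ≈ - (x ^ suc n * fib n)
  fib-step n = lin₂ 1# 1# (fib-rec (suc n)) (fib′-rec n)
    (solve 4 (λ a b c d → a :- (:- d) := con (+ 1) :* (a :- (b :- c)) :+ con (+ 1) :* (b :- (c :- d)))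
      refl (fib (suc (suc (suc n)))) (fib′ (suc (suc n))) (fib′ (suc n)) (x ^ suc n * fib n))

  fib-mod0 : ∀ r → fib (r ℕ.* 3) ≈ σ r * x ^ pent₀ r
  fib-mod0 zero    = solve 1 (λ s → con (+ 0) :+ s :* con (+ 1) :* con (+ 1) := s :* con (+ 1)) refl (σ 0)
  fib-mod0 (suc r) = begin
    fib (suc r ℕ.* 3)                          ≈⟨ fib-step (r ℕ.* 3) ⟩
    - (x ^ suc (r ℕ.* 3) * fib (r ℕ.* 3))      ≈⟨ -‿cong (*-congˡ (fib-mod0 r)) ⟩
    - (x ^ suc (r ℕ.* 3) * (σ r * x ^ pent₀ r)) ≈⟨ solve 3 (λ a s b → :- (a :* (s :* b)) := (:- s) :* (a :* b)) refl _ _ _ ⟩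
    - σ r * (x ^ suc (r ℕ.* 3) * x ^ pent₀ r)  ≈⟨ *-cong (σ-suc r) (^-homo-* x (suc (r ℕ.* 3)) (pent₀ r)) ⟨
    σ (suc r) * x ^ pent₀ (suc r)              ∎

  fib-mod1 : ∀ r → fib (suc (r ℕ.* 3)) ≈ σ r * x ^ pent₁ r
  fib-mod1 zero    = solve 2 (λ s t → con (+ 0) :+ s :* con (+ 1) :* con (+ 1) :+ t :* con (+ 0) := s :* con (+ 1)) refl (σ 0) (σ 1 * 1#)
  fib-mod1 (suc r) = begin
    fib (suc (suc r ℕ.* 3))                            ≈⟨ fib-step (suc (r ℕ.* 3)) ⟩
    - (x ^ suc (suc (r ℕ.* 3)) * fib (suc (r ℕ.* 3)))  ≈⟨ -‿cong (*-congˡ (fib-mod1 r)) ⟩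
    - (x ^ suc (suc (r ℕ.* 3)) * (σ r * x ^ pent₁ r))  ≈⟨ solve 3 (λ a s b → :- (a :* (s :* b)) := (:- s) :* (a :* b)) refl _ _ _ ⟩
    - σ r * (x ^ suc (suc (r ℕ.* 3)) * x ^ pent₁ r)    ≈⟨ *-cong (σ-suc r) (^-homo-* x (suc (suc (r ℕ.* 3))) (pent₁ r)) ⟨
    σ (suc r) * x ^ pent₁ (suc r)                      ∎

  fib-mod2 : ∀ r → fib (suc (suc (r ℕ.* 3))) ≈ 0#
  fib-mod2 zero    = lin₁ 1# (σ-suc 0)
    (solve 4 (λ s t u v → con (+ 0) :+ s :* con (+ 1) :* con (+ 1) :+ t :* con (+ 1) :* (con (+ 1) :+ v :* con (+ 0)) :+ u :* con (+ 0) :- con (+ 0)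
       := con (+ 1) :* (t :- (:- s)))
      refl (σ 0) (σ 1) (σ 2 * x ^ 1) (x ^ 1))
  fib-mod2 (suc r) = begin
    fib (suc (suc (suc r ℕ.* 3)))                                  ≈⟨ fib-step (suc (suc (r ℕ.* 3))) ⟩
    - (x ^ suc (suc (suc (r ℕ.* 3))) * fib (suc (suc (r ℕ.* 3))))  ≈⟨ -‿cong (*-congˡ (fib-mod2 r)) ⟩
    - (x ^ suc (suc (suc (r ℕ.* 3))) * 0#)                         ≈⟨ solve 1 (λ a → :- (a :* con (+ 0)) := con (+ 0)) refl _ ⟩
    0#                                                             ∎

  -- lucasTerm n i is the summand of index i + 1 in
  -- Σⱼ (-1)ʲ x^(j(j-1)/2) (1 - xⁿ)/(1 - xⁿ⁻ʲ) [n-j choose j].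
  lucasTerm : ℕ → ℕ → Carrier
  lucasTerm n i = σ (suc i) * x ^ tri (suc i)
    * (G x (n ∸ suc i) (suc i) + x ^ (n ∸ suc i) * G x (n ∸ suc (suc i)) i)

  -- The `1#` is the summand of index 0. The sum stops at index `n - 1`, because the quotient (1 -
  -- xⁿ)/(1 - xⁿ⁻ʲ) has no meaning at `j = n`.
  lucas : ℕ → Carrier
  lucas n = 1# + Sum (n ∸ 1) (lucasTerm n)

  lucas-fib : ∀ n → lucas (suc (suc n)) ≈ fib (suc (suc n)) - x ^ suc n * fib n
  lucas-fib n = begin
    1# + Sum (suc n) (lucasTerm (suc (suc n)))
      ≈⟨ +-cong σ0-term (Sum-cong (suc n) (λ i i<1+n → termwise i (ℕ.<⇒≤ i<1+n))) ⟩
    fibTerm (suc (suc n)) 0 + Sum (suc n) (λ i → fibTerm (suc (suc n)) (suc i) + - (x ^ suc n) * fibTerm n i)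
      ≈⟨ +-congˡ (trans (Sum-+ (suc n) _ _) (+-congˡ (Sum-* (suc n) (- (x ^ suc n)) (fibTerm n)))) ⟩
    fibTerm (suc (suc n)) 0 + (Sum (suc n) (λ i → fibTerm (suc (suc n)) (suc i)) + - (x ^ suc n) * fib n)
      ≈⟨ solve 4 (λ a b c y → a :+ (b :+ (:- y) :* c) := a :+ b :- y :* c) refl _ _ _ _ ⟩
    fibTerm (suc (suc n)) 0 + Sum (suc n) (λ i → fibTerm (suc (suc n)) (suc i)) - x ^ suc n * fib n
      ≈⟨ +-congʳ (fib-head (suc n)) ⟨
    fib (suc (suc n)) - x ^ suc n * fib n ∎
    where
    σ0-term : 1# ≈ σ 0 * 1# * 1#
    σ0-term = trans (sym ι-1) (solve 1 (λ s → s := s :* con (+ 1) :* con (+ 1)) refl (σ 0))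
    exponents : ∀ i → i ≤ suc n → x ^ tri (suc i) * x ^ (suc n ∸ i) ≈ x ^ suc n * x ^ tri i
    exponents i i≤1+n = begin
      x ^ tri (suc i) * x ^ (suc n ∸ i)        ≈⟨ ^-homo-* x (tri (suc i)) (suc n ∸ i) ⟨
      x ^ (i ℕ.+ tri i ℕ.+ (suc n ∸ i))        ≈⟨ ^-congʳ x (ℕS.solve 3 (λ a b d → a ⊞ b ⊞ d ≗ d ⊞ a ⊞ b) ≡.refl i (tri i) (suc n ∸ i)) ⟩
      x ^ (suc n ∸ i ℕ.+ i ℕ.+ tri i)          ≈⟨ ^-congʳ x (≡.cong (ℕ._+ tri i) (ℕ.m∸n+n≡m i≤1+n)) ⟩
      x ^ (suc n ℕ.+ tri i)                    ≈⟨ ^-homo-* x (suc n) (tri i) ⟩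
      x ^ suc n * x ^ tri i                    ∎
      where open ℕS hiding (solve)
    termwise : ∀ i → i ≤ suc n → lucasTerm (suc (suc n)) i ≈ fibTerm (suc (suc n)) (suc i) + - (x ^ suc n) * fibTerm n i
    termwise i i≤1+n = lin₂ (σ (suc i) * G x (n ∸ i) i) (x ^ suc n * x ^ tri i * G x (n ∸ i) i)
      (exponents i i≤1+n) (σ-suc i)
      (solve 8 (λ s s′ w P g y z v → s :* w :* (P :+ v :* g) :- (s :* w :* P :+ (:- y) :* (s′ :* z :* g))
          := s :* g :* (w :* v :- y :* z) :+ y :* z :* g :* (s :- (:- s′)))
        refl (σ (suc i)) (σ i) (x ^ tri (suc i)) (G x (suc n ∸ i) (suc i)) (G x (n ∸ i) i)
             (x ^ suc n) (x ^ tri i) (x ^ (suc n ∸ i)))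

  -- In this residue class alone neither of the two `fib` values in `lucas-fib` is zero; hence the
  -- factor `1# + x ^ suc r`.
  lucas-mod0 : ∀ r → lucas (suc r ℕ.* 3) ≈ σ (suc r) * ((1# + x ^ suc r) * x ^ pent₀ (suc r))
  lucas-mod0 r = begin
    lucas (suc r ℕ.* 3)
      ≈⟨ lucas-fib (suc (r ℕ.* 3)) ⟩
    fib (suc r ℕ.* 3) - x ^ suc (suc (r ℕ.* 3)) * fib (suc (r ℕ.* 3))
      ≈⟨ +-cong (fib-mod0 (suc r)) (-‿cong (*-congˡ (fib-mod1 r))) ⟩
    σ (suc r) * x ^ pent₀ (suc r) - x ^ suc (suc (r ℕ.* 3)) * (σ r * x ^ pent₁ r)
      ≈⟨ lin₂ (- σ r) (- (x ^ suc r * x ^ pent₀ (suc r))) exponents (σ-suc r)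
          (solve 6 (λ s s′ p y z w → s :* p :- y :* (s′ :* z) :- s :* ((con (+ 1) :+ w) :* p)
             := (:- s′) :* (y :* z :- w :* p) :+ (:- (w :* p)) :* (s :- (:- s′)))
           refl (σ (suc r)) (σ r) (x ^ pent₀ (suc r)) (x ^ suc (suc (r ℕ.* 3))) (x ^ pent₁ r) (x ^ suc r)) ⟩
    σ (suc r) * ((1# + x ^ suc r) * x ^ pent₀ (suc r)) ∎
    where
    exponents : x ^ suc (suc (r ℕ.* 3)) * x ^ pent₁ r ≈ x ^ suc r * x ^ pent₀ (suc r)
    exponents = trans (sym (^-homo-* x (suc (suc (r ℕ.* 3))) (pent₁ r)))
      (trans (^-congʳ x (pent₁≡r+pent₀ (suc r))) (^-homo-* x (suc r) (pent₀ (suc r))))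

  lucas-mod1 : ∀ r → lucas (suc (r ℕ.* 3)) ≈ σ r * x ^ pent₁ r
  lucas-mod1 zero    = trans (+-identityʳ 1#) (sym (trans (*-identityʳ _) ι-1))
  lucas-mod1 (suc r) = begin
    lucas (suc (suc r ℕ.* 3))
      ≈⟨ lucas-fib (suc (suc (r ℕ.* 3))) ⟩
    fib (suc (suc r ℕ.* 3)) - x ^ (suc r ℕ.* 3) * fib (suc (suc (r ℕ.* 3)))
      ≈⟨ +-cong (fib-mod1 (suc r)) (-‿cong (*-congˡ (fib-mod2 r))) ⟩
    σ (suc r) * x ^ pent₁ (suc r) - x ^ (suc r ℕ.* 3) * 0#
      ≈⟨ solve 2 (λ a b → a :- b :* con (+ 0) := a) refl _ _ ⟩
    σ (suc r) * x ^ pent₁ (suc r) ∎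

  lucas-mod2 : ∀ r → lucas (suc (suc (r ℕ.* 3))) ≈ σ (suc r) * x ^ pent₀ (suc r)
  lucas-mod2 r = begin
    lucas (suc (suc (r ℕ.* 3)))
      ≈⟨ lucas-fib (r ℕ.* 3) ⟩
    fib (suc (suc (r ℕ.* 3))) - x ^ suc (r ℕ.* 3) * fib (r ℕ.* 3)
      ≈⟨ +-cong (fib-mod2 r) (-‿cong (*-congˡ (fib-mod0 r))) ⟩
    0# - x ^ suc (r ℕ.* 3) * (σ r * x ^ pent₀ r)
      ≈⟨ solve 3 (λ a s b → con (+ 0) :- a :* (s :* b) := (:- s) :* (a :* b)) refl _ _ _ ⟩
    - σ r * (x ^ suc (r ℕ.* 3) * x ^ pent₀ r)
      ≈⟨ *-cong (σ-suc r) (^-homo-* x (suc (r ℕ.* 3)) (pent₀ r)) ⟨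
    σ (suc r) * x ^ pent₀ (suc r) ∎

-- Gaussian binomials near a root of unity

-- `tet k` is the binomial coefficient `k` choose 3.
tet : ℕ → ℕ
tet zero    = 0
tet (suc k) = tri k ℕ.+ tet k

module RootOfUnity {c ℓ} (R : CommutativeRing c ℓ)
  (hom : ℤ.+-*-rawRing -Raw-AlmostCommutative⟶ fromCommutativeRing R) where

  open RingTools R hom

  -- What remains of "x is a primitive n-th root of unity" modulo Φₙ(x)².
  record IsRoot (x : Carrier) (n : ℕ) : Set (c ⊔ ℓ) where
    field
      nilpotent : (1# - x ^ n) * (1# - x ^ n) ≈ 0#
      regular   : ∀ k → n ∤ k → ∀ y → (1# - x ^ k) * y ≈ 0# → y ≈ 0#

  module Root {x : Carrier} {p : ℕ} (root : IsRoot x (suc p)) where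
    open IsRoot root public
    open Gauss x

    n : ℕ
    n = suc p

    δ : Carrier
    δ = 1# - x ^ n

    cancel : ∀ {k y z} → n ∤ k → (1# - x ^ k) * y ≈ (1# - x ^ k) * z → y ≈ z
    cancel {k} {y} {z} n∤k e = x∙y⁻¹≈ε⇒x≈y y z (regular k n∤k (y - z) (lin₁ 1# e
      (solve 3 (λ a y z → a :* (y :- z) :- con (+ 0) := con (+ 1) :* (a :* y :- a :* z)) refl (1# - x ^ k) y z)))

    n∤small : ∀ {i} → suc i < n → n ∤ suc i
    n∤small = >⇒∤

    -- The binomial expansion of `(1# - δ) ^ a`, cut off after the linear term by `nilpotent`.
    pow-δ : ∀ a → x ^ (a ℕ.* n) ≈ 1# - ν a * δ
    pow-δ zero    = lin₁ δ ι-0 (solve 2 (λ z d → con (+ 1) :- (con (+ 1) :- z :* d) := d :* (z :- con (+ 0))) refl (ν 0) δ)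
    pow-δ (suc a) = trans (^-homo-* x n (a ℕ.* n)) (lin₃ (x ^ n) δ (ν a) (pow-δ a) (ν-suc a) nilpotent
      (solve 4 (λ y u v v′ → let d = con (+ 1) :- y in
           y :* u :- (con (+ 1) :- v′ :* d)
             := y :* (u :- (con (+ 1) :- v :* d)) :+ d :* (v′ :- (con (+ 1) :+ v)) :+ v :* (d :* d :- con (+ 0)))
        refl (x ^ n) (x ^ (a ℕ.* n)) (ν a) (ν (suc a))))

    δ-pow : ∀ a → δ * x ^ (a ℕ.* n) ≈ δ
    δ-pow a = lin₂ δ (- ν a) (pow-δ a) nilpotent
      (solve 3 (λ d u v → d :* u :- d := d :* (u :- (con (+ 1) :- v :* d)) :+ (:- v) :* (d :* d :- con (+ 0)))
        refl δ (x ^ (a ℕ.* n)) (ν a))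

    δ-pow-n : δ * x ^ n ≈ δ
    δ-pow-n = trans (*-congˡ (^-congʳ x (≡.sym (ℕ.*-identityˡ n)))) (δ-pow 1)

    -- Next to a factor `δ`, exponents count only modulo `n`. The congruence of `a` and `b` is given
    -- by multiples added on both sides, which avoids subtraction.
    δ-pow-mod : ∀ a b u v → a ℕ.+ u ℕ.* n ≡ b ℕ.+ v ℕ.* n → δ * x ^ a ≈ δ * x ^ b
    δ-pow-mod a b u v e = begin
      δ * x ^ a                        ≈⟨ shift a u ⟩
      δ * x ^ (a ℕ.+ u ℕ.* n)          ≡⟨ ≡.cong (λ t → δ * x ^ t) e ⟩
      δ * x ^ (b ℕ.+ v ℕ.* n)          ≈⟨ shift b v ⟨
      δ * x ^ b                        ∎
      where
      shift : ∀ a u → δ * x ^ a ≈ δ * x ^ (a ℕ.+ u ℕ.* n)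
      shift a u = sym (trans (*-congˡ (^-homo-* x a (u ℕ.* n))) (lin₁ (x ^ a) (δ-pow u)
        (solve 3 (λ d s t → d :* (s :* t) :- d :* s := s :* (d :* t :- d)) refl δ (x ^ a) (x ^ (u ℕ.* n)))))

    -- Powers of `x` are units: `x ^ a * x ^ (a * p)` is `x ^ (a * n)`, that is `1# - ν a * δ`, with
    -- inverse `1# + ν a * δ`.
    pow-cancel : ∀ a {y z} → x ^ a * y ≈ x ^ a * z → y ≈ z
    pow-cancel a {y} {z} e = lin₃ (w * (1# + ν a * δ)) ((1# + ν a * δ) * (y - z) * - 1#) (ν a * ν a * (y - z)) e inv nilpotent
      (solve 6 (λ s w v d y z → y :- z
          := w :* (con (+ 1) :+ v :* d) :* (s :* y :- s :* z)
          :+ (con (+ 1) :+ v :* d) :* (y :- z) :* (:- con (+ 1)) :* (s :* w :- (con (+ 1) :- v :* d))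
          :+ v :* v :* (y :- z) :* (d :* d :- con (+ 0)))
        refl (x ^ a) w (ν a) δ y z)
      where
      w : Carrier
      w = x ^ (a ℕ.* p)
      inv : x ^ a * w ≈ 1# - ν a * δ
      inv = trans (sym (^-homo-* x a (a ℕ.* p))) (trans (^-congʳ x (≡.sym (ℕ.*-suc a p))) (pow-δ a))

    G-multiple-absorb : ∀ a k → (1# - x ^ suc k) * G x (a ℕ.* n) (suc k) ≈ ν a * δ * G x (a ℕ.* n ∸ 1) k
    G-multiple-absorb zero k = lin₁ (- (δ * G x 0 k)) ι-0
      (solve 4 (λ y v d g → (con (+ 1) :- y) :* con (+ 0) :- v :* d :* g := (:- (d :* g)) :* (v :- con (+ 0)))
        refl (x ^ suc k) (ν 0) δ (G x 0 k))
    G-multiple-absorb (suc a) k = trans (G-absorb (p ℕ.+ a ℕ.* n) k) (*-congʳ (lin₁ (- 1#) (pow-δ (suc a))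
      (solve 2 (λ y vd → con (+ 1) :- y :- vd := (:- con (+ 1)) :* (y :- (con (+ 1) :- vd))) refl _ _)))

    δG≈0 : ∀ a {j} → n ∤ j → δ * G x (a ℕ.* n) j ≈ 0#
    δG≈0 a {zero}  n∤j = ⊥-elim (n∤j (n ∣0))
    δG≈0 a {suc k} n∤j = regular (suc k) n∤j _ (lin₂ δ (ν a * G x (a ℕ.* n ∸ 1) k) (G-multiple-absorb a k) nilpotent
      (solve 5 (λ y d g v h → y :* (d :* g) :- con (+ 0) := d :* (y :* g :- v :* d :* h) :+ v :* h :* (d :* d :- con (+ 0)))
        refl (1# - x ^ suc k) δ (G x (a ℕ.* n) (suc k)) (ν a) (G x (a ℕ.* n ∸ 1) k)))

    δGn≈0 : ∀ {j} → n ∤ j → δ * G x n j ≈ 0#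
    δGn≈0 {j} n∤j = trans (*-congˡ (reflexive (≡.cong (λ t → G x t j) (≡.sym (ℕ.*-identityˡ n))))) (δG≈0 1 n∤j)

    -- After multiplication by the regular element `1# - x ^ i` the first binomial is a multiple of
    -- `δ`, and `δ` annihilates the second by `δG≈0`. This removes the inner terms of the
    -- Vandermonde sum.
    GG≈0 : ∀ {i} b {j} → n ∤ i → n ∤ j → G x n i * G x (b ℕ.* n) j ≈ 0#
    GG≈0 {zero}  b {j} n∤i n∤j = ⊥-elim (n∤i (n ∣0))
    GG≈0 {suc i} b {j} n∤i n∤j = regular (suc i) n∤i _ (lin₂ (G x (b ℕ.* n) j) (G x p i) (G-absorb p i) (δG≈0 b n∤j)
      (solve 5 (λ y g h d k → y :* (g :* h) :- con (+ 0) := h :* (y :* g :- d :* k) :+ k :* (d :* h :- con (+ 0)))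
        refl (1# - x ^ suc i) (G x n (suc i)) (G x (b ℕ.* n) j) δ (G x p i)))

    vandermonde-ends : ∀ a l → G x (n ℕ.+ a ℕ.* n) (l ℕ.+ n)
      ≈ x ^ (n ℕ.* (l ℕ.+ n)) * G x (a ℕ.* n) (l ℕ.+ n) + G x (a ℕ.* n) l + Sum p (λ i →
          x ^ ((p ∸ i) ℕ.* (l ℕ.+ n ∸ suc i)) * (G x n (suc i) * G x (a ℕ.* n) (l ℕ.+ n ∸ suc i)))
    vandermonde-ends a l = begin
      G x (n ℕ.+ a ℕ.* n) (l ℕ.+ n)
        ≈⟨ vandermonde n (a ℕ.* n) (l ℕ.+ n) ⟩
      Sum (suc (l ℕ.+ n)) F
        ≡⟨ ≡.cong (λ t → Sum (suc t) F) (ℕ.+-comm l n) ⟩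
      Sum (suc n ℕ.+ l) F
        ≈⟨ Sum-extend (suc n) l (λ i n<i → zero-fac _ (zero-facˡ _ (G-vanish n<i))) ⟩
      Sum n F + F n
        ≈⟨ +-cong (Sum-head p F) F-last ⟩
      F 0 + Sum p (λ i → F (suc i)) + G x (a ℕ.* n) l
        ≈⟨ solve 4 (λ y g s h → y :* (con (+ 1) :* g) :+ s :+ h := y :* g :+ h :+ s) refl _ _ _ _ ⟩
      x ^ (n ℕ.* (l ℕ.+ n)) * G x (a ℕ.* n) (l ℕ.+ n) + G x (a ℕ.* n) l + Sum p (λ i → F (suc i)) ∎
      where
      F : ℕ → Carrier
      F i = x ^ ((n ∸ i) ℕ.* (l ℕ.+ n ∸ i)) * (G x n i * G x (a ℕ.* n) (l ℕ.+ n ∸ i))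
      F-last : F n ≈ G x (a ℕ.* n) l
      F-last rewrite ℕ.n∸n≡0 p | ℕ.m+n∸n≡m l n = trans (*-identityˡ _) (trans (*-congʳ (G-diag n)) (*-identityˡ _))

    -- Each further period multiplies the previous value by `x ^ (n * n)`, that is `1# - ν n * δ`,
    -- and adds 1. The linear terms therefore accumulate `n` times 0 + 1 + ... + (a-1).
    G-multiple : ∀ a → G x (a ℕ.* n) n ≈ ν a - ν n * ν (tri a) * δ
    G-multiple zero = lin₂ (ν n * δ) (- 1#) ι-0 ι-0
      (solve 3 (λ z m d → con (+ 0) :- (z :- m :* z :* d) := m :* d :* (z :- con (+ 0)) :+ (:- con (+ 1)) :* (z :- con (+ 0)))
        refl (ν 0) (ν n) δ)
    G-multiple (suc a) = begin
      G x (n ℕ.+ a ℕ.* n) n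
        ≈⟨ vandermonde-ends a 0 ⟩
      x ^ (n ℕ.* n) * G x (a ℕ.* n) n + 1# + Sum p _
        ≈⟨ +-cong (+-congʳ (*-cong (pow-δ n) (G-multiple a))) (Sum-zero p (λ i i<p → zero-fac _ (GG≈0 a (n∤small (s<s i<p)) (n∤co i i<p)))) ⟩
      (1# - ν n * δ) * (ν a - ν n * ν (tri a) * δ) + 1# + 0#
        ≈⟨ lin₃ (- 1#) (ν n * δ) (ν n * ν n * ν (tri a)) (ν-suc a) (ν-+ a (tri a)) nilpotent
          (solve 6 (λ m d a t a′ t′ → (con (+ 1) :- m :* d) :* (a :- m :* t :* d) :+ con (+ 1) :+ con (+ 0) :- (a′ :- m :* t′ :* d)
             := (:- con (+ 1)) :* (a′ :- (con (+ 1) :+ a)) :+ m :* d :* (t′ :- (a :+ t)) :+ m :* m :* t :* (d :* d :- con (+ 0)))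
            refl (ν n) δ (ν a) (ν (tri a)) (ν (suc a)) (ν (tri (suc a)))) ⟩
      ν (suc a) - ν n * ν (tri (suc a)) * δ ∎
      where
      n∤co : ∀ i → i < p → n ∤ p ∸ i
      n∤co i i<p rewrite ℕ.+-∸-assoc 1 i<p = n∤small (s≤s (ℕ.≤-trans (ℕ.≤-reflexive (≡.sym (ℕ.+-∸-assoc 1 i<p))) (ℕ.m∸n≤m p i)))

    -- For even n the base q² has order n/2, so the lower index n spans two periods. The factor 3
    -- arises because each step contributes `tri a` twice through `x ^ (n * (n + n))` and once
    -- through `G-multiple`.
    G-multiple₂ : ∀ a → G x (a ℕ.* n) (n ℕ.+ n) ≈ ν (tri a) - ν n * ν (3 ℕ.* tet a) * δ
    G-multiple₂ zero = lin₂ (ν n * δ) (- 1#) ι-0 ι-0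
      (solve 3 (λ z m d → con (+ 0) :- (z :- m :* z :* d) := m :* d :* (z :- con (+ 0)) :+ (:- con (+ 1)) :* (z :- con (+ 0)))
        refl (ν 0) (ν n) δ)
    G-multiple₂ (suc a) = begin
      G x (n ℕ.+ a ℕ.* n) (n ℕ.+ n)
        ≈⟨ vandermonde-ends a n ⟩
      x ^ (n ℕ.* (n ℕ.+ n)) * G x (a ℕ.* n) (n ℕ.+ n) + G x (a ℕ.* n) n + Sum p _
        ≈⟨ +-cong (+-cong (*-cong pow (G-multiple₂ a)) (G-multiple a))
             (Sum-zero p (λ i i<p → zero-fac _ (GG≈0 a (n∤small (s<s i<p)) (n∤co i i<p)))) ⟩
      (1# - (ν n + ν n) * δ) * (ν (tri a) - ν n * ν (3 ℕ.* tet a) * δ) + (ν a - ν n * ν (tri a) * δ) + 0#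
        ≈⟨ lin₃ (- 1#) (ν n * δ) (ν n * (ν n + ν n) * ν (3 ℕ.* tet a)) (ν-+ a (tri a)) tet-step nilpotent
          (solve 7 (λ m d a t u w u′ →
             (con (+ 1) :- (m :+ m) :* d) :* (t :- m :* u :* d) :+ (a :- m :* t :* d) :+ con (+ 0) :- (w :- m :* u′ :* d)
             := (:- con (+ 1)) :* (w :- (a :+ t)) :+ m :* d :* (u′ :- (t :+ t :+ t :+ u)) :+ m :* (m :+ m) :* u :* (d :* d :- con (+ 0)))
            refl (ν n) δ (ν a) (ν (tri a)) (ν (3 ℕ.* tet a)) (ν (tri (suc a))) (ν (3 ℕ.* tet (suc a)))) ⟩
      ν (tri (suc a)) - ν n * ν (3 ℕ.* tet (suc a)) * δ ∎
      where
      pow : x ^ (n ℕ.* (n ℕ.+ n)) ≈ 1# - (ν n + ν n) * δ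
      pow = trans (^-congʳ x (ℕ.*-comm n (n ℕ.+ n))) (trans (pow-δ (n ℕ.+ n)) (+-congˡ (-‿cong (*-congʳ (ν-+ n n)))))
      tet-step : ν (3 ℕ.* tet (suc a)) ≈ ν (tri a) + ν (tri a) + ν (tri a) + ν (3 ℕ.* tet a)
      tet-step = trans (reflexive (≡.cong ν (ℕS.solve 2 (λ t u → # 3 ⊠ (t ⊞ u) ≗ (t ⊞ t ⊞ t) ⊞ # 3 ⊠ u) ≡.refl (tri a) (tet a))))
        (trans (ν-+ _ (3 ℕ.* tet a)) (+-congʳ (trans (ν-+ _ (tri a)) (+-congʳ (ν-+ _ _)))))
        where open ℕS hiding (solve)
      n∤co : ∀ i → i < p → n ∤ n ℕ.+ n ∸ suc i
      n∤co i i<p n∣ = n∤small {p ∸ suc i} (s≤s (ℕ.≤-trans (ℕ.≤-reflexive (≡.sym (ℕ.+-∸-assoc 1 i<p))) (ℕ.m∸n≤m p i)))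
        (∣m+n∣m⇒∣n (≡.subst (n ∣_) (≡.trans (ℕ.+-∸-assoc n (ℕ.m<n⇒m<1+n i<p)) (≡.cong (n ℕ.+_) (ℕ.+-∸-assoc 1 i<p))) n∣) n∣n)

    -- The q-Lucas theorem one period at a time: next to `δ`, a period added to the upper entry is
    -- invisible below the index `n`. The start is row `n`, whose inner entries `δ` annihilates; the
    -- Pascal rule carries this to all rows.
    lucas-low : ∀ N {j} → j < n → δ * G x (N ℕ.+ n) j ≈ δ * G x N j
    lucas-low N       {zero}  _   = refl
    lucas-low zero    {suc j} j<n = trans (δGn≈0 (n∤small j<n)) (sym (zeroʳ δ))
    lucas-low (suc N) {suc j} j<n = lin₂ 1# (x ^ suc j) (lucas-low N (ℕ.<-trans (ℕ.n<1+n j) j<n)) (lucas-low N j<n)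
      (solve 6 (λ d y a b a′ b′ → d :* (a :+ y :* b) :- d :* (a′ :+ y :* b′)
          := con (+ 1) :* (d :* a :- d :* a′) :+ y :* (d :* b :- d :* b′))
        refl δ (x ^ suc j) (G x (N ℕ.+ n) j) (G x (N ℕ.+ n) (suc j)) (G x N j) (G x N (suc j)))

    lucas-low* : ∀ a N {j} → j < n → δ * G x (a ℕ.* n ℕ.+ N) j ≈ δ * G x N j
    lucas-low* zero    N j<n = refl
    lucas-low* (suc a) N {j} j<n = trans
      (*-congˡ (reflexive (≡.cong (λ t → G x t j) (ℕS.solve 3 (λ a b c → a ⊞ b ⊞ c ≗ b ⊞ c ⊞ a) ≡.refl n (a ℕ.* n) N))))
      (trans (lucas-low (a ℕ.* n ℕ.+ N) j<n) (lucas-low* a N j<n))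
      where open ℕS hiding (solve)

    -- At indices from `n` on, the added period contributes a second copy shifted by `n`. It enters
    -- through the entry of index `n` in row `n`, which is 1.
    lucas-high : ∀ N {i} → i < n → δ * G x (N ℕ.+ n) (i ℕ.+ n) ≈ δ * (G x N (i ℕ.+ n) + G x N i)
    lucas-high zero    {zero}  i<n = *-congˡ (trans (G-diag n) (sym (+-identityˡ 1#)))
    lucas-high zero    {suc i} i<n = *-congˡ (trans (G-vanish (s≤s (ℕ.m≤n+m n i))) (sym (+-identityˡ 0#)))
    lucas-high (suc N) {zero}  i<n = lin₃ 1# (x ^ n) 1# (lucas-low N (ℕ.n<1+n p)) (lucas-high N i<n) δ-pow-n
      (solve 6 (λ d y a b a′ b′ → d :* (a :+ y :* b) :- d :* (a′ :+ y :* b′ :+ con (+ 1))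
          := con (+ 1) :* (d :* a :- d :* a′) :+ y :* (d :* b :- d :* (b′ :+ con (+ 1))) :+ con (+ 1) :* (d :* y :- d))
        refl δ (x ^ n) (G x (N ℕ.+ n) p) (G x (N ℕ.+ n) n) (G x N p) (G x N n))
    lucas-high (suc N) {suc i} i<n = lin₃ 1# (x ^ suc (i ℕ.+ n)) (G x N (suc i))
      (lucas-high N (ℕ.<-trans (ℕ.n<1+n i) i<n)) (lucas-high N i<n)
      (δ-pow-mod (suc i ℕ.+ n) (suc i) 0 1 (≡.cong suc (≡.trans (ℕ.+-identityʳ _) (≡.cong (i ℕ.+_) (≡.sym (ℕ.*-identityˡ n))))))
      (solve 9 (λ d y y′ a b a′ b′ a″ b″ → d :* (a :+ y :* b) :- d :* (a′ :+ y :* b′ :+ (a″ :+ y′ :* b″))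
          := con (+ 1) :* (d :* a :- d :* (a′ :+ a″)) :+ y :* (d :* b :- d :* (b′ :+ b″)) :+ b″ :* (d :* y :- d :* y′))
        refl δ (x ^ suc (i ℕ.+ n)) (x ^ suc i) (G x (N ℕ.+ n) (i ℕ.+ n)) (G x (N ℕ.+ n) (suc (i ℕ.+ n)))
             (G x N (i ℕ.+ n)) (G x N (suc (i ℕ.+ n))) (G x N i) (G x N (suc i)))

    lucas-high* : ∀ a N {i} → i < n → δ * G x (a ℕ.* n ℕ.+ N) (i ℕ.+ n) ≈ δ * (G x N (i ℕ.+ n) + ν a * G x N i)
    lucas-high* zero    N {i} i<n = lin₁ (- (δ * G x N i)) ι-0
      (solve 4 (λ d g z h → d :* g :- d :* (g :+ z :* h) := (:- (d :* h)) :* (z :- con (+ 0))) refl δ (G x N (i ℕ.+ n)) (ν 0) (G x N i))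
    lucas-high* (suc a) N {i} i<n = begin
      δ * G x (n ℕ.+ a ℕ.* n ℕ.+ N) (i ℕ.+ n)
        ≡⟨ ≡.cong (λ t → δ * G x t (i ℕ.+ n)) (ℕS.solve 3 (λ a b c → a ⊞ b ⊞ c ≗ b ⊞ c ⊞ a) ≡.refl n (a ℕ.* n) N) ⟩
      δ * G x (a ℕ.* n ℕ.+ N ℕ.+ n) (i ℕ.+ n)
        ≈⟨ lucas-high (a ℕ.* n ℕ.+ N) i<n ⟩
      δ * (G x (a ℕ.* n ℕ.+ N) (i ℕ.+ n) + G x (a ℕ.* n ℕ.+ N) i)
        ≈⟨ lin₃ 1# 1# (- (δ * G x N i)) (lucas-high* a N i<n) (lucas-low* a N i<n) (ν-suc a)
          (solve 7 (λ d g h g′ h′ v v′ → d :* (g :+ h) :- d :* (g′ :+ v′ :* h′)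
             := con (+ 1) :* (d :* g :- d :* (g′ :+ v :* h′)) :+ con (+ 1) :* (d :* h :- d :* h′) :+ (:- (d :* h′)) :* (v′ :- (con (+ 1) :+ v)))
            refl δ (G x (a ℕ.* n ℕ.+ N) (i ℕ.+ n)) (G x (a ℕ.* n ℕ.+ N) i) (G x N (i ℕ.+ n)) (G x N i) (ν a) (ν (suc a))) ⟩
      δ * (G x N (i ℕ.+ n) + ν (suc a) * G x N i) ∎
      where open ℕS hiding (solve)

    -- Row `n` is annihilated by `δ` at inner indices, so the Pascal rule makes neighbouring entries
    -- of row `n - 1` differ by the factor `- x ^ suc j`.
    negation₀ : ∀ j → j < n → δ * (x ^ tri (suc j) * G x p j) ≈ σ j * δ
    negation₀ zero    _   = lin₁ (- δ) ι-1
      (solve 2 (λ d s → d :* (con (+ 1) :* con (+ 1)) :- s :* d := (:- d) :* (s :- con (+ 1))) refl δ (σ 0))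
    negation₀ (suc j) j<n = begin
      δ * (x ^ tri (suc (suc j)) * h)          ≈⟨ *-congˡ (*-congʳ (^-homo-* x (suc j) (tri (suc j)))) ⟩
      δ * (x ^ suc j * x ^ tri (suc j) * h)
        ≈⟨ lin₃ (x ^ tri (suc j)) (- 1#) (- δ) (δGn≈0 (n∤small j<n)) (negation₀ j (ℕ.<-trans (ℕ.n<1+n j) j<n)) (σ-suc j)
          (solve 7 (λ d y t g h s s′ → d :* (y :* t :* h) :- s′ :* d
             := t :* (d :* (g :+ y :* h) :- con (+ 0)) :+ (:- con (+ 1)) :* (d :* (t :* g) :- s :* d) :+ (:- d) :* (s′ :- (:- s)))
            refl δ (x ^ suc j) (x ^ tri (suc j)) (G x p j) h (σ j) (σ (suc j))) ⟩
      σ (suc j) * δ ∎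
      where
      h : Carrier
      h = G x p (suc j)

    -- The reflection [-b-1, j] = (-1)ʲ x^{-bj-j(j+1)/2} [b+j, j], with -b-1 read modulo n.
    negation : ∀ b c j → c ℕ.+ suc b ≡ n → j < n →
               δ * (x ^ (j ℕ.* b ℕ.+ tri (suc j)) * G x c j) ≈ σ j * (δ * G x (b ℕ.+ j) j)
    negation b c zero _ _ = lin₁ (- δ) ι-1
      (solve 2 (λ d s → d :* (con (+ 1) :* con (+ 1)) :- s :* (d :* con (+ 1)) := (:- d) :* (s :- con (+ 1))) refl δ (σ 0))
    negation zero c (suc j) eq j<n rewrite ℕ.suc-injective (≡.trans (≡.sym (ℕ.+-comm c 1)) eq) | ℕ.*-zeroʳ j =
      trans (negation₀ (suc j) j<n) (*-congˡ (sym (trans (*-congˡ (G-diag (suc j))) (*-identityʳ δ))))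
    negation (suc b) c (suc j) eq j<n = begin
      δ * (x ^ (suc j ℕ.* suc b ℕ.+ tri (suc (suc j))) * h)
        ≈⟨ *-congˡ (*-congʳ (trans (^-congʳ x e-eq) (^-homo-* x (suc j) E))) ⟩
      δ * (x ^ suc j * x ^ E * h)
        -- The entry is isolated from the Pascal rule for `G x (suc c) (suc j)`. The induction
        -- hypothesis at smaller `b` evaluates the left side of that rule, and the one at smaller
        -- `j` evaluates its other summand; `pascal` then joins the two reflected values.
        ≈⟨ lin₃ 1# (- (δ * g)) (- x ^ suc b) (negation b (suc c) (suc j) (≡.trans (≡.sym (ℕ.+-suc c (suc b))) eq) j<n)
             (trans (^-congʳ x E-eq) (^-homo-* x (suc b) F))
             (negation (suc b) c j eq (ℕ.<-trans (ℕ.n<1+n j) j<n))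
          (solve 11 (λ d y w f g h z s s′ u v →
             d :* (y :* w :* h) :- (s′ :* (d :* u) :- z :* (s :* (d :* f)))
             := con (+ 1) :* (d :* (w :* (g :+ y :* h)) :- s′ :* (d :* u))
                :+ (:- (d :* g)) :* (w :- z :* v)
                :+ (:- z) :* (d :* (v :* g) :- s :* (d :* f)))
            refl δ (x ^ suc j) (x ^ E) (G x (suc b ℕ.+ j) j) g h (x ^ suc b) (σ j) (σ (suc j)) (G x (b ℕ.+ suc j) (suc j)) (x ^ F)) ⟩
      σ (suc j) * (δ * G x (b ℕ.+ suc j) (suc j)) - x ^ suc b * (σ j * (δ * G x (suc b ℕ.+ j) j))
        ≈⟨ lin₂ (- (σ (suc j) * δ)) (- (x ^ suc b * (δ * G x (suc b ℕ.+ j) j))) pascal (σ-suc j)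
          (solve 7 (λ d f z s s′ u w → s′ :* (d :* u) :- z :* (s :* (d :* f)) :- s′ :* (d :* w)
             := (:- (s′ :* d)) :* (w :- (z :* f :+ u)) :+ (:- (z :* (d :* f))) :* (s′ :- (:- s)))
            refl δ (G x (suc b ℕ.+ j) j) (x ^ suc b) (σ j) (σ (suc j)) (G x (b ℕ.+ suc j) (suc j)) (G x (suc b ℕ.+ suc j) (suc j))) ⟩
      σ (suc j) * (δ * G x (suc b ℕ.+ suc j) (suc j)) ∎
      where
      E F : ℕ
      E = suc j ℕ.* b ℕ.+ tri (suc (suc j))
      F = j ℕ.* suc b ℕ.+ tri (suc j)
      g h : Carrier
      g = G x c j
      h = G x c (suc j)
      e-eq : suc j ℕ.* suc b ℕ.+ tri (suc (suc j)) ≡ suc j ℕ.+ E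
      e-eq = ℕS.solve 3 (λ j b t → (# 1 ⊞ j) ⊠ (# 1 ⊞ b) ⊞ t ≗ (# 1 ⊞ j) ⊞ ((# 1 ⊞ j) ⊠ b ⊞ t)) ≡.refl j b (tri (suc (suc j)))
        where open ℕS hiding (solve)
      E-eq : E ≡ suc b ℕ.+ F
      E-eq = ℕS.solve 3 (λ j b t → (# 1 ⊞ j) ⊠ b ⊞ (# 1 ⊞ j ⊞ t) ≗ (# 1 ⊞ b) ⊞ (j ⊠ (# 1 ⊞ b) ⊞ t)) ≡.refl j b (tri (suc j))
        where open ℕS hiding (solve)
      pascal : G x (suc b ℕ.+ suc j) (suc j) ≈ x ^ suc b * G x (suc b ℕ.+ j) j + G x (b ℕ.+ suc j) (suc j)
      pascal = trans (G-pascal′ (b ℕ.+ suc j) j) (+-congʳ (*-cong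
        (^-congʳ x (≡.trans (≡.cong (_∸ j) (ℕ.+-suc b j)) (ℕ.m+n∸n≡m (suc b) j)))
        (reflexive (≡.cong (λ t → G x t j) (ℕ.+-suc b j)))))

-- The congruence in an abstract ring

tri-double : ∀ k → tri (suc k) ℕ.+ tri (suc k) ≡ suc k ℕ.* k
tri-double zero    = ≡.refl
tri-double (suc k) = ≡.trans
  (solve 2 (λ k t → # 1 ⊞ k ⊞ t ⊞ (# 1 ⊞ k ⊞ t) ≗ # 2 ⊠ (# 1 ⊞ k) ⊞ (t ⊞ t)) ≡.refl k (tri (suc k)))
  (≡.trans (≡.cong (2 ℕ.* suc k ℕ.+_) (tri-double k))
    (solve 1 (λ k → # 2 ⊠ (# 1 ⊞ k) ⊞ (# 1 ⊞ k) ⊠ k ≗ (# 2 ⊞ k) ⊠ (# 1 ⊞ k)) ≡.refl k))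
  where open ℕS

tet-sextuple : ∀ k → 6 ℕ.* tet (suc (suc k)) ≡ suc (suc k) ℕ.* (suc k ℕ.* k)
tet-sextuple zero    = ≡.refl
tet-sextuple (suc k) = ≡.trans
  (solve 2 (λ t u → # 6 ⊠ (t ⊞ u) ≗ # 3 ⊠ (t ⊞ t) ⊞ # 6 ⊠ u) ≡.refl (tri (suc (suc k))) (tet (suc (suc k))))
  (≡.trans (≡.cong₂ (λ u v → 3 ℕ.* u ℕ.+ v) (tri-double (suc k)) (tet-sextuple k))
    (solve 1 (λ k → # 3 ⊠ ((# 2 ⊞ k) ⊠ (# 1 ⊞ k)) ⊞ (# 2 ⊞ k) ⊠ ((# 1 ⊞ k) ⊠ k)
        ≗ (# 3 ⊞ k) ⊠ ((# 2 ⊞ k) ⊠ (# 1 ⊞ k))) ≡.refl k))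
  where open ℕS

-- Origin of m(2m-1): the term `k = 0` is [2mn,n], whose linear coefficient is `n` times 2m choose
-- 2.
tri-even : ∀ m → tri (suc m ℕ.+ suc m) ≡ suc m ℕ.* suc (m ℕ.+ m)
tri-even m = ℕ.*-cancelˡ-≡ _ _ 2 (≡.trans
  (solve 1 (λ t → # 2 ⊠ t ≗ t ⊞ t) ≡.refl (tri (suc m ℕ.+ suc m)))
  (≡.trans (tri-double (m ℕ.+ suc m))
    (solve 1 (λ m → (# 1 ⊞ (m ⊞ (# 1 ⊞ m))) ⊠ (m ⊞ (# 1 ⊞ m)) ≗ # 2 ⊠ ((# 1 ⊞ m) ⊠ (# 1 ⊞ (m ⊞ m)))) ≡.refl m)))
  where open ℕS

-- For even n the last term has `n / 2` times this number as linear coefficient; the factor 2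
-- completes `n / 2` to `n`.
tet-even : ∀ m → 3 ℕ.* tet (suc m ℕ.+ suc m) ≡ 2 ℕ.* (suc (m ℕ.+ m) ℕ.* (suc m ℕ.* m))
tet-even m = ℕ.*-cancelˡ-≡ _ _ 2 (≡.trans
  (≡.cong (λ u → 2 ℕ.* (3 ℕ.* tet u)) (≡.cong suc (ℕ.+-suc m m)))
  (≡.trans (solve 1 (λ t → # 2 ⊠ (# 3 ⊠ t) ≗ # 6 ⊠ t) ≡.refl (tet (suc (suc (m ℕ.+ m)))))
  (≡.trans (tet-sextuple (m ℕ.+ m))
    (solve 1 (λ m → (# 2 ⊞ (m ⊞ m)) ⊠ ((# 1 ⊞ (m ⊞ m)) ⊠ (m ⊞ m)) ≗ # 2 ⊠ (# 2 ⊠ ((# 1 ⊞ (m ⊞ m)) ⊠ ((# 1 ⊞ m) ⊠ m)))) ≡.refl m))))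
  where open ℕS

tri-+ : ∀ a b → tri (a ℕ.+ b) ≡ tri a ℕ.+ tri b ℕ.+ a ℕ.* b
tri-+ zero    b = ≡.sym (ℕ.+-identityʳ (tri b))
tri-+ (suc a) b = ≡.trans (≡.cong (a ℕ.+ b ℕ.+_) (tri-+ a b))
  (solve 4 (λ a b t u → a ⊞ b ⊞ (t ⊞ u ⊞ a ⊠ b) ≗ a ⊞ t ⊞ u ⊞ (b ⊞ a ⊠ b)) ≡.refl a b (tri a) (tri b))
  where open ℕS

even≢odd : ∀ k h → k ℕ.+ k ≢ suc (h ℕ.+ h)
even≢odd (suc k) zero    eq rewrite ℕ.+-suc k k with () ← eq
even≢odd (suc k) (suc h) eq rewrite ℕ.+-suc k k | ℕ.+-suc h h = even≢odd k h (ℕ.suc-injective (ℕ.suc-injective eq))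

module Congruence {c ℓ} (R : CommutativeRing c ℓ)
  (hom : ℤ.+-*-rawRing -Raw-AlmostCommutative⟶ fromCommutativeRing R)
  (q : CommutativeRing.Carrier R) (m′ p : ℕ)
  (root : RootOfUnity.IsRoot R hom q (suc p)) where

  open RingTools R hom
  open RootOfUnity R hom
  open Gauss q
  open LucasSums R hom q using (lucasTerm; lucas)
  open Root root

  m : ℕ
  m = suc m′

  Q : Carrier
  Q = q * q

  Q-pow-sq : ∀ k → Q ^ k ≈ q ^ k * q ^ k
  Q-pow-sq zero    = sym (*-identityˡ 1#)
  Q-pow-sq (suc k) = trans (*-congˡ (Q-pow-sq k)) (solve 2 (λ a b → a :* a :* (b :* b) := a :* b :* (a :* b)) refl q (q ^ k))

  Q-pow : ∀ k → Q ^ k ≈ q ^ (k ℕ.+ k)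
  Q-pow k = trans (Q-pow-sq k) (sym (^-homo-* q k k))

  term : ℕ → Carrier
  term k = σ k * (G Q (m ℕ.* n) k * G q (2 ℕ.* (m ℕ.* n) ∸ 2 ℕ.* k) (n ∸ k))

  term-as : ∀ {k j N} → k ℕ.+ j ≡ n → N ℕ.+ 2 ℕ.* k ≡ 2 ℕ.* (m ℕ.* n) → term k ≈ σ k * (G Q (m ℕ.* n) k * G q N j)
  term-as {k} {j} {N} k+j≡n N+2k≡ = *-congˡ (*-congˡ (reflexive (≡.cong₂ (G q)
    (≡.trans (≡.cong (_∸ 2 ℕ.* k) (≡.sym N+2k≡)) (ℕ.m+n∸n≡m N (2 ℕ.* k)))
    (≡.trans (≡.cong (_∸ k) (≡.sym k+j≡n)) (ℕ.m+n∸m≡n k j)))))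

  lucasTerm-as : ∀ {k i} → suc k ℕ.+ suc i ≡ n →
    lucasTerm n i ≈ σ (suc i) * q ^ tri (suc i) * (G q (suc k) (suc i) + q ^ suc k * G q k i)
  lucasTerm-as {k} {i} eq = *-congˡ (+-cong
    (reflexive (≡.cong (λ t → G q t (suc i)) e₁))
    (*-cong (^-congʳ q e₁) (reflexive (≡.cong (λ t → G q t i) e₂))))
    where
    e₁ : n ∸ suc i ≡ suc k
    e₁ = ≡.trans (≡.cong (_∸ suc i) (≡.sym eq)) (ℕ.m+n∸n≡m (suc k) (suc i))
    e₂ : n ∸ suc (suc i) ≡ k
    e₂ = ≡.trans (≡.cong (_∸ suc (suc i)) (≡.trans (≡.sym eq) (≡.sym (ℕ.+-suc k (suc i))))) (ℕ.m+n∸n≡m k (suc (suc i)))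

  -- With `y = q ^ suc k` and `z = q ^ suc i`, absorption turns `(1 - y)` times the second binomial
  -- into `(1 - z)` times the first. Then `1 - y + y (1 - z) = 1 - y z`, and `y z = q ^ n`.
  lucasTerm-clear : ∀ {k i} → suc k ℕ.+ suc i ≡ n →
    (1# - q ^ suc k) * lucasTerm n i ≈ σ (suc i) * q ^ tri (suc i) * (δ * G q (suc k) (suc i))
  lucasTerm-clear {k} {i} eq = trans (*-congˡ (lucasTerm-as eq))
    (lin₂ (- (s * q ^ suc k)) (- (s * g)) (G-absorb k i)
      (trans (sym (^-homo-* q (suc k) (suc i))) (^-congʳ q eq))
      (solve 6 (λ s y z w g h → (con (+ 1) :- y) :* (s :* (g :+ y :* h)) :- s :* ((con (+ 1) :- w) :* g)
         := (:- (s :* y)) :* ((con (+ 1) :- z) :* g :- (con (+ 1) :- y) :* h) :+ (:- (s :* g)) :* (y :* z :- w))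
        refl s (q ^ suc k) (q ^ suc i) (q ^ n) g (G q k i)))
    where
    s g : Carrier
    s = σ (suc i) * q ^ tri (suc i)
    g = G q (suc k) (suc i)

  central : ∀ i → suc i < n → G q (suc i ℕ.+ suc i) (suc i) ≈ (1# + q ^ suc i) * G q (i ℕ.+ suc i) (suc i)
  central i i<n = lin₂ 1# (- (q ^ suc i)) pascal halves
    (solve 4 (λ y a b g → g :- (con (+ 1) :+ y) :* b := con (+ 1) :* (g :- (y :* a :+ b)) :+ (:- y) :* (b :- a))
      refl (q ^ suc i) (G q (i ℕ.+ suc i) i) (G q (i ℕ.+ suc i) (suc i)) (G q (suc i ℕ.+ suc i) (suc i)))
    where
    e : i ℕ.+ suc i ∸ i ≡ suc i
    e = ℕ.m+n∸m≡n i (suc i)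
    pascal : G q (suc i ℕ.+ suc i) (suc i) ≈ q ^ suc i * G q (i ℕ.+ suc i) i + G q (i ℕ.+ suc i) (suc i)
    pascal = trans (G-pascal′ (i ℕ.+ suc i) i) (+-congʳ (*-congʳ (^-congʳ q e)))
    halves : G q (i ℕ.+ suc i) (suc i) ≈ G q (i ℕ.+ suc i) i
    -- In the middle of an odd row `G-step` has the same factor on both sides, so regularity yields
    -- this instance of symmetry.
    halves = cancel (n∤small i<n) (trans (G-step (i ℕ.+ suc i) i) (*-congʳ (+-congˡ (-‿cong (^-congʳ q e)))))

  -- The right-hand side of the theorem with `c` in place of (-1)ⁿ((1+(-1)ⁿ)(m-1)+1). Only `c = -1`
  -- for odd n and `c = 2m-1` for even n occur.
  value : Carrier → Carrier
  value c = ν (m ℕ.+ m) - ν n * (ν m * ν (suc (m′ ℕ.+ m′))) * δ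
    + c * (ν m - ν n * (ν m * ν m′) * δ + ν (m ℕ.+ m) * (lucas n - 1#))

  -- The parity of n matters only for these three facts: it decides whether q² has
  -- order n or n/2, and whether k = n/2 occurs.
  module Middle (C : Carrier)
    (upper : ∀ k → suc k < n → n < suc k ℕ.+ suc k →
             (1# - Q ^ suc k) * G Q (m ℕ.* n) (suc k) * Q ^ tri (suc k) ≈ C * (σ (suc k) * δ))
    (factor : ∀ k → ∃ λ W → (1# - Q ^ suc k) * G Q (m ℕ.* n) (suc k) ≈ δ * W)
    (half : ∀ k → suc k ℕ.+ suc k ≡ n → term (suc k) ≈ C * lucasTerm n k) where

    -- The range k > n/2, with j = n - k < k. Both sides are multiplied by the regular element 1 -
    -- q²ᵏ and by the unit Q^(k(k-1)/2), which brings the left side into the form required by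
    -- `upper`. On the right 1 - q²ᵏ = (1 - qᵏ)(1 + qᵏ), and the first factor clears the q-Lucas
    -- summand.
    above : ∀ k i → suc k ℕ.+ suc i ≡ n → i < k → term (suc k) ≈ C * lucasTerm n i
    above k i eq i<k = cancel n∤2k (pow-cancel (tri (suc k) ℕ.+ tri (suc k)) (begin
      q ^ (tri (suc k) ℕ.+ tri (suc k)) * ((1# - q ^ (suc k ℕ.+ suc k)) * term (suc k))
        ≈⟨ *-cong (Q-pow (tri (suc k))) (*-cong (+-congˡ (-‿cong (Q-pow (suc k)))) (sym (term-as {suc k} {suc i} {N} eq N-eq))) ⟨
      Q ^ tri (suc k) * ((1# - Q ^ suc k) * (σ (suc k) * (G Q (m ℕ.* n) (suc k) * G q N (suc i))))
        ≈⟨ lin₁ (σ (suc k) * G q N (suc i)) (upper k k<n (≡.subst (_< suc k ℕ.+ suc k) eq (s<s (ℕ.+-monoʳ-< k (s<s i<k)))))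
          (solve 7 (λ t y s g h C d → t :* (y :* (s :* (g :* h))) :- C :* (s :* s) :* (d :* h)
             := s :* h :* (y :* g :* t :- C :* (s :* d)))
            refl (Q ^ tri (suc k)) (1# - Q ^ suc k) (σ (suc k)) (G Q (m ℕ.* n) (suc k)) (G q N (suc i)) C δ) ⟩
      C * (σ (suc k) * σ (suc k)) * (δ * G q N (suc i))
        ≈⟨ *-cong (trans (*-congˡ (σ²≈1 (suc k))) (*-identityʳ C)) (lucas-low* (m′ ℕ.+ m′) (suc i ℕ.+ suc i) i<n) ⟩
      C * (δ * G q (suc i ℕ.+ suc i) (suc i))
        ≈⟨ *-congˡ core ⟩
      C * (σ (suc i) * (δ * (1# + q ^ suc k) * q ^ T * q ^ tri (suc i)) * G q (suc k) (suc i))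
        ≈⟨ lin₂ (- (C * q ^ T * (1# + q ^ suc k))) (C * q ^ T * lucasTerm n i) (lucasTerm-clear eq)
             (^-homo-* q (suc k) (suc k))
          (solve 9 (λ C s d y w t g l z →
             C :* (s :* (d :* (con (+ 1) :+ y) :* w :* t) :* g) :- w :* ((con (+ 1) :- z) :* (C :* l))
             := (:- (C :* w :* (con (+ 1) :+ y))) :* ((con (+ 1) :- y) :* l :- s :* t :* (d :* g))
               :+ C :* w :* l :* (z :- y :* y))
            refl C (σ (suc i)) δ (q ^ suc k) (q ^ T) (q ^ tri (suc i)) (G q (suc k) (suc i)) (lucasTerm n i) (q ^ (suc k ℕ.+ suc k))) ⟩
      q ^ T * ((1# - q ^ (suc k ℕ.+ suc k)) * (C * lucasTerm n i)) ∎))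
      where
      N T : ℕ
      -- This is 2mn - 2k, because 2n - 2k = 2j; a multiple of `n` split off in this way is
      -- discarded by `lucas-low*`.
      N = (m′ ℕ.+ m′) ℕ.* n ℕ.+ (suc i ℕ.+ suc i)
      T = tri (suc k) ℕ.+ tri (suc k)
      k<n : suc k < n
      k<n = ≡.subst (suc k <_) eq (ℕ.m<m+n (suc k) z<s)
      i<n : suc i < n
      i<n = ≡.subst (suc i <_) eq (ℕ.m<n+m (suc i) z<s)
      N-eq : N ℕ.+ 2 ℕ.* suc k ≡ 2 ℕ.* (m ℕ.* n)
      N-eq = ≡.trans
        (solveℕ 4 (λ m k i n → (m ⊞ m) ⊠ n ⊞ (# 1 ⊞ i ⊞ (# 1 ⊞ i)) ⊞ # 2 ⊠ (# 1 ⊞ k) ≗ # 2 ⊠ ((# 1 ⊞ k) ⊞ (# 1 ⊞ i) ⊞ m ⊠ n)) ≡.refl m′ k i n)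
        (≡.cong (λ t → 2 ℕ.* (t ℕ.+ m′ ℕ.* n)) eq)
        where open ℕS renaming (solve to solveℕ)
      n∤2k : n ∤ suc k ℕ.+ suc k
      n∤2k n∣2k = n∤small {k ∸ suc i} (ℕ.≤-<-trans (≡.subst (_≤ k) (ℕ.+-∸-assoc 1 i<k) (ℕ.m∸n≤m k i)) (ℕ.<-trans (ℕ.n<1+n k) k<n))
        (∣m+n∣m⇒∣n (≡.subst (n ∣_) split n∣2k) n∣n)
        where
        split : suc k ℕ.+ suc k ≡ n ℕ.+ suc (k ∸ suc i)
        split = ≡.sym (≡.trans (≡.cong₂ ℕ._+_ (≡.sym eq) (≡.sym (ℕ.+-∸-assoc 1 i<k)))
          (≡.trans (ℕ.+-assoc (suc k) (suc i) (k ∸ i)) (≡.cong (λ t → suc k ℕ.+ suc t) (ℕ.m+[n∸m]≡n (ℕ.<⇒≤ i<k)))))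
      E : ℕ
      E = suc i ℕ.* i ℕ.+ tri (suc (suc i))
      -- With k = n - j the exponents are k² + j(j-1)/2 on the left and `E`, which is j² + j(j-1)/2,
      -- on the right. The witnesses come from k² + 2jn = j² + n². For `pow₂`, -k and +j are added
      -- and one more `n` balances them.
      pow₁ : δ * q ^ (suc k ℕ.+ (T ℕ.+ tri (suc i))) ≈ δ * q ^ E
      pow₁ = δ-pow-mod (suc k ℕ.+ (T ℕ.+ tri (suc i))) E (suc i ℕ.+ suc i) n (≡.trans
        (≡.cong₂ (λ t u → suc k ℕ.+ (t ℕ.+ tri (suc i)) ℕ.+ (suc i ℕ.+ suc i) ℕ.* u) (tri-double k) (≡.sym eq))
        (≡.trans (solveℕ 3 (λ k i t → # 1 ⊞ k ⊞ ((# 1 ⊞ k) ⊠ k ⊞ t) ⊞ (# 1 ⊞ i ⊞ (# 1 ⊞ i)) ⊠ (# 1 ⊞ k ⊞ (# 1 ⊞ i))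
            ≗ (# 1 ⊞ i) ⊠ i ⊞ (# 1 ⊞ i ⊞ t) ⊞ (# 1 ⊞ k ⊞ (# 1 ⊞ i)) ⊠ (# 1 ⊞ k ⊞ (# 1 ⊞ i))) ≡.refl k i (tri (suc i)))
          (≡.cong (λ u → E ℕ.+ u ℕ.* u) eq)))
        where open ℕS renaming (solve to solveℕ)
      pow₂ : δ * q ^ (T ℕ.+ tri (suc i)) ≈ δ * q ^ (suc i ℕ.+ E)
      pow₂ = δ-pow-mod (T ℕ.+ tri (suc i)) (suc i ℕ.+ E) (suc (suc i ℕ.+ suc i)) n (≡.trans
        (≡.cong₂ (λ t u → t ℕ.+ tri (suc i) ℕ.+ suc (suc i ℕ.+ suc i) ℕ.* u) (tri-double k) (≡.sym eq))
        (≡.trans (solveℕ 3 (λ k i t → (# 1 ⊞ k) ⊠ k ⊞ t ⊞ (# 1 ⊞ (# 1 ⊞ i ⊞ (# 1 ⊞ i))) ⊠ (# 1 ⊞ k ⊞ (# 1 ⊞ i))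
            ≗ # 1 ⊞ i ⊞ ((# 1 ⊞ i) ⊠ i ⊞ (# 1 ⊞ i ⊞ t)) ⊞ (# 1 ⊞ k ⊞ (# 1 ⊞ i)) ⊠ (# 1 ⊞ k ⊞ (# 1 ⊞ i))) ≡.refl k i (tri (suc i)))
          (≡.cong (λ u → suc i ℕ.+ E ℕ.+ u ℕ.* u) eq)))
        where open ℕS renaming (solve to solveℕ)
      powers : δ * (1# + q ^ suc k) * q ^ T * q ^ tri (suc i) ≈ δ * (1# + q ^ suc i) * q ^ E
      powers = begin
        δ * (1# + q ^ suc k) * q ^ T * q ^ tri (suc i)
          ≈⟨ solve 4 (λ d y t u → d :* (con (+ 1) :+ y) :* t :* u := d :* (t :* u) :+ d :* (y :* (t :* u))) refl _ _ _ _ ⟩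
        δ * (q ^ T * q ^ tri (suc i)) + δ * (q ^ suc k * (q ^ T * q ^ tri (suc i)))
          ≈⟨ +-cong (*-congˡ (^-homo-* q T (tri (suc i)))) (*-congˡ (trans (^-homo-* q (suc k) (T ℕ.+ tri (suc i))) (*-congˡ (^-homo-* q T (tri (suc i)))))) ⟨
        δ * q ^ (T ℕ.+ tri (suc i)) + δ * q ^ (suc k ℕ.+ (T ℕ.+ tri (suc i)))
          ≈⟨ +-cong pow₂ pow₁ ⟩
        δ * q ^ (suc i ℕ.+ E) + δ * q ^ E
          ≈⟨ +-congʳ (*-congˡ (^-homo-* q (suc i) E)) ⟩
        δ * (q ^ suc i * q ^ E) + δ * q ^ E
          ≈⟨ solve 3 (λ d y e → d :* (y :* e) :+ d :* e := d :* (con (+ 1) :+ y) :* e) refl _ _ _ ⟩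
        δ * (1# + q ^ suc i) * q ^ E ∎
      -- After `central`, the coefficient [2j-1,j] is the reflection of [-j,j], and -j is k modulo
      -- `n`. The same congruence exchanges 1 + qʲ for 1 + qᵏ at the cost of a power of `q`.
      core : δ * G q (suc i ℕ.+ suc i) (suc i)
             ≈ σ (suc i) * (δ * (1# + q ^ suc k) * q ^ T * q ^ tri (suc i)) * G q (suc k) (suc i)
      core = begin
        δ * G q (suc i ℕ.+ suc i) (suc i)
          ≈⟨ *-congˡ (central i i<n) ⟩
        δ * ((1# + q ^ suc i) * g₁)
          ≈⟨ lin₂ (- (σ (suc i) * (1# + q ^ suc i))) (- (δ * (1# + q ^ suc i) * g₁)) (negation i (suc k) (suc i) eq i<n) (σ²≈1 (suc i))
            (solve 6 (λ d y g s e h → d :* ((con (+ 1) :+ y) :* g) :- s :* (d :* (con (+ 1) :+ y) :* e) :* h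
               := (:- (s :* (con (+ 1) :+ y))) :* (d :* (e :* h) :- s :* (d :* g)) :+ (:- (d :* (con (+ 1) :+ y) :* g)) :* (s :* s :- con (+ 1)))
              refl δ (q ^ suc i) g₁ (σ (suc i)) (q ^ E) (G q (suc k) (suc i))) ⟩
        σ (suc i) * (δ * (1# + q ^ suc i) * q ^ E) * G q (suc k) (suc i)
          ≈⟨ *-congʳ (*-congˡ powers) ⟨
        σ (suc i) * (δ * (1# + q ^ suc k) * q ^ T * q ^ tri (suc i)) * G q (suc k) (suc i) ∎
        where
        g₁ : Carrier
        g₁ = G q (i ℕ.+ suc i) (suc i)

    -- The range k < n/2, with j = n - k > k, where both sides vanish: the q-Lucas summand because
    -- its binomials [k,j] and [k-1,j-1] are zero, the term because its factor `δ` reduces the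
    -- second binomial to [j-k,j].
    below : ∀ k i → suc k ℕ.+ suc i ≡ n → k < i → term (suc k) ≈ C * lucasTerm n i
    below k i eq k<i with factor k
    ... | W , fac = trans term≈0 (sym (zero-fac C lucasTerm≈0))
      where
      lucasTerm≈0 : lucasTerm n i ≈ 0#
      lucasTerm≈0 = trans (lucasTerm-as eq) (zero-fac _
        (trans (+-cong (G-vanish (s<s k<i)) (zero-fac _ (G-vanish k<i))) (+-identityˡ 0#)))
      N : ℕ
      -- Again 2mn - 2k; here 2n - 2k = 2j exceeds `n`, so one more period splits off and j - k is
      -- left.
      N = suc (m′ ℕ.+ m′) ℕ.* n ℕ.+ (i ∸ k)
      i<n : suc i < n
      i<n = ≡.subst (suc i <_) eq (ℕ.m<n+m (suc i) z<s)
      N-eq : N ℕ.+ 2 ℕ.* suc k ≡ 2 ℕ.* (m ℕ.* n)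
      N-eq = ≡.trans
        (solveℕ 4 (λ m k d n → (# 1 ⊞ (m ⊞ m)) ⊠ n ⊞ d ⊞ # 2 ⊠ (# 1 ⊞ k) ≗ (# 1 ⊞ k ⊞ (# 1 ⊞ (k ⊞ d))) ⊞ n ⊞ # 2 ⊠ (m ⊠ n)) ≡.refl m′ k (i ∸ k) n)
        (≡.trans (≡.cong (λ t → t ℕ.+ n ℕ.+ 2 ℕ.* (m′ ℕ.* n)) (≡.trans (≡.cong (λ t → suc k ℕ.+ suc t) (ℕ.m+[n∸m]≡n (ℕ.<⇒≤ k<i))) eq))
          (solveℕ 2 (λ m n → n ⊞ n ⊞ # 2 ⊠ (m ⊠ n) ≗ # 2 ⊠ (n ⊞ m ⊠ n)) ≡.refl m′ n))
        where open ℕS renaming (solve to solveℕ)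
      δG : δ * G q N (suc i) ≈ 0#
      δG = trans (lucas-low* (suc (m′ ℕ.+ m′)) (i ∸ k) i<n) (zero-fac _ (G-vanish (s≤s (ℕ.m∸n≤m i k))))
      n∤2k : n ∤ suc k ℕ.+ suc k
      n∤2k = n∤small (≡.subst (suc k ℕ.+ suc k <_) eq (s<s (ℕ.+-monoʳ-< k (s<s k<i))))
      term≈0 : term (suc k) ≈ 0#
      term≈0 = regular _ n∤2k _ (trans
        (*-cong (+-congˡ (-‿cong (sym (Q-pow (suc k))))) (term-as {suc k} {suc i} {N} eq N-eq))
        (lin₂ (σ (suc k) * G q N (suc i)) (σ (suc k) * W) fac δG
          (solve 6 (λ y s g h d w → y :* (s :* (g :* h)) :- con (+ 0) := s :* h :* (y :* g :- d :* w) :+ s :* w :* (d :* h :- con (+ 0)))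
            refl (1# - Q ^ suc k) (σ (suc k)) (G Q (m ℕ.* n) (suc k)) (G q N (suc i)) δ W)))

    middle : ∀ k i → suc k ℕ.+ suc i ≡ n → term (suc k) ≈ C * lucasTerm n i
    middle k i eq with ℕ.<-cmp i k
    ... | tri< i<k _ _ = above k i eq i<k
    -- Here 2k = n, so the multiplier 1 - q²ᵏ of the other two cases would be the nilpotent `δ`.
    ... | tri≈ _ i≡k _ rewrite i≡k = half k eq
    ... | tri> _ _ k<i = below k i eq k<i

    total : ∀ {c} → C ≈ c * ν (m ℕ.+ m) →
      term n ≈ c * (ν m - ν n * (ν m * ν m′) * δ) →
      Sum (suc n) term ≈ value c
    total {c} C≈ last = begin
      Sum n term + term n
        ≈⟨ +-cong (Sum-head p term) last ⟩
      term 0 + Sum p (λ k → term (suc k)) + c * (ν m - ν n * (ν m * ν m′) * δ)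
        ≈⟨ +-congʳ (+-cong first (begin
          Sum p (λ k → term (suc k))                ≈⟨ Sum-rev p (λ k → term (suc k)) ⟩
          Sum p (λ i → term (suc (p ∸ suc i)))      ≈⟨ Sum-cong p (λ i i<p → middle (p ∸ suc i) i (≡.cong suc (ℕ.m∸n+n≡m i<p))) ⟩
          Sum p (λ i → C * lucasTerm n i)           ≈⟨ Sum-* p C (lucasTerm n) ⟩
          C * Sum p (lucasTerm n)                   ≈⟨ *-congʳ C≈ ⟩
          c * ν (m ℕ.+ m) * Sum p (lucasTerm n)     ∎)) ⟩
      ν (m ℕ.+ m) - ν n * (ν m * ν (suc (m′ ℕ.+ m′))) * δ + c * ν (m ℕ.+ m) * Sum p (lucasTerm n) + c * (ν m - ν n * (ν m * ν m′) * δ)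
        -- `lucas n` starts with the summand 1 of index 0, whereas the sum here starts at index 1;
        -- this is the subtracted 1 in `value`.
        ≈⟨ solve 5 (λ a c v s b → a :+ c :* v :* s :+ c :* b := a :+ c :* (b :+ v :* (con (+ 1) :+ s :- con (+ 1))))
             refl _ c (ν (m ℕ.+ m)) (Sum p (lucasTerm n)) _ ⟩
      ν (m ℕ.+ m) - ν n * (ν m * ν (suc (m′ ℕ.+ m′))) * δ
        + c * (ν m - ν n * (ν m * ν m′) * δ + ν (m ℕ.+ m) * (lucas n - 1#)) ∎
      where
      first : term 0 ≈ ν (m ℕ.+ m) - ν n * (ν m * ν (suc (m′ ℕ.+ m′))) * δ
      first = begin
        term 0
          ≈⟨ term-as {0} {n} {(m ℕ.+ m) ℕ.* n} ≡.refl (solveℕ 2 (λ m n → (m ⊞ m) ⊠ n ⊞ # 0 ≗ # 2 ⊠ (m ⊠ n)) ≡.refl m n) ⟩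
        σ 0 * (1# * G q ((m ℕ.+ m) ℕ.* n) n)
          ≈⟨ trans (*-congʳ ι-1) (solve 1 (λ g → con (+ 1) :* (con (+ 1) :* g) := g) refl _) ⟩
        G q ((m ℕ.+ m) ℕ.* n) n
          ≈⟨ G-multiple (m ℕ.+ m) ⟩
        ν (m ℕ.+ m) - ν n * ν (tri (m ℕ.+ m)) * δ
          ≈⟨ +-congˡ (-‿cong (*-congʳ (*-congˡ (trans (reflexive (≡.cong ν (tri-even m′))) (ν-* m (suc (m′ ℕ.+ m′))))))) ⟩
        ν (m ℕ.+ m) - ν n * (ν m * ν (suc (m′ ℕ.+ m′))) * δ ∎
        where open ℕS renaming (solve to solveℕ)

  term-n : term n ≈ σ n * G Q (m ℕ.* n) n
  term-n = *-congˡ (trans (*-congˡ (reflexive (≡.cong (G q (2 ℕ.* (m ℕ.* n) ∸ 2 ℕ.* n)) (ℕ.n∸n≡0 n)))) (*-identityʳ _))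

  -- Odd n: the square of q again has order n

  module Odd (h : ℕ) (p≡2h : p ≡ h ℕ.+ h) where

    n∤double : ∀ {k} → n ∤ k → n ∤ k ℕ.+ k
    n∤double {k} n∤k n∣2k = n∤k (∣m+n∣m⇒∣n (≡.subst (n ∣_) split (∣n⇒∣m*n k n∣n)) (∣n⇒∣m*n h n∣2k))
      where
      split : k ℕ.* n ≡ h ℕ.* (k ℕ.+ k) ℕ.+ k
      split rewrite p≡2h = ℕS.solve 2 (λ k h → k ⊠ (# 1 ⊞ (h ⊞ h)) ≗ h ⊠ (k ⊞ k) ⊞ k) ≡.refl k h
        where open ℕS

    rootQ : IsRoot Q n
    rootQ = record
      { nilpotent = lin₂ ((1# + q ^ n) * (1# + q ^ n)) (- (1# + 1#) + Q ^ n + q ^ n * q ^ n) nilpotent (Q-pow-sq n)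
          (solve 2 (λ y Y → (con (+ 1) :- Y) :* (con (+ 1) :- Y) :- con (+ 0)
              := (con (+ 1) :+ y) :* (con (+ 1) :+ y) :* ((con (+ 1) :- y) :* (con (+ 1) :- y) :- con (+ 0))
                 :+ (:- (con (+ 1) :+ con (+ 1)) :+ Y :+ y :* y) :* (Y :- y :* y))
            refl (q ^ n) (Q ^ n))
      ; regular = λ k n∤k y e → regular (k ℕ.+ k) (n∤double n∤k) y
          (trans (*-congʳ (+-congˡ (-‿cong (sym (Q-pow k))))) e)
      }

    module RQ = Root rootQ

    δQ-factor : RQ.δ ≈ δ * (1# + q ^ n)
    δQ-factor = lin₁ (- 1#) (Q-pow-sq n)
      (solve 2 (λ y Y → con (+ 1) :- Y :- (con (+ 1) :- y) :* (con (+ 1) :+ y) := (:- con (+ 1)) :* (Y :- y :* y)) refl (q ^ n) (Q ^ n))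

    -- This factor 2 turns m into 2m in the constant `C`, and m choose 2 into m(m-1) in `last`.
    δQ≈2δ : RQ.δ ≈ δ + δ
    δQ≈2δ = trans δQ-factor (lin₁ 1# δ-pow-n
      (solve 2 (λ d y → d :* (con (+ 1) :+ y) :- (d :+ d) := con (+ 1) :* (d :* y :- d)) refl δ (q ^ n)))

    σn : σ n ≈ - 1#
    σn = trans (σ-suc p) (-‿cong (trans (reflexive (≡.cong σ p≡2h)) (trans (σ-+ h h) (σ²≈1 h))))

    C : Carrier
    C = - 1# * ν (m ℕ.+ m)

    -- Absorption leaves [mn-1,k-1] in base `Q`, which q-Lucas reduces to row n-1, where `negation₀`
    -- knows the value. The minus sign of `C` is the sign change from index k-1 to k.
    upper : ∀ k → suc k < n → n < suc k ℕ.+ suc k →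
            (1# - Q ^ suc k) * G Q (m ℕ.* n) (suc k) * Q ^ tri (suc k) ≈ C * (σ (suc k) * δ)
    upper k k<n _ = begin
      (1# - Q ^ suc k) * G Q (m ℕ.* n) (suc k) * t
        ≈⟨ lin₃ t (ν m * t) (ν m) (RQ.G-multiple-absorb m k) low (RQ.negation₀ k (ℕ.<-trans (ℕ.n<1+n k) k<n))
          (solve 8 (λ y g t v d g₁ g₂ s → y :* g :* t :- v :* (s :* d)
              := t :* (y :* g :- v :* d :* g₁) :+ v :* t :* (d :* g₁ :- d :* g₂) :+ v :* (d :* (t :* g₂) :- s :* d))
            refl (1# - Q ^ suc k) (G Q (m ℕ.* n) (suc k)) t (ν m) RQ.δ (G Q (p ℕ.+ m′ ℕ.* n) k) (G Q p k) (σ k)) ⟩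
      ν m * (σ k * RQ.δ)
        ≈⟨ lin₃ (ν m * σ k) (σ (suc k) * δ) ((ν m + ν m) * δ) δQ≈2δ (ν-+ m m) (σ-suc k)
          (solve 6 (λ v s e d v₂ s′ → v :* (s :* e) :- (:- con (+ 1)) :* v₂ :* (s′ :* d)
              := v :* s :* (e :- (d :+ d)) :+ s′ :* d :* (v₂ :- (v :+ v)) :+ (v :+ v) :* d :* (s′ :- (:- s)))
            refl (ν m) (σ k) RQ.δ δ (ν (m ℕ.+ m)) (σ (suc k))) ⟩
      C * (σ (suc k) * δ) ∎
      where
      t : Carrier
      t = Q ^ tri (suc k)
      low : RQ.δ * G Q (p ℕ.+ m′ ℕ.* n) k ≈ RQ.δ * G Q p k
      low = trans (*-congˡ (reflexive (≡.cong (λ N → G Q N k) (ℕ.+-comm p (m′ ℕ.* n)))))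
        (RQ.lucas-low* m′ p (ℕ.<-trans (ℕ.n<1+n k) k<n))

    factor : ∀ k → ∃ λ W → (1# - Q ^ suc k) * G Q (m ℕ.* n) (suc k) ≈ δ * W
    factor k = (1# + q ^ n) * (ν m * g) , lin₂ 1# (ν m * g) (RQ.G-multiple-absorb m k) δQ-factor
      (solve 6 (λ y v e g d z → y :- d :* (z :* (v :* g)) := con (+ 1) :* (y :- v :* e :* g) :+ v :* g :* (e :- d :* z))
        refl _ (ν m) RQ.δ g δ (1# + q ^ n))
      where
      g : Carrier
      g = G Q (p ℕ.+ m′ ℕ.* n) k

    last : term n ≈ - 1# * (ν m - ν n * (ν m * ν m′) * δ)
    last = begin
      term n
        ≈⟨ trans term-n (*-cong σn (RQ.G-multiple m)) ⟩
      - 1# * (ν m - ν n * ν (tri m) * RQ.δ)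
        ≈⟨ lin₂ (ν n * ν (tri m)) (ν n * δ) δQ≈2δ double
          (solve 6 (λ v N t e d w → (:- con (+ 1)) :* (v :- N :* t :* e) :- (:- con (+ 1)) :* (v :- N :* (v :* w) :* d)
              := N :* t :* (e :- (d :+ d)) :+ N :* d :* (t :+ t :- v :* w))
            refl (ν m) (ν n) (ν (tri m)) RQ.δ δ (ν m′)) ⟩
      - 1# * (ν m - ν n * (ν m * ν m′) * δ) ∎
      where
      double : ν (tri m) + ν (tri m) ≈ ν m * ν m′
      double = trans (sym (ν-+ (tri m) (tri m))) (trans (reflexive (≡.cong ν (tri-double m′))) (ν-* m m′))

    open Middle C upper factor (λ k eq → ⊥-elim (even≢odd (suc k) h (≡.trans eq (≡.cong suc p≡2h))))

    sum-odd : Sum (suc n) term ≈ value (- 1#)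
    sum-odd = total refl last

  -- Even n: the square of q has order n/2

  module Even (s : ℕ) (n≡2h : n ≡ suc s ℕ.+ suc s) where

    h a′ : ℕ
    h  = suc s
    a′ = suc (m′ ℕ.+ m′)

    m+m≡1+a′ : m ℕ.+ m ≡ suc a′
    m+m≡1+a′ = ≡.cong suc (ℕ.+-suc m′ m′)

    mn≡ah : m ℕ.* n ≡ suc a′ ℕ.* h
    mn≡ah = ≡.trans (≡.cong (m ℕ.*_) n≡2h) (ℕS.solve 2 (λ m h → (# 1 ⊞ m) ⊠ (h ⊞ h) ≗ (# 1 ⊞ (# 1 ⊞ (m ⊞ m))) ⊠ h) ≡.refl m′ h)
      where open ℕS

    Qh≈qn : Q ^ h ≈ q ^ n
    Qh≈qn = trans (Q-pow h) (^-congʳ q (≡.sym n≡2h))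

    h<n : h < n
    h<n = ≡.subst (h <_) (≡.sym n≡2h) (ℕ.m<m+n h z<s)

    rootQ : IsRoot Q h
    rootQ = record
      { nilpotent = trans (*-cong (+-congˡ (-‿cong Qh≈qn)) (+-congˡ (-‿cong Qh≈qn))) nilpotent
      ; regular = λ k h∤k y e → regular (k ℕ.+ k) (λ n∣2k → h∤k (halve k n∣2k)) y
          (trans (*-congʳ (+-congˡ (-‿cong (sym (Q-pow k))))) e)
      }
      where
      halve : ∀ k → n ∣ k ℕ.+ k → h ∣ k
      halve k n∣2k = *-cancelˡ-∣ 2 (≡.subst₂ _∣_
        (≡.trans n≡2h (≡.cong (h ℕ.+_) (≡.sym (ℕ.+-identityʳ h)))) (≡.cong (k ℕ.+_) (≡.sym (ℕ.+-identityʳ k))) n∣2k)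

    module RQ = Root rootQ

    δQ≈δ : RQ.δ ≈ δ
    δQ≈δ = +-congˡ (-‿cong Qh≈qn)

    -- Next to `δ`, the power `q ^ h` acts as -1: the product `(1# - q ^ h) * (δ * q ^ h + δ)` is
    -- `δ * δ`, and its first factor is regular.
    δ-half : δ * q ^ h ≈ - δ
    δ-half = cancel {h} (n∤small h<n) (lin₂ 1# (- δ) nilpotent (trans (sym (^-homo-* q h h)) (^-congʳ q (≡.sym n≡2h)))
      (solve 2 (λ y z → let d = con (+ 1) :- z in
          (con (+ 1) :- y) :* (d :* y) :- (con (+ 1) :- y) :* (:- d) := con (+ 1) :* (d :* d :- con (+ 0)) :+ (:- d) :* (y :* y :- z))
        refl (q ^ h) (q ^ n)))

    δ-halves : ∀ t → δ * q ^ (t ℕ.* h) ≈ σ t * δ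
    δ-halves zero    = trans (*-identityʳ δ) (sym (trans (*-congʳ ι-1) (*-identityˡ δ)))
    δ-halves (suc t) = trans (*-congˡ (^-homo-* q h (t ℕ.* h))) (lin₃ (q ^ (t ℕ.* h)) (- 1#) (- δ) δ-half (δ-halves t) (σ-suc t)
      (solve 5 (λ d y z s s′ → d :* (y :* z) :- s′ :* d
          := z :* (d :* y :- (:- d)) :+ (:- con (+ 1)) :* (d :* z :- s :* d) :+ (:- d) :* (s′ :- (:- s)))
        refl δ (q ^ h) (q ^ (t ℕ.* h)) (σ t) (σ (suc t))))

    δ-tri : δ * q ^ (tri h ℕ.+ tri h) ≈ σ s * δ
    δ-tri = trans (*-congˡ (^-congʳ q (≡.trans (tri-double s) (ℕ.*-comm h s)))) (δ-halves s)

    σn : σ n ≈ 1#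
    σn = trans (reflexive (≡.cong σ n≡2h)) (trans (σ-+ h h) (σ²≈1 h))

    C : Carrier
    C = ν a′ * ν (m ℕ.+ m)

    absorb : ∀ k → (1# - Q ^ suc k) * G Q (m ℕ.* n) (suc k) ≈ ν (m ℕ.+ m) * (δ * G Q (a′ ℕ.* h ℕ.+ s) k)
    absorb k = begin
      (1# - Q ^ suc k) * G Q (m ℕ.* n) (suc k)
        ≡⟨ ≡.cong (λ N → (1# - Q ^ suc k) * G Q N (suc k)) mn≡ah ⟩
      (1# - Q ^ suc k) * G Q (suc a′ ℕ.* h) (suc k)
        ≈⟨ RQ.G-multiple-absorb (suc a′) k ⟩
      ν (suc a′) * RQ.δ * G Q (s ℕ.+ a′ ℕ.* h) k
        ≈⟨ *-cong (*-cong (reflexive (≡.cong ν (≡.sym m+m≡1+a′))) δQ≈δ) (reflexive (≡.cong (λ N → G Q N k) (ℕ.+-comm s (a′ ℕ.* h)))) ⟩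
      ν (m ℕ.+ m) * δ * G Q (a′ ℕ.* h ℕ.+ s) k
        ≈⟨ *-assoc _ _ _ ⟩
      ν (m ℕ.+ m) * (δ * G Q (a′ ℕ.* h ℕ.+ s) k) ∎

    factor : ∀ k → ∃ λ W → (1# - Q ^ suc k) * G Q (m ℕ.* n) (suc k) ≈ δ * W
    factor k = ν (m ℕ.+ m) * G Q (a′ ℕ.* h ℕ.+ s) k , trans (absorb k)
      (solve 3 (λ a b c → a :* (b :* c) := b :* (a :* c)) refl _ _ _)

    -- Relative to the order `h` of `Q` the lower index `i + h` left by absorption lies in the
    -- second period, so `lucas-high*` multiplies by the number `a′` = 2m-1 of full periods in the
    -- upper entry. The sign `σ s` is the value of `Q ^ tri h` next to `δ`.
    upper′ : ∀ i → i < h →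
      (1# - Q ^ suc (i ℕ.+ h)) * G Q (m ℕ.* n) (suc (i ℕ.+ h)) * Q ^ tri (suc (i ℕ.+ h)) ≈ C * (σ (suc (i ℕ.+ h)) * δ)
    upper′ i i<h = begin
      (1# - Q ^ suc (i ℕ.+ h)) * G Q (m ℕ.* n) (suc (i ℕ.+ h)) * t
        ≈⟨ lin₃ t (ν (m ℕ.+ m) * t) (ν (m ℕ.+ m) * ν a′ * g) (absorb (i ℕ.+ h)) high Q-tri
          (solve 8 (λ z v d g₁ t a g u → z :* t :- v :* a :* g :* (u) := t :* (z :- v :* (d :* g₁)) :+ v :* t :* (d :* g₁ :- d :* (a :* g)) :+ v :* a :* g :* (d :* t :- u))
            refl _ (ν (m ℕ.+ m)) δ (G Q (a′ ℕ.* h ℕ.+ s) (i ℕ.+ h)) t (ν a′) g (σ s * (δ * Q ^ tri (suc i)))) ⟩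
      ν (m ℕ.+ m) * ν a′ * g * (σ s * (δ * Q ^ tri (suc i)))
        ≈⟨ lin₂ (ν (m ℕ.+ m) * ν a′ * σ s) (- (ν a′ * ν (m ℕ.+ m) * δ)) neg σ-eq
          (solve 8 (λ v a g s d t i w → v :* a :* g :* (s :* (d :* t)) :- a :* v :* (w :* d)
             := v :* a :* s :* (d :* (t :* g) :- i :* d) :+ (:- (a :* v :* d)) :* (w :- i :* s))
            refl (ν (m ℕ.+ m)) (ν a′) g (σ s) δ (Q ^ tri (suc i)) (σ i) (σ (suc (i ℕ.+ h)))) ⟩
      C * (σ (suc (i ℕ.+ h)) * δ) ∎
      where
      t g : Carrier
      t = Q ^ tri (suc (i ℕ.+ h))
      g = G Q s i
      σ-eq : σ (suc (i ℕ.+ h)) ≈ σ i * σ s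
      σ-eq = trans (reflexive (≡.cong (λ u → σ (suc u)) (ℕ.+-suc i s)))
        (trans (trans (σ-suc (suc (i ℕ.+ s))) (-‿cong (σ-suc (i ℕ.+ s)))) (lin₁ 1# (σ-+ i s)
          (solve 2 (λ a b → :- (:- a) :- b := con (+ 1) :* (a :- b)) refl _ _)))
      neg : δ * (Q ^ tri (suc i) * g) ≈ σ i * δ
      neg = trans (*-congʳ (sym δQ≈δ)) (trans (RQ.negation₀ i i<h) (*-congˡ δQ≈δ))
      high : δ * G Q (a′ ℕ.* h ℕ.+ s) (i ℕ.+ h) ≈ δ * (ν a′ * g)
      high = trans (*-congʳ (sym δQ≈δ)) (trans (RQ.lucas-high* a′ s i<h) (*-cong δQ≈δ
        (trans (+-congʳ (Gauss.G-vanish Q (ℕ.m≤n+m h i))) (+-identityˡ _))))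
      Q-tri : δ * t ≈ σ s * (δ * Q ^ tri (suc i))
      Q-tri = begin
        δ * t
          ≈⟨ *-congˡ (trans (^-congʳ Q (tri-+ (suc i) h)) (trans (^-homo-* Q (tri (suc i) ℕ.+ tri h) (suc i ℕ.* h)) (*-congʳ (^-homo-* Q (tri (suc i)) (tri h))))) ⟩
        δ * (Q ^ tri (suc i) * Q ^ tri h * Q ^ (suc i ℕ.* h))
          ≈⟨ lin₂ (Q ^ tri (suc i) * Q ^ tri h) (Q ^ tri (suc i)) δQ-pow δQ-tri
            (solve 5 (λ d t u w s → d :* (t :* u :* w) :- s :* (d :* t) := t :* u :* (d :* w :- d) :+ t :* (d :* u :- s :* d))
              refl δ (Q ^ tri (suc i)) (Q ^ tri h) (Q ^ (suc i ℕ.* h)) (σ s)) ⟩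
        σ s * (δ * Q ^ tri (suc i)) ∎
        where
        δQ-pow : δ * Q ^ (suc i ℕ.* h) ≈ δ
        δQ-pow = trans (*-congʳ (sym δQ≈δ)) (trans (RQ.δ-pow (suc i)) δQ≈δ)
        δQ-tri : δ * Q ^ tri h ≈ σ s * δ
        δQ-tri = trans (*-congˡ (Q-pow (tri h))) δ-tri

    upper : ∀ k → suc k < n → n < suc k ℕ.+ suc k →
            (1# - Q ^ suc k) * G Q (m ℕ.* n) (suc k) * Q ^ tri (suc k) ≈ C * (σ (suc k) * δ)
    upper k k<n n<2k = ≡.subst (λ k → (1# - Q ^ suc k) * G Q (m ℕ.* n) (suc k) * Q ^ tri (suc k) ≈ C * (σ (suc k) * δ))
      (ℕ.m∸n+n≡m h≤k) (upper′ (k ∸ h) k∸h<h)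
      where
      h≤k : h ≤ k
      h≤k = ℕ.≮⇒≥ (λ k<h → ℕ.<⇒≱ n<2k (≡.subst (suc k ℕ.+ suc k ≤_) (≡.sym n≡2h) (ℕ.+-mono-≤ k<h k<h)))
      k∸h<h : k ∸ h < h
      k∸h<h = ℕ.+-cancelʳ-< h (k ∸ h) h (≡.subst₂ _<_ (≡.sym (ℕ.m∸n+n≡m h≤k)) n≡2h (ℕ.<-trans (ℕ.n<1+n k) k<n))

    -- The multiplier `1# - q ^ h` replaces the unusable 1 - q²ʰ. It extracts the factor `δ` from
    -- the base-q binomial, so that [mn,h] in base `Q` counts only through its constant term 2m.
    half′ : term h ≈ C * lucasTerm n s
    half′ = cancel {h} (n∤small h<n) (pow-cancel (tri h) (begin
      q ^ tri h * ((1# - q ^ h) * term h)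
        ≈⟨ *-congˡ (*-congˡ (term-as {h} {h} {a′ ℕ.* n} (≡.sym n≡2h) N-eq)) ⟩
      q ^ tri h * ((1# - q ^ h) * (σ h * (G Q (m ℕ.* n) h * G q (a′ ℕ.* n) h)))
        ≈⟨ lin₃ (q ^ tri h * σ h * g₁) (q ^ tri h * σ h * g₁ * ν a′) (σ h * g₁ * ν a′) (G-multiple-absorb a′ s) low (negation₀ s s<n)
          (solve 10 (λ t y r g₁ g₂ g₃ g₄ a d s → t :* (y :* (r :* (g₁ :* g₂))) :- r :* a :* s :* (d :* g₁)
             := t :* r :* g₁ :* (y :* g₂ :- a :* d :* g₃) :+ t :* r :* g₁ :* a :* (d :* g₃ :- d :* g₄)
                :+ r :* g₁ :* a :* (d :* (t :* g₄) :- s :* d))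
            refl (q ^ tri h) (1# - q ^ h) (σ h) g₁ (G q (a′ ℕ.* n) h) (G q (p ℕ.+ (m′ ℕ.+ m′) ℕ.* n) s) (G q p s) (ν a′) δ (σ s)) ⟩
      σ h * ν a′ * σ s * (δ * g₁)
        ≈⟨ lin₁ (σ h * ν a′ * σ s) δg₁
          (solve 6 (λ r a s z v d → r :* a :* s :* z :- a :* v :* (r :* (s :* d)) := r :* a :* s :* (z :- v :* d))
            refl (σ h) (ν a′) (σ s) (δ * g₁) (ν (m ℕ.+ m)) δ) ⟩
      C * (σ h * (σ s * δ))
        ≈⟨ lin₃ (- (C * σ h)) (- (q ^ tri h * C)) (- (C * σ h * q ^ tri h * q ^ tri h * δ))
             (trans (*-congˡ (sym (^-homo-* q (tri h) (tri h)))) δ-tri) (lucasTerm-clear (≡.sym n≡2h)) (G-diag h)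
          (solve 8 (λ C r s d t y l g → C :* (r :* (s :* d)) :- t :* (y :* (C :* l))
             := (:- (C :* r)) :* (d :* (t :* t) :- s :* d) :+ (:- (t :* C)) :* (y :* l :- r :* t :* (d :* g))
               :+ (:- (C :* r :* t :* t :* d)) :* (g :- con (+ 1)))
            refl C (σ h) (σ s) δ (q ^ tri h) (1# - q ^ h) (lucasTerm n s) (G q h h)) ⟩
      q ^ tri h * ((1# - q ^ h) * (C * lucasTerm n s)) ∎))
      where
      g₁ : Carrier
      g₁ = G Q (m ℕ.* n) h
      s<n : s < n
      s<n = ℕ.<-trans (ℕ.n<1+n s) h<n
      N-eq : a′ ℕ.* n ℕ.+ 2 ℕ.* h ≡ 2 ℕ.* (m ℕ.* n)
      N-eq = ≡.trans (≡.cong (λ t → a′ ℕ.* n ℕ.+ t) (≡.trans (≡.cong (h ℕ.+_) (ℕ.+-identityʳ h)) (≡.sym n≡2h)))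
        (ℕS.solve 2 (λ m n → (# 1 ⊞ (m ⊞ m)) ⊠ n ⊞ n ≗ # 2 ⊠ ((# 1 ⊞ m) ⊠ n)) ≡.refl m′ n)
        where open ℕS
      low : δ * G q (p ℕ.+ (m′ ℕ.+ m′) ℕ.* n) s ≈ δ * G q p s
      low = trans (*-congˡ (reflexive (≡.cong (λ N → G q N s) (ℕ.+-comm p ((m′ ℕ.+ m′) ℕ.* n)))))
        (lucas-low* (m′ ℕ.+ m′) p s<n)
      δg₁ : δ * g₁ ≈ ν (m ℕ.+ m) * δ
      δg₁ = begin
        δ * g₁
          ≡⟨ ≡.cong (λ N → δ * G Q N h) mn≡ah ⟩
        δ * G Q (suc a′ ℕ.* h) h
          ≈⟨ *-congˡ (RQ.G-multiple (suc a′)) ⟩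
        δ * (ν (suc a′) - ν h * ν (tri (suc a′)) * RQ.δ)
          ≈⟨ lin₂ (- (ν h * ν (tri (suc a′)))) (- (δ * ν h * ν (tri (suc a′)))) nilpotent δQ≈δ
            (solve 5 (λ d v h t e → d :* (v :- h :* t :* e) :- v :* d := (:- (h :* t)) :* (d :* d :- con (+ 0)) :+ (:- (d :* h :* t)) :* (e :- d))
              refl δ (ν (suc a′)) (ν h) (ν (tri (suc a′))) RQ.δ) ⟩
        ν (suc a′) * δ
          ≡⟨ ≡.cong (λ N → ν N * δ) (≡.sym m+m≡1+a′) ⟩
        ν (m ℕ.+ m) * δ ∎

    half : ∀ k → suc k ℕ.+ suc k ≡ n → term (suc k) ≈ C * lucasTerm n k
    half k eq = ≡.subst (λ k → term (suc k) ≈ C * lucasTerm n k) s≡k half′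
      where
      s≡k : s ≡ k
      s≡k = ℕ.suc-injective (ℕ.*-cancelˡ-≡ h (suc k) 2
        (≡.trans (≡.cong (h ℕ.+_) (ℕ.+-identityʳ h)) (≡.trans (≡.sym n≡2h) (≡.trans (≡.sym eq) (≡.cong (suc k ℕ.+_) (≡.sym (ℕ.+-identityʳ (suc k))))))))

    last : term n ≈ ν a′ * (ν m - ν n * (ν m * ν m′) * δ)
    last = begin
      term n
        ≈⟨ trans term-n (trans (*-congʳ σn) (*-identityˡ _)) ⟩
      G Q (m ℕ.* n) n
        ≡⟨ ≡.cong₂ (G Q) mn≡ah n≡2h ⟩
      G Q (suc a′ ℕ.* h) (h ℕ.+ h)
        ≈⟨ RQ.G-multiple₂ (suc a′) ⟩
      ν (tri (suc a′)) - ν h * ν (3 ℕ.* tet (suc a′)) * RQ.δ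
        ≡⟨ ≡.cong (λ a → ν (tri a) - ν h * ν (3 ℕ.* tet a) * RQ.δ) (≡.sym m+m≡1+a′) ⟩
      ν (tri (m ℕ.+ m)) - ν h * ν (3 ℕ.* tet (m ℕ.+ m)) * RQ.δ
        ≈⟨ +-cong (trans (reflexive (≡.cong ν (tri-even m′))) (ν-* m a′)) (-‿cong (*-cong (*-congˡ tet-eq) δQ≈δ)) ⟩
      ν m * ν a′ - ν h * (u + u) * δ
        ≈⟨ lin₁ (ν a′ * (ν m * ν m′) * δ) (trans (reflexive (≡.cong ν n≡2h)) (ν-+ h h))
          (solve 6 (λ v a w h d N → v :* a :- h :* (a :* (v :* w) :+ a :* (v :* w)) :* d :- a :* (v :- N :* (v :* w) :* d)
             := a :* (v :* w) :* d :* (N :- (h :+ h)))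
            refl (ν m) (ν a′) (ν m′) (ν h) δ (ν n)) ⟩
      ν a′ * (ν m - ν n * (ν m * ν m′) * δ) ∎
      where
      u : Carrier
      u = ν a′ * (ν m * ν m′)
      tet-eq : ν (3 ℕ.* tet (m ℕ.+ m)) ≈ u + u
      tet-eq = trans (reflexive (≡.cong ν (≡.trans (tet-even m′) (≡.cong (w ℕ.+_) (ℕ.+-identityʳ w)))))
        (trans (ν-+ w w) (+-cong ν-w ν-w))
        where
        w : ℕ
        w = a′ ℕ.* (m ℕ.* m′)
        ν-w : ν w ≈ u
        ν-w = trans (ν-* a′ (m ℕ.* m′)) (*-congˡ (ν-* m m′))

    open Middle C upper factor half

    sum-even : Sum (suc n) term ≈ value (ν a′)
    sum-even = total refl last

-- The polynomial ring and its quotients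

-- _≈ᴾ_ as a record, so that the two polynomials can be inferred from a proof.
infix 4 _≋_
record _≋_ (p r : Poly) : Set where
  constructor mk≋
  field at : p ≈ᴾ r
open _≋_ public

module ℤS = ℤ.+-*-Solver

≋-refl : ∀ {p} → p ≋ p
≋-refl = mk≋ λ _ → ≡.refl

≋-sym : ∀ {p r} → p ≋ r → r ≋ p
≋-sym e = mk≋ λ i → ≡.sym (at e i)

≋-trans : ∀ {p r s} → p ≋ r → r ≋ s → p ≋ s
≋-trans e f = mk≋ λ i → ≡.trans (at e i) (at f i)

∷-cong : ∀ {a b p r} → a ≡ b → p ≋ r → a ∷ p ≋ b ∷ r
∷-cong a≡b e = mk≋ λ { zero → a≡b ; (suc i) → at e i }

0∷[] : 0ℤ ∷ [] ≋ []
0∷[] = mk≋ λ { zero → ≡.refl ; (suc _) → ≡.refl }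

coeff-⊕ : ∀ p r i → coeff (p ⊕ r) i ≡ coeff p i ℤ.+ coeff r i
coeff-⊕ []      r       i       = ≡.sym (ℤ.+-identityˡ _)
coeff-⊕ (a ∷ p) []      i       = ≡.sym (ℤ.+-identityʳ _)
coeff-⊕ (a ∷ p) (b ∷ r) zero    = ≡.refl
coeff-⊕ (a ∷ p) (b ∷ r) (suc i) = coeff-⊕ p r i

coeff-scale : ∀ c p i → coeff (scale c p) i ≡ c ℤ.* coeff p i
coeff-scale c []      i       = ≡.sym (ℤ.*-zeroʳ c)
coeff-scale c (a ∷ p) zero    = ≡.refl
coeff-scale c (a ∷ p) (suc i) = coeff-scale c p i

coeff-neg : ∀ p i → coeff (negᴾ p) i ≡ ℤ.- coeff p i
coeff-neg []      i       = ≡.refl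
coeff-neg (a ∷ p) zero    = ≡.refl
coeff-neg (a ∷ p) (suc i) = coeff-neg p i

coeff-⊖ : ∀ p r i → coeff (p ⊖ r) i ≡ coeff p i ℤ.- coeff r i
coeff-⊖ p r i = ≡.trans (coeff-⊕ p (negᴾ r) i) (≡.cong (λ t → coeff p i ℤ.+ t) (coeff-neg r i))

coeff-∷-⊗ : ∀ a p r i → coeff ((a ∷ p) ⊗ r) i ≡ a ℤ.* coeff r i ℤ.+ coeff (0ℤ ∷ p ⊗ r) i
coeff-∷-⊗ a p r i = ≡.trans (coeff-⊕ (scale a r) _ i) (≡.cong (ℤ._+ _) (coeff-scale a r i))

⊕-cong : ∀ {p p′ r r′} → p ≋ p′ → r ≋ r′ → p ⊕ r ≋ p′ ⊕ r′
⊕-cong {p} {p′} {r} {r′} e f = mk≋ λ i → ≡.trans (coeff-⊕ p r i)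
  (≡.trans (≡.cong₂ ℤ._+_ (at e i) (at f i)) (≡.sym (coeff-⊕ p′ r′ i)))

negᴾ-cong : ∀ {p r} → p ≋ r → negᴾ p ≋ negᴾ r
negᴾ-cong {p} {r} e = mk≋ λ i → ≡.trans (coeff-neg p i) (≡.trans (≡.cong ℤ.-_ (at e i)) (≡.sym (coeff-neg r i)))

scale-cong : ∀ c {p r} → p ≋ r → scale c p ≋ scale c r
scale-cong c {p} {r} e = mk≋ λ i → ≡.trans (coeff-scale c p i) (≡.trans (≡.cong (c ℤ.*_) (at e i)) (≡.sym (coeff-scale c r i)))

⊕-assoc : ∀ p r s → (p ⊕ r) ⊕ s ≋ p ⊕ (r ⊕ s)
⊕-assoc p r s = mk≋ λ i → begin
  coeff ((p ⊕ r) ⊕ s) i                       ≡⟨ coeff-⊕ (p ⊕ r) s i ⟩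
  coeff (p ⊕ r) i ℤ.+ coeff s i               ≡⟨ ≡.cong (ℤ._+ coeff s i) (coeff-⊕ p r i) ⟩
  coeff p i ℤ.+ coeff r i ℤ.+ coeff s i       ≡⟨ ℤ.+-assoc (coeff p i) _ _ ⟩
  coeff p i ℤ.+ (coeff r i ℤ.+ coeff s i)     ≡⟨ ≡.cong (λ t → coeff p i ℤ.+ t) (≡.sym (coeff-⊕ r s i)) ⟩
  coeff p i ℤ.+ coeff (r ⊕ s) i               ≡⟨ coeff-⊕ p (r ⊕ s) i ⟨
  coeff (p ⊕ (r ⊕ s)) i                       ∎
  where open ≡.≡-Reasoning

⊕-comm : ∀ p r → p ⊕ r ≋ r ⊕ p
⊕-comm p r = mk≋ λ i → ≡.trans (coeff-⊕ p r i) (≡.trans (ℤ.+-comm (coeff p i) _) (≡.sym (coeff-⊕ r p i)))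

⊕-identityʳ : ∀ p → p ⊕ [] ≋ p
⊕-identityʳ p = mk≋ λ i → ≡.trans (coeff-⊕ p [] i) (ℤ.+-identityʳ _)

⊕-inverseʳ : ∀ p → p ⊕ negᴾ p ≋ []
⊕-inverseʳ p = mk≋ λ i → ≡.trans (coeff-⊖ p p i) (ℤ.+-inverseʳ (coeff p i))

⊗-congˡ : ∀ p {r r′} → r ≋ r′ → p ⊗ r ≋ p ⊗ r′
⊗-congˡ []      e = ≋-refl
⊗-congˡ (a ∷ p) e = ⊕-cong (scale-cong a e) (∷-cong ≡.refl (⊗-congˡ p e))

⊗-zeroʳ : ∀ p → p ⊗ [] ≋ []
⊗-zeroʳ []      = ≋-refl
⊗-zeroʳ (a ∷ p) = ≋-trans (∷-cong ≡.refl (⊗-zeroʳ p)) 0∷[]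

-- The mirror image of the defining clause of `_⊗_`; commutativity then follows by induction on one
-- factor.
⊗-∷ʳ : ∀ p b r → p ⊗ (b ∷ r) ≋ scale b p ⊕ (0ℤ ∷ p ⊗ r)
⊗-∷ʳ []      b r = ≋-sym 0∷[]
⊗-∷ʳ (a ∷ p) b r = mk≋ go
  where
  open ≡.≡-Reasoning
  go : (a ∷ p) ⊗ (b ∷ r) ≈ᴾ scale b (a ∷ p) ⊕ (0ℤ ∷ (a ∷ p) ⊗ r)
  go zero    = ≡.cong (ℤ._+ 0ℤ) (ℤ.*-comm a b)
  go (suc i) = begin
    coeff (scale a r ⊕ p ⊗ (b ∷ r)) i
      ≡⟨ ≡.trans (coeff-⊕ (scale a r) _ i) (≡.cong₂ ℤ._+_ (coeff-scale a r i) (at (⊗-∷ʳ p b r) i)) ⟩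
    a ℤ.* coeff r i ℤ.+ coeff (scale b p ⊕ (0ℤ ∷ p ⊗ r)) i
      ≡⟨ ≡.cong (λ t → a ℤ.* coeff r i ℤ.+ t) (coeff-⊕ (scale b p) _ i) ⟩
    a ℤ.* coeff r i ℤ.+ (coeff (scale b p) i ℤ.+ coeff (0ℤ ∷ p ⊗ r) i)
      ≡⟨ ℤS.solve 3 (λ x y z → x ℤS.:+ (y ℤS.:+ z) ℤS.:= y ℤS.:+ (x ℤS.:+ z)) ≡.refl (a ℤ.* coeff r i) (coeff (scale b p) i) _ ⟩
    coeff (scale b p) i ℤ.+ (a ℤ.* coeff r i ℤ.+ coeff (0ℤ ∷ p ⊗ r) i)
      ≡⟨ ≡.cong (λ t → coeff (scale b p) i ℤ.+ t) (coeff-∷-⊗ a p r i) ⟨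
    coeff (scale b p) i ℤ.+ coeff ((a ∷ p) ⊗ r) i
      ≡⟨ coeff-⊕ (scale b p) _ i ⟨
    coeff (scale b p ⊕ (a ∷ p) ⊗ r) i ∎

⊗-comm : ∀ p r → p ⊗ r ≋ r ⊗ p
⊗-comm []      r = ≋-sym (⊗-zeroʳ r)
⊗-comm (a ∷ p) r = ≋-trans (⊕-cong ≋-refl (∷-cong ≡.refl (⊗-comm p r))) (≋-sym (⊗-∷ʳ r a p))

⊗-cong : ∀ {p p′ r r′} → p ≋ p′ → r ≋ r′ → p ⊗ r ≋ p′ ⊗ r′
⊗-cong {p} {p′} {r} {r′} e f = ≋-trans (⊗-congˡ p f)
  (≋-trans (⊗-comm p r′) (≋-trans (⊗-congˡ r′ e) (⊗-comm r′ p′)))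

⊗-distribʳ : ∀ r p s → (p ⊕ s) ⊗ r ≋ p ⊗ r ⊕ s ⊗ r
⊗-distribʳ r []      s       = ≋-refl
⊗-distribʳ r (a ∷ p) []      = ≋-sym (⊕-identityʳ _)
⊗-distribʳ r (a ∷ p) (b ∷ s) = mk≋ λ i → begin
  coeff (((a ℤ.+ b) ∷ (p ⊕ s)) ⊗ r) i
    ≡⟨ coeff-∷-⊗ (a ℤ.+ b) (p ⊕ s) r i ⟩
  (a ℤ.+ b) ℤ.* coeff r i ℤ.+ coeff (0ℤ ∷ (p ⊕ s) ⊗ r) i
    ≡⟨ ≡.cong (λ t → (a ℤ.+ b) ℤ.* coeff r i ℤ.+ t) (≡.trans (at (∷-cong ≡.refl (⊗-distribʳ r p s)) i) (coeff-⊕ (0ℤ ∷ p ⊗ r) (0ℤ ∷ s ⊗ r) i)) ⟩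
  (a ℤ.+ b) ℤ.* coeff r i ℤ.+ (coeff (0ℤ ∷ p ⊗ r) i ℤ.+ coeff (0ℤ ∷ s ⊗ r) i)
    ≡⟨ ℤS.solve 5 (λ a b c x y → (a ℤS.:+ b) ℤS.:* c ℤS.:+ (x ℤS.:+ y) ℤS.:= a ℤS.:* c ℤS.:+ x ℤS.:+ (b ℤS.:* c ℤS.:+ y))
         ≡.refl a b (coeff r i) _ _ ⟩
  a ℤ.* coeff r i ℤ.+ coeff (0ℤ ∷ p ⊗ r) i ℤ.+ (b ℤ.* coeff r i ℤ.+ coeff (0ℤ ∷ s ⊗ r) i)
    ≡⟨ ≡.cong₂ ℤ._+_ (coeff-∷-⊗ a p r i) (coeff-∷-⊗ b s r i) ⟨
  coeff ((a ∷ p) ⊗ r) i ℤ.+ coeff ((b ∷ s) ⊗ r) i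
    ≡⟨ coeff-⊕ ((a ∷ p) ⊗ r) _ i ⟨
  coeff ((a ∷ p) ⊗ r ⊕ (b ∷ s) ⊗ r) i ∎
  where open ≡.≡-Reasoning

scale-⊗ : ∀ c p r → scale c p ⊗ r ≋ scale c (p ⊗ r)
scale-⊗ c []      r = ≋-refl
scale-⊗ c (a ∷ p) r = mk≋ λ i → begin
  coeff (((c ℤ.* a) ∷ scale c p) ⊗ r) i
    ≡⟨ coeff-∷-⊗ (c ℤ.* a) (scale c p) r i ⟩
  c ℤ.* a ℤ.* coeff r i ℤ.+ coeff (0ℤ ∷ scale c p ⊗ r) i
    ≡⟨ ≡.cong (λ t → c ℤ.* a ℤ.* coeff r i ℤ.+ t)
         (≡.trans (at (∷-cong (≡.sym (ℤ.*-zeroʳ c)) (scale-⊗ c p r)) i) (coeff-scale c (0ℤ ∷ p ⊗ r) i)) ⟩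
  c ℤ.* a ℤ.* coeff r i ℤ.+ c ℤ.* coeff (0ℤ ∷ p ⊗ r) i
    ≡⟨ ℤS.solve 4 (λ c a x y → c ℤS.:* a ℤS.:* x ℤS.:+ c ℤS.:* y ℤS.:= c ℤS.:* (a ℤS.:* x ℤS.:+ y)) ≡.refl c a (coeff r i) _ ⟩
  c ℤ.* (a ℤ.* coeff r i ℤ.+ coeff (0ℤ ∷ p ⊗ r) i)
    ≡⟨ ≡.cong (c ℤ.*_) (coeff-∷-⊗ a p r i) ⟨
  c ℤ.* coeff ((a ∷ p) ⊗ r) i
    ≡⟨ coeff-scale c ((a ∷ p) ⊗ r) i ⟨
  coeff (scale c ((a ∷ p) ⊗ r)) i ∎
  where open ≡.≡-Reasoning

scale-0 : ∀ p → scale 0ℤ p ≋ []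
scale-0 p = mk≋ λ i → coeff-scale 0ℤ p i

0∷-⊗ : ∀ p r → (0ℤ ∷ p) ⊗ r ≋ 0ℤ ∷ p ⊗ r
0∷-⊗ p r = ⊕-cong (scale-0 r) ≋-refl

⊗-assoc : ∀ p r s → (p ⊗ r) ⊗ s ≋ p ⊗ (r ⊗ s)
⊗-assoc []      r s = ≋-refl
⊗-assoc (a ∷ p) r s = ≋-trans (⊗-distribʳ s (scale a r) (0ℤ ∷ p ⊗ r))
  (⊕-cong (scale-⊗ a r s) (≋-trans (0∷-⊗ (p ⊗ r) s) (∷-cong ≡.refl (⊗-assoc p r s))))

scale-1 : ∀ p → scale 1ℤ p ≋ p
scale-1 p = mk≋ λ i → ≡.trans (coeff-scale 1ℤ p i) (ℤ.*-identityˡ _)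

const-⊗ : ∀ c p → constᴾ c ⊗ p ≋ scale c p
const-⊗ c p = ≋-trans (⊕-cong ≋-refl 0∷[]) (⊕-identityʳ _)

⊗-identityˡ : ∀ p → one ⊗ p ≋ p
⊗-identityˡ p = ≋-trans (const-⊗ 1ℤ p) (scale-1 p)

polyRing : CommutativeRing 0ℓ 0ℓ
polyRing = record
  { Carrier = Poly ; _≈_ = _≋_ ; _+_ = _⊕_ ; _*_ = _⊗_ ; -_ = negᴾ ; 0# = [] ; 1# = one
  ; isCommutativeRing = record
    { isRing = record
      { +-isAbelianGroup = record
        { isGroup = record
          { isMonoid = record
            { isSemigroup = record
              { isMagma = record
                { isEquivalence = record { refl = ≋-refl ; sym = ≋-sym ; trans = ≋-trans }
                ; ∙-cong = ⊕-cong }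
              ; assoc = ⊕-assoc }
            ; identity = (λ _ → ≋-refl) , ⊕-identityʳ }
          ; inverse = (λ p → ≋-trans (⊕-comm (negᴾ p) p) (⊕-inverseʳ p)) , ⊕-inverseʳ
          ; ⁻¹-cong = negᴾ-cong }
        ; comm = ⊕-comm }
      ; *-cong = ⊗-cong
      ; *-assoc = ⊗-assoc
      ; *-identity = ⊗-identityˡ , (λ p → ≋-trans (⊗-comm p one) (⊗-identityˡ p))
      ; distrib = (λ p r s → ≋-trans (⊗-comm p (r ⊕ s)) (≋-trans (⊗-distribʳ p r s) (⊕-cong (⊗-comm r p) (⊗-comm s p))))
                , ⊗-distribʳ }
    ; *-comm = ⊗-comm } }

polyHom : ℤ.+-*-rawRing -Raw-AlmostCommutative⟶ fromCommutativeRing polyRing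
polyHom = record
  { ⟦_⟧ = constᴾ
  ; +-homo = λ _ _ → ≋-refl
  ; *-homo = λ a b → ≋-sym (const-⊗ a (constᴾ b))
  ; -‿homo = λ _ → ≋-refl
  ; 0-homo = 0∷[]
  ; 1-homo = ≋-refl
  }

module Quotient {c ℓ} (R : CommutativeRing c ℓ)
  (hom : ℤ.+-*-rawRing -Raw-AlmostCommutative⟶ fromCommutativeRing R)
  (P : CommutativeRing.Carrier R) where

  open RingTools R hom

  infix 4 _∼_
  record _∼_ (x y : Carrier) : Set (c ⊔ ℓ) where
    constructor mk∼
    field
      witness : Carrier
      diff    : x - y ≈ P * witness

  ≈⇒∼ : ∀ {x y} → x ≈ y → x ∼ y
  ≈⇒∼ x≈y = mk∼ 0# (trans (x≈y⇒x∙y⁻¹≈ε x≈y) (sym (zeroʳ P)))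

  quotientRing : CommutativeRing c (c ⊔ ℓ)
  quotientRing = record
    { Carrier = Carrier ; _≈_ = _∼_ ; _+_ = _+_ ; _*_ = _*_ ; -_ = -_ ; 0# = 0# ; 1# = 1#
    ; isCommutativeRing = record
      { isRing = record
        { +-isAbelianGroup = record
          { isGroup = record
            { isMonoid = record
              { isSemigroup = record
                { isMagma = record
                  { isEquivalence = record { refl = ≈⇒∼ refl ; sym = ∼-sym ; trans = ∼-trans }
                  ; ∙-cong = ∼-+ }
                ; assoc = λ x y z → ≈⇒∼ (+-assoc x y z) }
              ; identity = (λ x → ≈⇒∼ (+-identityˡ x)) , (λ x → ≈⇒∼ (+-identityʳ x)) }
            ; inverse = (λ x → ≈⇒∼ (-‿inverseˡ x)) , (λ x → ≈⇒∼ (-‿inverseʳ x))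
            ; ⁻¹-cong = ∼-neg }
          ; comm = λ x y → ≈⇒∼ (+-comm x y) }
        ; *-cong = ∼-*
        ; *-assoc = λ x y z → ≈⇒∼ (*-assoc x y z)
        ; *-identity = (λ x → ≈⇒∼ (*-identityˡ x)) , (λ x → ≈⇒∼ (*-identityʳ x))
        ; distrib = (λ x y z → ≈⇒∼ (distribˡ x y z)) , (λ x y z → ≈⇒∼ (distribʳ x y z)) }
      ; *-comm = λ x y → ≈⇒∼ (*-comm x y) } }
    where
    ∼-sym : ∀ {x y} → x ∼ y → y ∼ x
    ∼-sym {x} {y} (mk∼ w e) = mk∼ (- w) (lin₁ (- 1#) e
      (solve 4 (λ x y p w → y :- x :- p :* (:- w) := (:- con (+ 1)) :* (x :- y :- p :* w)) refl x y P w))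
    ∼-trans : ∀ {x y z} → x ∼ y → y ∼ z → x ∼ z
    ∼-trans {x} {y} {z} (mk∼ w e) (mk∼ v f) = mk∼ (w + v) (lin₂ 1# 1# e f
      (solve 6 (λ x y z p w v → x :- z :- p :* (w :+ v) := con (+ 1) :* (x :- y :- p :* w) :+ con (+ 1) :* (y :- z :- p :* v))
        refl x y z P w v))
    ∼-+ : ∀ {x y u v} → x ∼ y → u ∼ v → x + u ∼ y + v
    ∼-+ {x} {y} {u} {v} (mk∼ w e) (mk∼ z f) = mk∼ (w + z) (lin₂ 1# 1# e f
      (solve 7 (λ x y u v p w z → x :+ u :- (y :+ v) :- p :* (w :+ z)
          := con (+ 1) :* (x :- y :- p :* w) :+ con (+ 1) :* (u :- v :- p :* z)) refl x y u v P w z))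
    ∼-* : ∀ {x y u v} → x ∼ y → u ∼ v → x * u ∼ y * v
    ∼-* {x} {y} {u} {v} (mk∼ w e) (mk∼ z f) = mk∼ (w * u + y * z) (lin₂ u y e f
      (solve 7 (λ x y u v p w z → x :* u :- y :* v :- p :* (w :* u :+ y :* z)
          := u :* (x :- y :- p :* w) :+ y :* (u :- v :- p :* z)) refl x y u v P w z))
    ∼-neg : ∀ {x y} → x ∼ y → - x ∼ - y
    ∼-neg {x} {y} (mk∼ w e) = mk∼ (- w) (lin₁ (- 1#) e
      (solve 4 (λ x y p w → :- x :- (:- y) :- p :* (:- w) := (:- con (+ 1)) :* (x :- y :- p :* w)) refl x y P w))

  quotientHom : ℤ.+-*-rawRing -Raw-AlmostCommutative⟶ fromCommutativeRing quotientRing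
  quotientHom = record
    { ⟦_⟧ = ι
    ; +-homo = λ a b → ≈⇒∼ (ι-+ a b)
    ; *-homo = λ a b → ≈⇒∼ (ι-* a b)
    ; -‿homo = λ a → ≈⇒∼ (ι-neg a)
    ; 0-homo = ≈⇒∼ ι-0
    ; 1-homo = ≈⇒∼ ι-1
    }

  private module Q = RingTools quotientRing quotientHom

  -- The quotient keeps the carrier and the operations and only coarsens the equality. Powers,
  -- Gaussian binomials and sums are thus the same elements in both rings, which an induction on the
  -- recursion argument makes explicit.
  quotient-^ : ∀ x k → x Q.^ k ≡ x ^ k
  quotient-^ x zero    = ≡.refl
  quotient-^ x (suc k) = ≡.cong (x *_) (quotient-^ x k)

  quotient-G : ∀ x n k → Q.G x n k ≡ G x n k
  quotient-G x n       zero    = ≡.refl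
  quotient-G x zero    (suc k) = ≡.refl
  quotient-G x (suc n) (suc k) = ≡.cong₂ _+_ (quotient-G x n k) (≡.cong₂ _*_ (quotient-^ x (suc k)) (quotient-G x n (suc k)))

  quotient-Sum : ∀ n f → Q.Sum n f ≡ Sum n f
  quotient-Sum zero    f = ≡.refl
  quotient-Sum (suc n) f = ≡.cong (_+ f n) (quotient-Sum n f)

-- Monic polynomials and exact division

module Division {c ℓ} (R : CommutativeRing c ℓ)
  (hom : ℤ.+-*-rawRing -Raw-AlmostCommutative⟶ fromCommutativeRing R) where
  open RingTools R hom

  scaled-step : ∀ {k A W u} d t → k * A ≈ d * W → u ≈ k * t → k * (A - t * d) ≈ d * (W - u)
  scaled-step {k} {A} {W} {u} d t e f = lin₂ 1# d e f
    (solve 6 (λ k A t d W u → k :* (A :- t :* d) :- d :* (W :- u) := con (+ 1) :* (k :* A :- d :* W) :+ d :* (u :- k :* t))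
      refl k A t d W u)

  restore : ∀ {A V} d t → A - t * d ≈ d * V → A ≈ d * (V + t)
  restore {A} {V} d t e = lin₁ 1# e
    (solve 4 (λ A t d V → A :- d :* (V :+ t) := con (+ 1) :* (A :- t :* d :- d :* V)) refl A t d V)

  x+[y-x]≈y : ∀ x y → x + (y - x) ≈ y
  x+[y-x]≈y = solve 2 (λ x y → x :+ (y :- x) := y) refl

  step : ∀ {r g} d t → r ≈ d * g → r - t * d ≈ d * (g - t)
  step {r} {g} d t e = lin₁ 1# e
    (solve 4 (λ r t d g → r :- t :* d :- d :* (g :- t) := con (+ 1) :* (r :- d :* g)) refl r t d g)

  ratio-step : ∀ {t b g h y z} → t ≈ b * g → (1# - z) * h ≈ (1# - y) * g → t * (y - 1#) ≈ b * (z - 1#) * h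
  ratio-step {t} {b} {g} {h} {y} {z} e f = lin₂ (y - 1#) b e f
    (solve 6 (λ t b g h y z → t :* (y :- con (+ 1)) :- b :* (z :- con (+ 1)) :* h
        := (y :- con (+ 1)) :* (t :- b :* g) :+ b :* ((con (+ 1) :- z) :* h :- (con (+ 1) :- y) :* g))
      refl t b g h y z)

module P = RingTools polyRing polyHom
module PD = Division polyRing polyHom

-- The degree bound deg p < s. It ignores trailing zeros, which make the length of the list only an
-- upper bound.
Below : Poly → ℕ → Set
Below p s = ∀ i → s ≤ i → coeff p i ≡ 0ℤ

Below-cong : ∀ {p r s} → p ≋ r → Below p s → Below r s
Below-cong e b i s≤i = ≡.trans (≡.sym (at e i)) (b i s≤i)

Below-mono : ∀ {p s t} → s ≤ t → Below p s → Below p t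
Below-mono s≤t b i t≤i = b i (ℕ.≤-trans s≤t t≤i)

Below-length : ∀ p → Below p (length p)
Below-length []      i       _         = ≡.refl
Below-length (a ∷ p) (suc i) (s≤s l≤i) = Below-length p i l≤i

Below-zero : ∀ {p} → Below p 0 → p ≋ []
Below-zero b = mk≋ λ i → b i z≤n

Below-step : ∀ {p s} → Below p (suc s) → coeff p s ≡ 0ℤ → Below p s
Below-step {p} {s} b e i s≤i with ℕ.m≤n⇒m<n∨m≡n s≤i
... | inj₁ s<i    = b i s<i
... | inj₂ ≡.refl = e

Below-⊖ : ∀ {p r s} → Below p s → Below r s → Below (p ⊖ r) s
Below-⊖ {p} {r} b c i s≤i = ≡.trans (coeff-⊖ p r i) (≡.cong₂ ℤ._-_ (b i s≤i) (c i s≤i))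

shifted-zero : ∀ d g → Below d 0 → 0ℤ ∷ d ⊗ g ≋ []
shifted-zero d g b = ≋-trans (∷-cong ≡.refl (⊗-cong {d} {[]} {g} (Below-zero b) ≋-refl)) 0∷[]

Below-⊗ : ∀ d g {D f} → Below d (suc D) → Below g f → Below (d ⊗ g) (D ℕ.+ f)
Below-⊗ []      g         bd bg i       _  = ≡.refl
Below-⊗ (a ∷ d) g {zero} {f}  bd bg i       le = ≡.trans (coeff-∷-⊗ a d g i)
  (≡.cong₂ ℤ._+_ (≡.trans (≡.cong (a ℤ.*_) (bg i le)) (ℤ.*-zeroʳ a))
    (at (shifted-zero d g (λ j _ → bd (suc j) (s≤s z≤n))) i))
Below-⊗ (a ∷ d) g {suc D} {f} bd bg (suc i) le = ≡.trans (coeff-∷-⊗ a d g (suc i))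
  (≡.cong₂ ℤ._+_ (≡.trans (≡.cong (a ℤ.*_) (bg (suc i) (ℕ.≤-trans (ℕ.m≤n+m f (suc D)) le))) (ℤ.*-zeroʳ a))
    (Below-⊗ d g {D} (λ j D<j → bd (suc j) (s≤s D<j)) bg i (ℕ.s≤s⁻¹ le)))

coeff-⊗-top : ∀ d g {D f} → Below d (suc D) → Below g (suc f) → coeff (d ⊗ g) (D ℕ.+ f) ≡ coeff d D ℤ.* coeff g f
coeff-⊗-top []      g         bd bg = ≡.refl
coeff-⊗-top (a ∷ d) g {zero} {f}  bd bg = ≡.trans (coeff-∷-⊗ a d g f)
  (≡.trans (≡.cong (λ t → a ℤ.* coeff g f ℤ.+ t)
    (at (shifted-zero d g (λ j _ → bd (suc j) (s≤s z≤n))) f))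
    (ℤ.+-identityʳ _))
coeff-⊗-top (a ∷ d) g {suc D} {f} bd bg = ≡.trans (coeff-∷-⊗ a d g (suc D ℕ.+ f))
  (≡.trans (≡.cong₂ ℤ._+_ (≡.trans (≡.cong (a ℤ.*_) (bg (suc D ℕ.+ f) (s≤s (ℕ.m≤n+m f D)))) (ℤ.*-zeroʳ a))
    (coeff-⊗-top d g {D} (λ j D<j → bd (suc j) (s≤s D<j)) bg)) (ℤ.+-identityˡ _))

coeff-X^ : ∀ k → coeff (X^ k) k ≡ 1ℤ
coeff-X^ zero    = ≡.refl
coeff-X^ (suc k) = coeff-X^ k

Below-X^ : ∀ k → Below (X^ k) (suc k)
Below-X^ zero    (suc i) _         = ≡.refl
Below-X^ (suc k) (suc i) (s≤s k<i) = Below-X^ k i k<i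

coeff-monomial : ∀ c k → coeff (scale c (X^ k)) k ≡ c
coeff-monomial c k = ≡.trans (coeff-scale c (X^ k) k) (≡.trans (≡.cong (c ℤ.*_) (coeff-X^ k)) (ℤ.*-identityʳ c))

Below-monomial : ∀ c k → Below (scale c (X^ k)) (suc k)
Below-monomial c k i k<i = ≡.trans (coeff-scale c (X^ k) i) (≡.trans (≡.cong (c ℤ.*_) (Below-X^ k i k<i)) (ℤ.*-zeroʳ c))

Below-⊖-monomial : ∀ g f {c} → Below g (suc f) → c ≡ coeff g f → Below (g ⊖ scale c (X^ f)) f
Below-⊖-monomial g f {c} b ≡.refl = Below-step {g ⊖ scale c (X^ f)} (Below-⊖ {g} {scale c (X^ f)} b (Below-monomial c f))
  (≡.trans (coeff-⊖ g (scale c (X^ f)) f)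
    (≡.trans (≡.cong (λ t → coeff g f ℤ.- t) (coeff-monomial c f)) (ℤ.+-inverseʳ (coeff g f))))

record Monic (d : Poly) : Set where
  field
    deg   : ℕ
    lead  : coeff d deg ≡ 1ℤ
    below : Below d (suc deg)
open Monic public

monic-top : ∀ {d} (md : Monic d) g {f} → Below g (suc f) → coeff (d ⊗ g) (deg md ℕ.+ f) ≡ coeff g f
monic-top {d} md g {f} b = ≡.trans (coeff-⊗-top d g (below md) b)
  (≡.trans (≡.cong (ℤ._* coeff g f) (lead md)) (ℤ.*-identityˡ _))

-- The top coefficient of `g` is the top coefficient of `d ⊗ g`. The bound descends from the length
-- of `g` for as long as that coefficient is known to vanish; cancellation is the case `s = 0`.
monic-quotient-Below : ∀ {d} (md : Monic d) g {s} → Below (d ⊗ g) (deg md ℕ.+ s) → Below g s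
monic-quotient-Below md g {s} b = go (length g) (Below-length g)
  where
  go : ∀ f → Below g f → Below g s
  go zero    bg = Below-mono {g} z≤n bg
  go (suc f) bg with s ℕ.≤? f
  ... | yes s≤f = go f (Below-step {g} bg (≡.trans (≡.sym (monic-top md g bg)) (b _ (ℕ.+-monoʳ-≤ (deg md) s≤f))))
  ... | no  s≰f = Below-mono {g} (ℕ.≰⇒> s≰f) bg

monic-cancel : ∀ {d} → Monic d → ∀ g → d ⊗ g ≋ [] → g ≋ []
monic-cancel md g e = Below-zero (monic-quotient-Below md g (λ i _ → at e i))

monic-one : Monic one
monic-one = record { deg = 0 ; lead = ≡.refl ; below = λ { (suc i) _ → ≡.refl } }

monic-⊗ : ∀ {d e} → Monic d → Monic e → Monic (d ⊗ e)
monic-⊗ {d} {e} md me = record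
  { deg   = deg md ℕ.+ deg me
  ; lead  = ≡.trans (monic-top md e (below me)) (lead me)
  ; below = ≡.subst (Below (d ⊗ e)) (ℕ.+-suc (deg md) (deg me)) (Below-⊗ d e (below md) (below me))
  }

monic-X^-1 : ∀ k → Monic (X^ (suc k) ⊖ one)
monic-X^-1 k = record
  { deg   = suc k
  ; lead  = ≡.trans (coeff-⊖ (X^ (suc k)) one (suc k)) (≡.cong (ℤ._- 0ℤ) (coeff-X^ (suc k)))
  ; below = Below-⊖ {X^ (suc k)} {one} (Below-X^ (suc k)) (λ { (suc i) _ → ≡.refl })
  }

monic-quotient : ∀ {d r} → Monic d → Monic r → ∀ g → r ≋ d ⊗ g → Monic g
monic-quotient {d} {r} md mr g e with deg md ℕ.≤? deg mr
... | no D≰E = ⊥-elim (1≢0 (≡.trans (≡.sym (lead mr)) (at r≋[] (deg mr))))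
  where
  1≢0 : 1ℤ ≢ 0ℤ
  1≢0 ()
  g≋[] : g ≋ []
  g≋[] = Below-zero (monic-quotient-Below md g
    (Below-cong e (Below-mono {r} (ℕ.≤-trans (ℕ.≰⇒> D≰E) (ℕ.m≤m+n (deg md) 0)) (below mr))))
  r≋[] : r ≋ []
  r≋[] = ≋-trans e (≋-trans (⊗-congˡ d g≋[]) (⊗-zeroʳ d))
... | yes D≤E = record
  { deg   = s
  ; lead  = ≡.trans (≡.sym (monic-top md g bg)) (≡.trans (≡.sym (at e _)) (≡.trans (≡.cong (coeff r) (ℕ.m+[n∸m]≡n D≤E)) (lead mr)))
  ; below = bg
  }
  where
  s : ℕ
  s = deg mr ∸ deg md
  bg : Below g (suc s)
  bg = monic-quotient-Below md g (Below-cong e (≡.subst (Below r)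
    (≡.trans (≡.cong suc (≡.sym (ℕ.m+[n∸m]≡n D≤E))) (≡.sym (ℕ.+-suc (deg md) s))) (below mr)))

-- A monic case of Gauss's lemma. The leading coefficient of `W` is also a coefficient of `c` times
-- `A`, hence a multiple of `c`, so the leading monomial of `W` divided by `c` stays integral and
-- can be split off.
monic-primitive : ∀ {d} → Monic d → ∀ {c} → c ≢ 0ℤ → ∀ A W → constᴾ c ⊗ A ≋ d ⊗ W → ∃ λ V → A ≋ d ⊗ V
monic-primitive {d} md {c} c≢0 A W = go (length W) A W (Below-length W)
  where
  go : ∀ f A W → Below W f → constᴾ c ⊗ A ≋ d ⊗ W → ∃ λ V → A ≋ d ⊗ V
  go zero A W bW e = [] , ≋-trans A≋[] (≋-sym (⊗-zeroʳ d))
    where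
    cA≋[] : scale c A ≋ []
    cA≋[] = ≋-trans (≋-sym (const-⊗ c A)) (≋-trans e (≋-trans (⊗-congˡ d (Below-zero bW)) (⊗-zeroʳ d)))
    A≋[] : A ≋ []
    A≋[] = mk≋ λ i → ℤ.*-cancelˡ-≡ c (coeff A i) 0ℤ ⦃ ℤ.≢-nonZero c≢0 ⦄
      (≡.trans (≡.sym (coeff-scale c A i)) (≡.trans (at cA≋[] i) (≡.sym (ℤ.*-zeroʳ c))))
  go (suc f) A W bW e = proj₁ rec ⊕ t , PD.restore {A} {proj₁ rec} d t (proj₂ rec)
    where
    a : ℤ
    -- Comparing coefficients of degree `deg md + f` shows that `c` times this integer is the
    -- leading coefficient of `W`.
    a = coeff A (deg md ℕ.+ f)
    t : Poly
    t = scale a (X^ f)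
    top : c ℤ.* a ≡ coeff W f
    top = ≡.trans (≡.sym (coeff-scale c A _)) (≡.trans (≡.sym (at (const-⊗ c A) _)) (≡.trans (at e _) (monic-top md W bW)))
    ct : scale (c ℤ.* a) (X^ f) ≋ constᴾ c ⊗ t
    ct = ≋-trans (mk≋ λ i → ≡.trans (coeff-scale (c ℤ.* a) (X^ f) i) (≡.trans (ℤ.*-assoc c a _)
      (≡.sym (≡.trans (coeff-scale c t i) (≡.cong (c ℤ.*_) (coeff-scale a (X^ f) i)))))) (≋-sym (const-⊗ c t))
    u : Poly
    u = scale (c ℤ.* a) (X^ f)
    rec : ∃ λ V → A ⊖ t ⊗ d ≋ d ⊗ V
    rec = go f (A ⊖ t ⊗ d) (W ⊖ u) (Below-⊖-monomial W f bW top) (PD.scaled-step {constᴾ c} {A} {W} {u} d t e ct)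

-- Long division by a monic polynomial is exact whenever a quotient exists

trim-≋ : ∀ p → trim p ≋ p
trim-≋ [] = ≋-refl
trim-≋ (a ∷ p) with trim p | trim-≋ p
... | [] | e with a ℤ.≟ 0ℤ
...   | yes a≡0 = ≋-trans (≋-sym 0∷[]) (∷-cong (≡.sym a≡0) e)
...   | no  _   = ∷-cong ≡.refl e
trim-≋ (a ∷ p) | b ∷ r | e = ∷-cong ≡.refl e

length-trim : ∀ p {s} → Below p s → length (trim p) ≤ s
length-trim [] b = z≤n
length-trim (a ∷ p) {zero} b with trim p | length-trim p {zero} (λ i _ → b (suc i) z≤n)
... | [] | _ with a ℤ.≟ 0ℤ
...   | yes _   = z≤n
...   | no  a≢0 = ⊥-elim (a≢0 (b 0 z≤n))
length-trim (a ∷ p) {suc s} b with trim p | length-trim p {s} (λ i s≤i → b (suc i) (s≤s s≤i))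
... | [] | _ with a ℤ.≟ 0ℤ
...   | yes _ = z≤n
...   | no  _ = s≤s z≤n
length-trim (a ∷ p) {suc s} b | _ ∷ _ | le = s≤s le

Below-trim : ∀ p → Below p (length (trim p))
Below-trim p = Below-cong (trim-≋ p) (Below-length (trim p))

lastC-coeff : ∀ p → lastC p ≡ coeff p (length p ∸ 1)
lastC-coeff []          = ≡.refl
lastC-coeff (a ∷ [])    = ≡.refl
lastC-coeff (a ∷ b ∷ p) = lastC-coeff (b ∷ p)

length-trim-monic : ∀ {d} (md : Monic d) → length (trim d) ≡ suc (deg md)
length-trim-monic {d} md = ℕ.≤-antisym (length-trim d (below md)) (ℕ.≰⇒> λ l≤D →
  1≢0 (≡.trans (≡.sym (lead md)) (Below-trim d (deg md) l≤D)))
  where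
  1≢0 : 1ℤ ≢ 0ℤ
  1≢0 ()

-- The fuel is tied to the degree of the quotient still to be found, which drops with every round;
-- `monic-quotient-Below` shows that the length of the dividend is enough.
divFuel-exact : ∀ f {r d} g (md : Monic d) → r ≋ d ⊗ g → Below g f → divFuel f r d ≋ g
divFuel-exact zero            g md e bg = ≋-sym (Below-zero bg)
divFuel-exact (suc f) {r} {d} g md e bg with length (trim r) <? length (trim d)
... | yes r<d = ≋-sym (Below-zero (monic-quotient-Below md g (Below-cong e (Below-mono {r}
        (ℕ.≤-trans (ℕ.s≤s⁻¹ (≡.subst (length (trim r) <_) (length-trim-monic md) r<d)) (ℕ.m≤m+n (deg md) 0)) (Below-trim r)))))
... | no r≮d = ≋-trans (⊕-cong (≋-refl {t}) (divFuel-exact f (g ⊖ t) md e′ below-g-t))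
    (PD.x+[y-x]≈y t g)
  where
  D k : ℕ
  D = deg md
  k = length (trim r) ∸ length (trim d)
  t : Poly
  t = scale (lastC (trim r)) (X^ k)
  e′ : r ⊖ t ⊗ d ≋ d ⊗ (g ⊖ t)
  e′ = PD.step {r} {g} d t e
  len-r : length (trim r) ≡ suc (D ℕ.+ k)
  len-r = ≡.sym (≡.trans (≡.cong (ℕ._+ k) (≡.sym (length-trim-monic md))) (ℕ.m+[n∸m]≡n (ℕ.≮⇒≥ r≮d)))
  lc : lastC (trim r) ≡ coeff r (D ℕ.+ k)
  lc = ≡.trans (lastC-coeff (trim r)) (≡.trans (at (trim-≋ r) _) (≡.cong (λ l → coeff r (l ∸ 1)) len-r))
  k≤f : k ≤ f
  k≤f = ℕ.+-cancelˡ-≤ D k f (ℕ.s≤s⁻¹ (≡.subst₂ _≤_ len-r (ℕ.+-suc D f)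
    (length-trim r (Below-cong (≋-sym e) (Below-⊗ d g (below md) bg)))))
  below-g-t : Below (g ⊖ t) f
  -- The fuel only bounds the degree of `g`: either `t` is the monomial of degree `f` in `g` and
  -- cancels it, or that coefficient of `g` is already zero.
  below-g-t with ℕ.m≤n⇒m<n∨m≡n k≤f
  ... | inj₂ k≡f = ≡.subst (λ j → Below (g ⊖ scale (lastC (trim r)) (X^ j)) f) (≡.sym k≡f)
          (Below-⊖-monomial g f bg (≡.trans lc (≡.trans (≡.cong (λ j → coeff r (D ℕ.+ j)) k≡f) (≡.trans (at e _) (monic-top md g bg)))))
  ... | inj₁ k<f = Below-⊖ {g} {t} (Below-step {g} bg (≡.trans (≡.sym (monic-top md g bg)) (≡.trans (≡.sym (at e _))
          (Below-trim r _ (≡.subst (_≤ D ℕ.+ f) (≡.sym len-r) (ℕ.+-monoʳ-< D k<f))))))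
          (Below-mono {t} k<f (Below-monomial (lastC (trim r)) k))

divMonic-exact : ∀ {r d} g → Monic d → r ≋ d ⊗ g → divMonic r d ≋ g
divMonic-exact {r} g md e = divFuel-exact (suc (length r)) g md e
  (Below-mono {g} (ℕ.n≤1+n _) (monic-quotient-Below md g (Below-cong e (Below-mono {r} (ℕ.m≤n+m _ (deg md)) (Below-length r)))))

𝕢 : Poly
𝕢 = X^ 1

𝕢⊗ : ∀ p → 𝕢 ⊗ p ≋ 0ℤ ∷ p
𝕢⊗ p = ≋-trans (0∷-⊗ one p) (∷-cong ≡.refl (⊗-identityˡ p))

X^≋ : ∀ k → X^ k ≋ 𝕢 P.^ k
X^≋ zero    = ≋-refl
X^≋ (suc k) = ≋-sym (≋-trans (⊗-congˡ 𝕢 (≋-sym (X^≋ k))) (𝕢⊗ (X^ k)))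

1-X^≋ : ∀ k → one ⊖ X^ k ≋ one ⊖ 𝕢 P.^ k
1-X^≋ k = ⊕-cong {one} {one} {negᴾ (X^ k)} {negᴾ (𝕢 P.^ k)} ≋-refl (negᴾ-cong (X^≋ k))

G-step-X^ : ∀ n k → (one ⊖ X^ (suc k)) ⊗ P.G 𝕢 n (suc k) ≋ (one ⊖ X^ (n ∸ k)) ⊗ P.G 𝕢 n k
G-step-X^ n k = ≋-trans
  (⊗-cong {one ⊖ X^ (suc k)} {one ⊖ 𝕢 P.^ suc k} {P.G 𝕢 n (suc k)} {P.G 𝕢 n (suc k)} (1-X^≋ (suc k)) ≋-refl)
  (≋-trans (P.Gauss.G-step 𝕢 n k)
    (⊗-cong {one ⊖ 𝕢 P.^ (n ∸ k)} {one ⊖ X^ (n ∸ k)} {P.G 𝕢 n k} {P.G 𝕢 n k} (≋-sym (1-X^≋ (n ∸ k))) ≋-refl))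

prodTop-G : ∀ n k → prodTop n k ≋ prodBot k ⊗ P.G 𝕢 n k
prodTop-G n zero    = ≋-refl
prodTop-G n (suc k) = PD.ratio-step {prodTop n k} {prodBot k} {P.G 𝕢 n k} {P.G 𝕢 n (suc k)} {X^ (n ∸ k)} {X^ (suc k)}
  (prodTop-G n k) (G-step-X^ n k)

monic-prodBot : ∀ k → Monic (prodBot k)
monic-prodBot zero    = monic-one
monic-prodBot (suc k) = monic-⊗ (monic-prodBot k) (monic-X^-1 k)

qbin≋G : ∀ n k → qbin n (+ k) ≋ P.G 𝕢 n k
qbin≋G n k with k ℕ.≤? n
... | yes _   = divMonic-exact (P.G 𝕢 n k) (monic-prodBot k) (prodTop-G n k)
... | no  k≰n = ≋-sym (P.Gauss.G-vanish 𝕢 (ℕ.≰⇒> k≰n))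

-- Cyclotomic polynomials

module PowerDivisibility {c ℓ} (R : CommutativeRing c ℓ)
  (hom : ℤ.+-*-rawRing -Raw-AlmostCommutative⟶ fromCommutativeRing R)
  (q : CommutativeRing.Carrier R) where

  open RingTools R hom

  infix 4 _∥_
  record _∥_ (d a : Carrier) : Set (c ⊔ ℓ) where
    constructor div
    field
      quot : Carrier
      eq   : a ≈ d * quot

  ∥-cong : ∀ {d a b} → a ≈ b → d ∥ a → d ∥ b
  ∥-cong a≈b (div w e) = div w (trans (sym a≈b) e)

  ∥-congˡ : ∀ {d e a} → d ≈ e → d ∥ a → e ∥ a
  ∥-congˡ d≈e (div w h) = div w (trans h (*-congʳ d≈e))

  ∥-refl : ∀ {d} → d ∥ d
  ∥-refl = div 1# (sym (*-identityʳ _))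

  1∥ : ∀ a → 1# ∥ a
  1∥ a = div a (sym (*-identityˡ a))

  ∥-trans : ∀ {d e a} → d ∥ e → e ∥ a → d ∥ a
  ∥-trans {d} {e} {a} (div w f) (div v g) = div (w * v) (trans g (trans (*-congʳ f) (*-assoc d w v)))

  ∥-*ʳ : ∀ {d a} b → d ∥ a → d ∥ a * b
  ∥-*ʳ {d} b (div w f) = div (w * b) (trans (*-congʳ f) (*-assoc d w b))

  ∥-*ˡ : ∀ {d a} b → d ∥ a → d ∥ b * a
  ∥-*ˡ b h = ∥-cong (*-comm _ b) (∥-*ʳ b h)

  ∥-* : ∀ {d e a b} → d ∥ a → e ∥ b → d * e ∥ a * b
  ∥-* {d} {e} (div w f) (div v g) = div (w * v) (trans (*-cong f g)
    (solve 4 (λ d e w v → d :* w :* (e :* v) := d :* e :* (w :* v)) refl d e w v))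

  E : ℕ → Carrier
  E k = q ^ k - 1#

  E-0 : E 0 ≈ 0#
  E-0 = -‿inverseʳ 1#

  E-+ : ∀ a b → E (a ℕ.+ b) ≈ q ^ b * E a + E b
  E-+ a b = trans (+-congʳ (^-homo-* q a b))
    (solve 2 (λ x y → x :* y :- con (+ 1) := y :* (x :- con (+ 1)) :+ (y :- con (+ 1))) refl (q ^ a) (q ^ b))

  E-∥ : ∀ a k → E a ∥ E (k ℕ.* a)
  E-∥ a zero    = div 0# (trans E-0 (sym (zeroʳ (E a))))
  E-∥ a (suc k) with E-∥ a k
  ... | div w f = div (q ^ (k ℕ.* a) + w) (trans (E-+ a (k ℕ.* a)) (trans (+-congˡ f)
    (solve 3 (λ x y w → x :* y :+ y :* w := y :* (x :+ w)) refl (q ^ (k ℕ.* a)) (E a) w)))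

  module _ {d y : Carrier} where

    ∥E-multiple : ∀ a k → d ∥ E a * y → d ∥ E (k ℕ.* a) * y
    ∥E-multiple a k h with E-∥ a k
    ... | div w f = ∥-cong (trans (solve 3 (λ e y w → e :* y :* w := e :* w :* y) refl (E a) y w) (*-congʳ (sym f))) (∥-*ʳ w h)

    ∥E-drop : ∀ b a → d ∥ E (b ℕ.+ a) * y → d ∥ E a * y → d ∥ E b * y
    ∥E-drop b a (div w f) (div v g) = div (w - q ^ b * v) (lin₃ 1# (- (q ^ b)) (- y) f g E-+′
      (solve 7 (λ d y z x e w v → (x :- con (+ 1)) :* y :- d :* (w :- x :* v)
          := con (+ 1) :* (z :* y :- d :* w) :+ (:- x) :* (e :* y :- d :* v) :+ (:- y) :* (z :- (x :* e :+ (x :- con (+ 1)))))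
        refl d y (E (b ℕ.+ a)) (q ^ b) (E a) w v))
      where
      E-+′ : E (b ℕ.+ a) ≈ q ^ b * E a + E b
      E-+′ = trans (+-congʳ (^-congʳ q (ℕ.+-comm b a))) (E-+ a b)

    -- The exponents `k` for which `d` divides `E k * y` are closed under multiples and differences.
    ∥E-gcd : ∀ a b → d ∥ E a * y → d ∥ E b * y → d ∥ E (gcd a b) * y
    ∥E-gcd a b ha hb with Bézout.identity (gcd-GCD a b)
    ... | Bézout.+- u v eq = ∥E-drop (gcd a b) (v ℕ.* b)
            (≡.subst (λ t → d ∥ E t * y) (≡.sym eq) (∥E-multiple a u ha)) (∥E-multiple b v hb)
    ... | Bézout.-+ u v eq = ∥E-drop (gcd a b) (u ℕ.* a)
            (≡.subst (λ t → d ∥ E t * y) (≡.sym eq) (∥E-multiple b v hb)) (∥E-multiple a u ha)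

  -- `s` is 1 + x + ... + xᵏ⁻¹, whose value at 1 is `k`.
  geometric : ∀ x k → ∃ λ s → ∃ λ w → (x ^ k - 1# ≈ (x - 1#) * s) × (s ≈ ν k + (x - 1#) * w)
  geometric x zero    = 0# , 0# , trans E-0 (sym (zeroʳ _)) , sym (trans (+-cong ι-0 (zeroʳ _)) (+-identityˡ 0#))
  geometric x (suc k) with geometric x k
  ... | s , w , e , f = x * s + 1# , s + w ,
    lin₁ x e (solve 3 (λ x y s → x :* y :- con (+ 1) :- (x :- con (+ 1)) :* (x :* s :+ con (+ 1))
        := x :* (y :- con (+ 1) :- (x :- con (+ 1)) :* s)) refl x (x ^ k) s) ,
    lin₂ 1# (- 1#) f (ν-suc k) (solve 5 (λ x s w v v′ → x :* s :+ con (+ 1) :- (v′ :+ (x :- con (+ 1)) :* (s :+ w))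
        := con (+ 1) :* (s :- (v :+ (x :- con (+ 1)) :* w)) :+ (:- con (+ 1)) :* (v′ :- (con (+ 1) :+ v))) refl x s w (ν k) (ν (suc k)))

  -- (qᵏᵍ - 1)/(qᵍ - 1) is congruent to k modulo qᵍ - 1, and d divides it.
  ∥-constant : ∀ {d y} g k → (∀ z → E g * z ≈ 0# → z ≈ 0#) → d * E g ∥ E (k ℕ.* g) → d ∥ E g * y → d ∥ ν k * y
  ∥-constant {d} {y} g k cancel (div S e) (div z f) with geometric (q ^ g) k
  ... | s , w , e₁ , e₂ = div (S * y - w * z) (lin₃ (- y) y (- w) e₂ s≈dS f
    (solve 8 (λ v y d S w z s G → v :* y :- d :* (S :* y :- w :* z)
        := (:- y) :* (s :- (v :+ G :* w)) :+ y :* (s :- d :* S) :+ (:- w) :* (G :* y :- d :* z))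
      refl (ν k) y d S w z s (E g)))
    where
    pow : (q ^ g) ^ k ≈ q ^ (k ℕ.* g)
    pow = trans (^-assocʳ q g k) (^-congʳ q (ℕ.*-comm g k))
    s≈dS : s ≈ d * S
    s≈dS = x∙y⁻¹≈ε⇒x≈y s (d * S) (cancel _ (lin₃ (- 1#) 1# 1# e₁ e pow
      (solve 6 (λ G s d S X Y → G :* (s :- d :* S) :- con (+ 0)
          := (:- con (+ 1)) :* (Y :- con (+ 1) :- G :* s) :+ con (+ 1) :* (X :- con (+ 1) :- d :* G :* S) :+ con (+ 1) :* (Y :- X))
        refl (E g) s d S (q ^ (k ℕ.* g)) ((q ^ g) ^ k))))

  -- Regularity of `a` modulo `d`, used twice: it first gives `y` as `d` times `y₁`; cancelling one
  -- `d` puts `y₁` in the same situation.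
  ∥-square : ∀ {d a} → (∀ z → d * z ≈ 0# → z ≈ 0#) → (∀ y → d ∥ a * y → d ∥ y) → ∀ y → d * d ∥ a * y → d * d ∥ y
  ∥-square {d} {a} cancel reg y h@(div w e) with reg y (∥-trans (div d refl) h)
  ... | div y₁ e₁ with reg y₁ (div w (x∙y⁻¹≈ε⇒x≈y _ _ (cancel _ (lin₂ 1# (- a) e e₁
        (solve 5 (λ d a y y₁ w → d :* (a :* y₁ :- d :* w) :- con (+ 0)
          := con (+ 1) :* (a :* y :- d :* d :* w) :+ (:- a) :* (y :- d :* y₁)) refl d a y y₁ w)))))
  ...   | div y₂ e₂ = div y₂ (trans e₁ (trans (*-congˡ e₂) (sym (*-assoc d d y₂))))

  ∥-flip : ∀ {d k y} → d ∥ (1# - q ^ k) * y → d ∥ E k * y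
  ∥-flip {d} {k} {y} (div w e) = div (- w) (lin₁ (- 1#) e
    (solve 4 (λ x y d w → (x :- con (+ 1)) :* y :- d :* (:- w) := (:- con (+ 1)) :* ((con (+ 1) :- x) :* y :- d :* w)) refl (q ^ k) y d w))

  ∥-nilpotent : ∀ {d k} → d ∥ E k → d * d ∥ (1# - q ^ k) * (1# - q ^ k)
  ∥-nilpotent {d} {k} h = ∥-cong
    (solve 1 (λ x → (x :- con (+ 1)) :* (x :- con (+ 1)) := (con (+ 1) :- x) :* (con (+ 1) :- x)) refl (q ^ k)) (∥-* h h)

open PowerDivisibility polyRing polyHom 𝕢 public

-- The recursive definition of Φ

lastP-snoc : ∀ T φ → lastP (T ++ [ φ ]) ≡ φ
lastP-snoc []          φ = ≡.refl
lastP-snoc (a ∷ [])    φ = ≡.refl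
lastP-snoc (a ∷ b ∷ T) φ = lastP-snoc (b ∷ T) φ

pick : ℕ → ℕ → Poly → Poly
pick m i φ = if ⌊ i ∣? m ⌋ then φ else one

pick-∣ : ∀ {m i} φ → i ∣ m → pick m i φ ≡ φ
pick-∣ {m} {i} φ i∣m with i ∣? m
... | yes _   = ≡.refl
... | no  i∤m = ⊥-elim (i∤m i∣m)

prodDiv-snoc : ∀ m T φ i → prodDiv m (T ++ [ φ ]) i ≋ prodDiv m T i ⊗ pick m (i ℕ.+ length T) φ
prodDiv-snoc m [] φ i rewrite ℕ.+-identityʳ i = ⊗-comm (pick m i φ) one
prodDiv-snoc m (ψ ∷ T) φ i rewrite ℕ.+-suc i (length T) =
  ≋-trans (⊗-congˡ (pick m i ψ) (prodDiv-snoc m T φ (suc i)))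
    (≋-sym (⊗-assoc (pick m i ψ) (prodDiv m T (suc i)) (pick m (suc (i ℕ.+ length T)) φ)))

-- Ψ i m is the product of the Φ_d with d ≤ i and d ∣ m.
Ψ : ℕ → ℕ → Poly
Ψ i m = prodDiv m (cycTable i) 1

length-cycTable : ∀ n → length (cycTable n) ≡ n
length-cycTable zero    = ≡.refl
length-cycTable (suc n) = ≡.trans (length-++ (cycTable n)) (≡.trans (≡.cong (ℕ._+ 1) (length-cycTable n)) (ℕ.+-comm n 1))

Φ-suc : ∀ n → Φ (suc n) ≡ divMonic (X^ (suc n) ⊖ one) (Ψ n (suc n))
Φ-suc n = lastP-snoc (cycTable n) _

Ψ-suc : ∀ n m → Ψ (suc n) m ≋ Ψ n m ⊗ pick m (suc n) (Φ (suc n))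
Ψ-suc n m = ≡.subst₂ (λ φ l → Ψ (suc n) m ≋ Ψ n m ⊗ pick m (suc l) φ) (≡.sym (Φ-suc n)) (length-cycTable n)
  (prodDiv-snoc m (cycTable n) _ 1)

Ψ-∣ : ∀ i {d m} → d ∣ m → Ψ i d ∥ Ψ i m
Ψ-∣ zero    d∣m = ∥-refl
Ψ-∣ (suc i) {d} {m} d∣m = ∥-congˡ (≋-sym (Ψ-suc i d)) (∥-cong (≋-sym (Ψ-suc i m)) (∥-* (Ψ-∣ i d∣m) picks))
  where
  picks : pick d (suc i) (Φ (suc i)) ∥ pick m (suc i) (Φ (suc i))
  picks with suc i ∣? d
  ... | no  _   = 1∥ _
  ... | yes i∣d = ≡.subst (Φ (suc i) ∥_) (≡.sym (pick-∣ (Φ (suc i)) (∣-trans i∣d d∣m))) ∥-refl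

Ψ-≤ : ∀ {i j} m → i ≤ j → Ψ i m ∥ Ψ j m
Ψ-≤ {i} {j} m i≤j = ≡.subst (λ j → Ψ i m ∥ Ψ j m) (ℕ.m∸n+n≡m i≤j) (go (j ∸ i))
  where
  go : ∀ k → Ψ i m ∥ Ψ (k ℕ.+ i) m
  go zero    = ∥-refl
  go (suc k) = ∥-cong (≋-sym (Ψ-suc (k ℕ.+ i) m)) (∥-*ʳ (pick m (suc (k ℕ.+ i)) (Φ (suc (k ℕ.+ i)))) (go k))

E≋ : ∀ k → X^ k ⊖ one ≋ E k
E≋ k = ⊕-cong {X^ k} {𝕢 P.^ k} (X^≋ k) ≋-refl

-- The index is shifted: the record concerns `Φ (suc n)`. `Φ-factor` says that the long division
-- defining it leaves no remainder.
record Good (n : ℕ) : Set where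
  field
    Φ-monic  : Monic (Φ (suc n))
    Φ-factor : E (suc n) ≋ Ψ n (suc n) ⊗ Φ (suc n)

  Ψ-full : E (suc n) ≋ Ψ (suc n) (suc n)
  Ψ-full = ≋-trans Φ-factor (≋-sym (≡.subst (λ φ → Ψ (suc n) (suc n) ≋ Ψ n (suc n) ⊗ φ) (pick-∣ (Φ (suc n)) n∣n) (Ψ-suc n (suc n))))
open Good

monic-cong : ∀ {p r} → p ≋ r → Monic p → Monic r
monic-cong {p} {r} e mp = record
  { deg = deg mp ; lead = ≡.trans (≡.sym (at e (deg mp))) (lead mp) ; below = Below-cong e (below mp) }

monic-E : ∀ k → Monic (E (suc k))
monic-E k = monic-cong (E≋ (suc k)) (monic-X^-1 k)

-- A common divisor `g` of `k` and `suc n` is proper, so `Good` at smaller indices writes `E g` as a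
-- product of factors of `Ψ n (suc n)`. Hence `Φ (suc n) ⊗ E g` divides `E (suc n)`, the hypothesis
-- of `∥-constant`; `monic-primitive` then removes the integer `c`.
Φ-regular : ∀ n → (∀ i → i ≤ n → Good i) → ∀ {k} → suc n ∤ k → ∀ y → Φ (suc n) ∥ E k ⊗ y → Φ (suc n) ∥ y
Φ-regular n good {k} n∤k y h = reduce (gcd k (suc n)) (gcd[m,n]∣m k (suc n)) (gcd[m,n]∣n k (suc n))
  (∥E-gcd k (suc n) h (∥-cong (⊗-cong (≋-sym (Φ-factor gn)) (≋-refl {y})) (∥-*ʳ y (∥-*ˡ (Ψ n (suc n)) ∥-refl))))
  where
  gn : Good n
  gn = good n ℕ.≤-refl
  reduce : ∀ g → g ∣ k → g ∣ suc n → Φ (suc n) ∥ E g ⊗ y → Φ (suc n) ∥ y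
  reduce zero     _   0∣n _ with () ← 0∣⇒≡0 0∣n
  reduce (suc g′) g∣k g∣n@(divides c n≡cg) h′ = div (proj₁ found) (proj₂ found)
    where
    g : ℕ
    g = suc g′
    g≤n : g ≤ n
    g≤n = ℕ.s≤s⁻¹ (ℕ.≤∧≢⇒< (∣⇒≤ g∣n) (λ g≡n → n∤k (≡.subst (_∣ k) g≡n g∣k)))
    E∥Ψ : E g ∥ Ψ n (suc n)
    E∥Ψ = ∥-congˡ (≋-sym (Ψ-full (good g′ (ℕ.≤-trans (ℕ.n≤1+n g′) g≤n)))) (∥-trans (Ψ-∣ g g∣n) (Ψ-≤ (suc n) g≤n))
    ΦE∥E : Φ (suc n) ⊗ E g ∥ E (c ℕ.* g)
    ΦE∥E = ≡.subst (λ t → Φ (suc n) ⊗ E g ∥ E t) n≡cg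
      (∥-cong (≋-sym (Φ-factor gn)) (∥-congˡ (⊗-comm (E g) (Φ (suc n))) (∥-* E∥Ψ (∥-refl {Φ (suc n)}))))
    c≢0 : + c ≢ 0ℤ
    c≢0 c≡0 with () ← ≡.trans n≡cg (≡.cong (ℕ._* g) (ℤ.+-injective c≡0))
    const∥ : Φ (suc n) ∥ constᴾ (+ c) ⊗ y
    const∥ = ∥-constant {Φ (suc n)} {y} g c (monic-cancel (monic-E g′)) ΦE∥E h′
    found : ∃ λ V → y ≋ Φ (suc n) ⊗ V
    found = monic-primitive (Φ-monic gn) c≢0 y (_∥_.quot const∥) (_∥_.eq const∥)

good-step : ∀ n → (∀ i → i < n → Good i) → Good n
good-step n good = record
  { Φ-monic  = monic-cong (≋-sym Φ≋) (monic-quotient Ψ-monic (monic-E n) B (_∥_.eq Ψ∥E))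
  ; Φ-factor = ≋-trans (_∥_.eq Ψ∥E) (⊗-congˡ (Ψ n (suc n)) (≋-sym Φ≋))
  }
  where
  m : ℕ
  m = suc n

  strip : ∀ i → i < n → ∀ j → j ≤ i → ∀ B → Φ (suc i) ∥ Ψ j m ⊗ B → Φ (suc i) ∥ B
  strip i i<n zero    _   B h = ∥-cong (⊗-identityˡ B) h
  strip i i<n (suc j) j<i B h = unpick (strip i i<n j (ℕ.<⇒≤ j<i) (pick m (suc j) (Φ (suc j)) ⊗ B)
      (∥-cong (≋-trans (⊗-cong (Ψ-suc j m) (≋-refl {B})) (⊗-assoc (Ψ j m) (pick m (suc j) (Φ (suc j))) B)) h))
    where
    unpick : Φ (suc i) ∥ pick m (suc j) (Φ (suc j)) ⊗ B → Φ (suc i) ∥ B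
    unpick h′ with suc j ∣? m
    ... | no  _ = ∥-cong (⊗-identityˡ B) h′
    ... | yes _ = Φ-regular i (λ l l≤i → good l (ℕ.≤-<-trans l≤i i<n)) (>⇒∤ (s<s j<i)) B
            (∥-cong (≋-trans (≋-sym (⊗-assoc (Ψ j (suc j)) (Φ (suc j)) B))
                (⊗-cong (≋-sym (Φ-factor (good j (ℕ.<-trans j<i i<n)))) (≋-refl {B})))
              (∥-*ˡ (Ψ j (suc j)) h′))

  -- The factors are collected one by one: if `suc i` divides `m`, then `Φ (suc i)` divides `E m`,
  -- and `strip` moves this divisibility to the cofactor of `Ψ i m`.
  Ψ∥ : ∀ i → i ≤ n → Ψ i m ∥ E m
  Ψ∥ zero    _   = 1∥ (E m)
  Ψ∥ (suc i) i<n = ∥-congˡ (≋-sym (Ψ-suc i m)) (extend (Ψ∥ i (ℕ.<⇒≤ i<n)))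
    where
    extend : Ψ i m ∥ E m → Ψ i m ⊗ pick m (suc i) (Φ (suc i)) ∥ E m
    extend (div B e) with suc i ∣? m
    ... | no  _ = ∥-congˡ (≋-sym (≋-trans (⊗-comm (Ψ i m) one) (⊗-identityˡ (Ψ i m)))) (div B e)
    ... | yes (divides c m≡ci) = ∥-cong (≋-sym e) (∥-* (∥-refl {Ψ i m}) (strip i i<n i ℕ.≤-refl B
            (∥-cong e (∥-trans (∥-cong (≋-sym (Φ-factor (good i i<n))) (∥-*ˡ (Ψ i (suc i)) (∥-refl {Φ (suc i)})))
              (≡.subst (λ t → E (suc i) ∥ E t) (≡.sym m≡ci) (E-∥ (suc i) c))))))

  monic-Ψ : ∀ i → i ≤ n → Monic (Ψ i m)
  monic-Ψ zero    _   = monic-one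
  monic-Ψ (suc i) i<n = monic-cong (≋-sym (Ψ-suc i m)) (monic-⊗ (monic-Ψ i (ℕ.<⇒≤ i<n)) monic-pick)
    where
    monic-pick : Monic (pick m (suc i) (Φ (suc i)))
    monic-pick with suc i ∣? m
    ... | no  _ = monic-one
    ... | yes _ = Φ-monic (good i i<n)

  Ψ∥E : Ψ n m ∥ E m
  Ψ∥E = Ψ∥ n ℕ.≤-refl
  B : Poly
  B = _∥_.quot Ψ∥E
  Ψ-monic : Monic (Ψ n m)
  Ψ-monic = monic-Ψ n ℕ.≤-refl
  Φ≋ : Φ m ≋ B
  Φ≋ = ≡.subst (_≋ B) (≡.sym (Φ-suc n)) (divMonic-exact B Ψ-monic (≋-trans (E≋ m) (_∥_.eq Ψ∥E)))

all-good : ∀ n → Good n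
all-good n = below-good (suc n) n (ℕ.n<1+n n)
  where
  below-good : ∀ n i → i < n → Good i
  below-good (suc n) i (s≤s i≤n) = good-step i (λ j j<i → below-good n j (ℕ.<-≤-trans j<i i≤n))

-- The q-binomial sum and 𝒜ₙ(q) in terms of Gaussian binomials

sub2-cong : ∀ {p r} → p ≋ r → sub2 p ≋ sub2 r
sub2-cong {p} {r} e = mk≋ (go p r (at e))
  where
  go : ∀ p r → p ≈ᴾ r → sub2 p ≈ᴾ sub2 r
  go []      []      e i             = ≡.refl
  go []      (b ∷ r) e zero          = e 0
  go []      (b ∷ r) e (suc zero)    = ≡.refl
  go []      (b ∷ r) e (suc (suc i)) = go [] r (λ j → e (suc j)) i
  go (a ∷ p) []      e zero          = e 0
  go (a ∷ p) []      e (suc zero)    = ≡.refl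
  go (a ∷ p) []      e (suc (suc i)) = go p [] (λ j → e (suc j)) i
  go (a ∷ p) (b ∷ r) e zero          = e 0
  go (a ∷ p) (b ∷ r) e (suc zero)    = ≡.refl
  go (a ∷ p) (b ∷ r) e (suc (suc i)) = go p r (λ j → e (suc j)) i

sub2-⊕ : ∀ p r → sub2 (p ⊕ r) ≡ sub2 p ⊕ sub2 r
sub2-⊕ []      r       = ≡.refl
sub2-⊕ (a ∷ p) []      = ≡.refl
sub2-⊕ (a ∷ p) (b ∷ r) = ≡.cong (λ t → (a ℤ.+ b) ∷ 0ℤ ∷ t) (sub2-⊕ p r)

𝕢² : Poly
𝕢² = 𝕢 ⊗ 𝕢

sub2-𝕢 : ∀ p → sub2 (𝕢 ⊗ p) ≋ 𝕢² ⊗ sub2 p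
sub2-𝕢 p = ≋-trans (sub2-cong (𝕢⊗ p)) (≋-sym
  (≋-trans (⊗-assoc 𝕢 𝕢 (sub2 p)) (≋-trans (𝕢⊗ (𝕢 ⊗ sub2 p)) (∷-cong ≡.refl (𝕢⊗ (sub2 p))))))

sub2-^ : ∀ k p → sub2 (𝕢 P.^ k ⊗ p) ≋ 𝕢² P.^ k ⊗ sub2 p
sub2-^ zero    p = ≋-trans (sub2-cong (⊗-identityˡ p)) (≋-sym (⊗-identityˡ (sub2 p)))
sub2-^ (suc k) p = ≋-trans (sub2-cong (⊗-assoc 𝕢 (𝕢 P.^ k) p))
  (≋-trans (sub2-𝕢 (𝕢 P.^ k ⊗ p)) (≋-trans (⊗-congˡ 𝕢² (sub2-^ k p)) (≋-sym (⊗-assoc 𝕢² (𝕢² P.^ k) (sub2 p)))))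

-- The Pascal recursion uses only sums and multiplication by powers of `𝕢`, so multiplicativity of
-- `sub2` in general is avoided.
sub2-G : ∀ n k → sub2 (P.G 𝕢 n k) ≋ P.G 𝕢² n k
sub2-G n       zero    = mk≋ λ { zero → ≡.refl ; (suc zero) → ≡.refl ; (suc (suc i)) → ≡.refl }
sub2-G zero    (suc k) = ≋-refl
sub2-G (suc n) (suc k) = P.trans (P.reflexive (sub2-⊕ (P.G 𝕢 n k) (𝕢 P.^ suc k ⊗ P.G 𝕢 n (suc k))))
  (⊕-cong (sub2-G n k) (≋-trans (sub2-^ (suc k) (P.G 𝕢 n (suc k))) (⊗-congˡ (𝕢² P.^ suc k) (sub2-G n (suc k)))))

sumP≡Sum : ∀ n f → sumP n f ≡ P.Sum n f
sumP≡Sum zero    f = ≡.refl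
sumP≡Sum (suc n) f = ≡.cong (_⊕ f n) (sumP≡Sum n f)

difference : ∀ n l → (+ (n ℕ.+ l)) ℤ.- (+ l) ≡ + n
difference n l = ℤS.solve 2 (λ a b → a ℤS.:+ b ℤS.:- b ℤS.:= a) ≡.refl (+ n) (+ l)

qbin-shift : ∀ N {n k} → k ≤ n → qbin N ((+ n) ℤ.- (+ k)) ≋ P.G 𝕢 N (n ∸ k)
qbin-shift N {n} {k} k≤n = ≡.subst (λ z → qbin N z ≋ P.G 𝕢 N (n ∸ k))
  (≡.sym (≡.trans (ℤ.m-n≡m⊖n n k) (ℤ.⊖-≥ k≤n))) (qbin≋G N (n ∸ k))

qbin-negative : ∀ N {n k} → n < k → qbin N ((+ n) ℤ.- (+ k)) ≡ []
qbin-negative N {n} {k} n<k = ≡.trans (≡.cong (qbin N) (≡.trans (ℤ.m-n≡m⊖n n k)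
  (≡.trans (ℤ.⊖-< n<k) (≡.cong (λ t → ℤ.- (+ t)) (ℕ.+-∸-assoc 1 n<k))))) ≡.refl

T0-term : ℕ → ℕ → ℕ → Poly
T0-term m n k = constᴾ (sgn k) ⊗ (P.G 𝕢² (m ℕ.* n) k ⊗ P.G 𝕢 (2 ℕ.* (m ℕ.* n) ∸ 2 ℕ.* k) (n ∸ k))

-- Since mn - (m-1)n = n, the lower index is n - k; past `k = n` it is negative and the summands
-- vanish.
T0-sum : ∀ m′ n → T0 (suc m′ ℕ.* n) (+ (m′ ℕ.* n)) ≋ P.Sum (suc n) (T0-term (suc m′) n)
T0-sum m′ n = P.trans (P.reflexive (sumP≡Sum (suc N) F))
  (P.trans (P.Sum-extend (suc n) (m′ ℕ.* n) F-vanish) (P.Sum-cong (suc n) (λ k k<1+n → F-term k (ℕ.s≤s⁻¹ k<1+n))))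
  where
  N : ℕ
  N = suc m′ ℕ.* n
  F : ℕ → Poly
  F k = scale (sgn k) (sub2 (qbin N (+ k)) ⊗ qbin (2 ℕ.* N ∸ 2 ℕ.* k) ((+ N) ℤ.- (+ (m′ ℕ.* n)) ℤ.- (+ k)))
  index : ∀ k → (+ N) ℤ.- (+ (m′ ℕ.* n)) ℤ.- (+ k) ≡ (+ n) ℤ.- (+ k)
  index k = ≡.cong (ℤ._- (+ k)) (difference n (m′ ℕ.* n))
  F-term : ∀ k → k ≤ n → F k ≋ T0-term (suc m′) n k
  F-term k k≤n = ≋-trans (≋-sym (const-⊗ (sgn k) _)) (⊗-congˡ (constᴾ (sgn k)) (⊗-cong
    (≋-trans (sub2-cong (qbin≋G N k)) (sub2-G N k))
    (≡.subst (λ z → qbin (2 ℕ.* N ∸ 2 ℕ.* k) z ≋ P.G 𝕢 (2 ℕ.* N ∸ 2 ℕ.* k) (n ∸ k)) (≡.sym (index k))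
      (qbin-shift (2 ℕ.* N ∸ 2 ℕ.* k) k≤n))))
  F-vanish : ∀ k → suc n ≤ k → F k ≋ []
  F-vanish k n<k = scale-cong (sgn k) (≋-trans (⊗-congˡ (sub2 (qbin N (+ k)))
    (P.reflexive (≡.trans (≡.cong (qbin (2 ℕ.* N ∸ 2 ℕ.* k)) (index k)) (qbin-negative (2 ℕ.* N ∸ 2 ℕ.* k) n<k))))
    (⊗-zeroʳ (sub2 (qbin N (+ k)))))

pent₀-double : ∀ r → pent₀ r ℕ.* 2 ℕ.+ r ≡ 3 ℕ.* (r ℕ.* r)
pent₀-double zero    = ≡.refl
pent₀-double (suc r) = ≡.trans
  (solve 2 (λ r t → (# 1 ⊞ r ⊠ # 3 ⊞ t) ⊠ # 2 ⊞ (# 1 ⊞ r) ≗ (t ⊠ # 2 ⊞ r) ⊞ (# 3 ⊞ # 6 ⊠ r)) ≡.refl r (pent₀ r))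
  (≡.trans (≡.cong (ℕ._+ (3 ℕ.+ 6 ℕ.* r)) (pent₀-double r))
    (solve 1 (λ r → # 3 ⊠ (r ⊠ r) ⊞ (# 3 ⊞ # 6 ⊠ r) ≗ # 3 ⊠ ((# 1 ⊞ r) ⊠ (# 1 ⊞ r))) ≡.refl r))
  where open ℕS

-- Replacing r by r+1 in r(3r-1) gives (r+1)(3r+2), so the classes 0 and 2 share one sequence of
-- exponents.
pent₀-suc : ∀ r → (r ℕ.+ 1) ℕ.* (3 ℕ.* r ℕ.+ 2) ≡ pent₀ (suc r) ℕ.* 2
pent₀-suc r = ℕ.+-cancelʳ-≡ (suc r) _ _ (≡.trans
  (solve 1 (λ r → (r ⊞ # 1) ⊠ (# 3 ⊠ r ⊞ # 2) ⊞ (# 1 ⊞ r) ≗ # 3 ⊠ ((# 1 ⊞ r) ⊠ (# 1 ⊞ r))) ≡.refl r)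
  (≡.sym (pent₀-double (suc r))))
  where open ℕS

pent₀-half : ∀ r → ((r ℕ.+ 1) ℕ.* (3 ℕ.* r ℕ.+ 2)) / 2 ≡ pent₀ (suc r)
pent₀-half r = ≡.trans (≡.cong (_/ 2) (pent₀-suc r)) (m*n/n≡m (pent₀ (suc r)) 2)

pent₀-half′ : ∀ r → (suc r ℕ.* (3 ℕ.* suc r ∸ 1)) / 2 ≡ pent₀ (suc r)
pent₀-half′ r = ≡.trans (≡.cong (_/ 2) (≡.cong₂ ℕ._*_ (ℕ.+-comm 1 r)
  (≡.trans (≡.cong (_∸ 1) (solve 1 (λ r → # 3 ⊠ (# 1 ⊞ r) ≗ (# 3 ⊠ r ⊞ # 2) ⊞ # 1) ≡.refl r)) (ℕ.m+n∸n≡m (3 ℕ.* r ℕ.+ 2) 1))))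
  (pent₀-half r)
  where open ℕS

pent₁-half : ∀ r → (r ℕ.* (3 ℕ.* r ℕ.+ 1)) / 2 ≡ pent₁ r
pent₁-half r = ≡.trans (≡.cong (_/ 2) (≡.trans
  (solve 1 (λ r → r ⊠ (# 3 ⊠ r ⊞ # 1) ≗ # 3 ⊠ (r ⊠ r) ⊞ r) ≡.refl r)
  (≡.trans (≡.cong (ℕ._+ r) (≡.sym (pent₀-double r)))
  (≡.trans (solve 2 (λ r t → t ⊠ # 2 ⊞ r ⊞ r ≗ (r ⊞ t) ⊠ # 2) ≡.refl r (pent₀ r))
    (≡.cong (ℕ._* 2) (≡.sym (pent₁≡r+pent₀ r))))))) (m*n/n≡m (pent₁ r) 2)
  where open ℕS

module L = LucasSums polyRing polyHom 𝕢

𝒜≋lucas : ∀ n → 0 < n → 𝒜 n ≋ L.lucas n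
𝒜≋lucas n 0<n with n % 3 | m≡m%n+[m/n]*n n 3 | m%n<n n 3
... | 0 | n≡ | _ = ≡.subst (λ t → A₀ ≋ L.lucas t) (≡.sym n≡) (case (n / 3) ≡.refl)
  where
  A₀ : Poly
  A₀ = scale (sgn (n / 3)) ((one ⊕ X^ (n / 3)) ⊗ X^ ((n / 3 ℕ.* (3 ℕ.* (n / 3) ∸ 1)) / 2))
  case : ∀ r → n / 3 ≡ r → A₀ ≋ L.lucas (n / 3 ℕ.* 3)
  -- At `n = 0` the two sides would be 2 and 1.
  case zero    e = ⊥-elim (ℕ.<⇒≢ 0<n (≡.sym (≡.trans n≡ (≡.cong (ℕ._* 3) e))))
  case (suc r) e rewrite e = ≋-trans (≋-sym (const-⊗ (sgn (suc r)) _)) (≋-trans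
    (⊗-congˡ (constᴾ (sgn (suc r))) (⊗-cong (⊕-cong (≋-refl {one}) (X^≋ (suc r)))
      (≡.subst (λ t → X^ t ≋ 𝕢 P.^ pent₀ (suc r)) (≡.sym (pent₀-half′ r)) (X^≋ (pent₀ (suc r))))))
    (≋-sym (L.lucas-mod0 r)))
... | 1 | n≡ | _ = ≡.subst (λ t → A₁ ≋ L.lucas t) (≡.sym n≡) (≋-trans (≋-sym (const-⊗ (sgn r) _)) (≋-trans
    (⊗-congˡ (constᴾ (sgn r)) (≡.subst (λ t → X^ t ≋ 𝕢 P.^ pent₁ r) (≡.sym (pent₁-half r)) (X^≋ (pent₁ r))))
    (≋-sym (L.lucas-mod1 r))))
  where
  r : ℕ
  r = n / 3
  A₁ : Poly
  A₁ = scale (sgn r) (X^ ((r ℕ.* (3 ℕ.* r ℕ.+ 1)) / 2))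
... | 2 | n≡ | _ = ≡.subst (λ t → A₂ ≋ L.lucas t) (≡.sym n≡) (≋-trans (≋-sym (const-⊗ (sgn (suc r)) _)) (≋-trans
    (⊗-congˡ (constᴾ (sgn (suc r))) (≡.subst (λ t → X^ t ≋ 𝕢 P.^ pent₀ (suc r)) (≡.sym (pent₀-half r)) (X^≋ (pent₀ (suc r)))))
    (≋-sym (L.lucas-mod2 r))))
  where
  r : ℕ
  r = n / 3
  A₂ : Poly
  A₂ = scale (sgn (suc r)) (X^ (((r ℕ.+ 1) ℕ.* (3 ℕ.* r ℕ.+ 2)) / 2))
... | suc (suc (suc _)) | _ | s≤s (s≤s (s≤s ()))

parity : ∀ p → (∃ λ h → p ≡ h ℕ.+ h) ⊎ (∃ λ h → suc p ≡ suc h ℕ.+ suc h)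
parity zero    = inj₁ (0 , ≡.refl)
parity (suc p) with parity p
... | inj₁ (h , p≡2h) = inj₂ (h , ≡.cong suc (≡.trans (≡.cong suc p≡2h) (≡.sym (ℕ.+-suc h h))))
... | inj₂ (h , e)    = inj₁ (suc h , e)

sgn-double : ∀ h → sgn (h ℕ.+ h) ≡ 1ℤ
sgn-double zero    = ≡.refl
sgn-double (suc h) = ≡.trans (≡.cong (λ t → ℤ.- sgn t) (ℕ.+-suc h h))
  (≡.trans (ℤ.neg-involutive (sgn (h ℕ.+ h))) (sgn-double h))

coefficient-odd : ∀ {p} h m → p ≡ h ℕ.+ h →
  sgn (suc p) ℤ.* ((1ℤ ℤ.+ sgn (suc p)) ℤ.* ((+ m) ℤ.- 1ℤ) ℤ.+ 1ℤ) ≡ ℤ.- 1ℤ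
coefficient-odd h m ≡.refl = ≡.cong (λ s → s ℤ.* ((1ℤ ℤ.+ s) ℤ.* ((+ m) ℤ.- 1ℤ) ℤ.+ 1ℤ)) (≡.cong ℤ.-_ (sgn-double h))

coefficient-even : ∀ {n} h m → n ≡ suc h ℕ.+ suc h → (+ suc m) ℤ.- 1ℤ ≡ + m →
  sgn n ℤ.* ((1ℤ ℤ.+ sgn n) ℤ.* ((+ suc m) ℤ.- 1ℤ) ℤ.+ 1ℤ) ≡ + suc (m ℕ.+ m)
coefficient-even h m n≡2h m-1≡ = ≡.trans
  (≡.cong₂ (λ s t → s ℤ.* ((1ℤ ℤ.+ s) ℤ.* t ℤ.+ 1ℤ)) (≡.trans (≡.cong sgn n≡2h) (sgn-double (suc h))) m-1≡)
  (ℤS.solve 1 (λ a → ℤS.con 1ℤ ℤS.:* ((ℤS.con 1ℤ ℤS.:+ ℤS.con 1ℤ) ℤS.:* a ℤS.:+ ℤS.con 1ℤ) ℤS.:= ℤS.con 1ℤ ℤS.:+ (a ℤS.:+ a))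
    ≡.refl (+ m))

-- The square of `φ` divides the square of `E (suc p)`, which gives nilpotency; regularity passes
-- from `φ` to its square by `∥-square`, with monicity providing the cancellation.
cyclotomic-root : ∀ p φ → Monic φ → φ ∥ E (suc p) → (∀ {k} → suc p ∤ k → ∀ y → φ ∥ E k ⊗ y → φ ∥ y) →
  RootOfUnity.IsRoot (Quotient.quotientRing polyRing polyHom (φ ⊗ φ)) (Quotient.quotientHom polyRing polyHom (φ ⊗ φ)) 𝕢 (suc p)
cyclotomic-root p φ φ-monic φ∥E φ-regular = record
  { nilpotent = ≡.subst (λ x → (one ⊖ x) ⊗ (one ⊖ x) ∼ []) (≡.sym (quotient-^ 𝕢 n)) (∥⇒∼0 (∥-nilpotent {φ} {n} φ∥E))
  ; regular   = λ k n∤k y e → ∥⇒∼0 (∥-square {φ} {E k} (monic-cancel φ-monic) (φ-regular n∤k) y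
      (∥-flip {φ ⊗ φ} {k} {y} (∼0⇒∥ (≡.subst (λ x → (one ⊖ x) ⊗ y ∼ []) (quotient-^ 𝕢 k) e))))
  }
  where
  n : ℕ
  n = suc p
  open Quotient polyRing polyHom (φ ⊗ φ)
  ∥⇒∼0 : ∀ {a} → φ ⊗ φ ∥ a → a ∼ []
  ∥⇒∼0 {a} (div w e) = mk∼ w (≋-trans (⊕-identityʳ a) e)
  ∼0⇒∥ : ∀ {a} → a ∼ [] → φ ⊗ φ ∥ a
  ∼0⇒∥ {a} (mk∼ w e) = div w (≋-trans (≋-sym (⊕-identityʳ a)) e)

-- Transfer to ℤ[q] modulo the square of Φ and conclusion

open import Data.Nat using (_*_)

module Modulo (p : ℕ) (D : Poly)
  (root : RootOfUnity.IsRoot (Quotient.quotientRing polyRing polyHom D) (Quotient.quotientHom polyRing polyHom D) 𝕢 (suc p)) where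

  n : ℕ
  n = suc p

  module Q = Quotient polyRing polyHom D
  module S = RingTools Q.quotientRing Q.quotientHom
  module SL = LucasSums Q.quotientRing Q.quotientHom 𝕢
  open Q using (_∼_; mk∼; ≈⇒∼; quotient-^; quotient-G; quotient-Sum)

  X^∼ : ∀ k → X^ k ∼ 𝕢 S.^ k
  X^∼ k = ≡.subst (X^ k ∼_) (≡.sym (quotient-^ 𝕢 k)) (≈⇒∼ (X^≋ k))

  lucas∼ : L.lucas n ∼ SL.lucas n
  lucas∼ = S.+-congˡ {one} (S.trans (S.reflexive (≡.sym (quotient-Sum p (L.lucasTerm n))))
    (S.Sum-cong p (λ i _ → S.reflexive (≡.sym (≡.cong₂ _⊗_ (≡.cong (constᴾ (sgn (suc i)) ⊗_) (quotient-^ 𝕢 (tri (suc i))))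
      (≡.cong₂ _⊕_ (quotient-G 𝕢 (n ∸ suc i) (suc i))
        (≡.cong₂ _⊗_ (quotient-^ 𝕢 (n ∸ suc i)) (quotient-G 𝕢 (n ∸ suc (suc i)) i))))))))

  module _ (m′ : ℕ) where
    open Congruence Q.quotientRing Q.quotientHom 𝕢 m′ p root using (term; value; module Odd; module Even)

    m : ℕ
    m = suc m′

    δ : Poly
    δ = one ⊖ 𝕢 S.^ n

    T0∼ : T0 (m * n) (+ (m′ * n)) ∼ S.Sum (suc n) term
    T0∼ = S.trans (≈⇒∼ (T0-sum m′ n)) (S.trans (S.reflexive (≡.sym (quotient-Sum (suc n) (T0-term m n))))
      (S.Sum-cong (suc n) (λ k _ → S.reflexive (≡.sym (≡.cong (constᴾ (sgn k) ⊗_)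
        (≡.cong₂ _⊗_ (quotient-G 𝕢² (m * n) k) (quotient-G 𝕢 (2 * (m * n) ∸ 2 * k) (n ∸ k))))))))

    scale∼ : ∀ z {z′ p r} → z ≡ z′ → p ∼ r → scale z p ∼ constᴾ z′ ⊗ r
    scale∼ z {p = p} ≡.refl p∼r = S.trans (≈⇒∼ (≋-sym (const-⊗ z p))) (S.*-congˡ {constᴾ z} p∼r)

    oneMinus∼ : one ⊖ X^ n ∼ δ
    oneMinus∼ = S.+-congˡ {one} (S.-‿cong (X^∼ n))

    assemble : ∀ a a′ b b′ s s′ → a ∼ a′ → b ∼ b′ → s ∼ s′ → a ⊖ b ⊕ s ∼ a′ ⊖ b′ ⊕ s′
    assemble a a′ b b′ s s′ e f g = S.+-cong {a ⊖ b} {a′ ⊖ b′} {s} {s′}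
      (S.+-cong {a} {a′} {negᴾ b} {negᴾ b′} e (S.-‿cong f)) g

    A B : Poly
    A = S.ν n ⊗ (S.ν m ⊗ S.ν (suc (m′ ℕ.+ m′))) ⊗ δ
    B = S.ν n ⊗ (S.ν m ⊗ S.ν m′) ⊗ δ

    inner : Poly
    inner = S.ν m ⊖ B ⊕ S.ν (m ℕ.+ m) ⊗ (SL.lucas n ⊖ one)

    2m≡ : (+ 2) ℤ.* (+ m) ≡ + (m ℕ.+ m)
    2m≡ = ≡.trans (≡.sym (ℤ.pos-* 2 m)) (≡.cong (λ t → + (m ℕ.+ t)) (ℕ.+-identityʳ m))

    m-1≡ : (+ m) ℤ.- 1ℤ ≡ + m′
    m-1≡ = ≡.trans (≡.cong (λ t → (+ t) ℤ.- 1ℤ) (ℕ.+-comm 1 m′)) (difference m′ 1)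

    2m-1≡ : (+ 2) ℤ.* (+ m) ℤ.- 1ℤ ≡ + suc (m′ ℕ.+ m′)
    2m-1≡ = ≡.trans (≡.cong (ℤ._- 1ℤ) 2m≡) (≡.trans
      (≡.cong (λ t → (+ t) ℤ.- 1ℤ) (≡.cong suc (≡.trans (ℕ.+-suc m′ m′) (ℕ.+-comm 1 (m′ ℕ.+ m′)))))
      (difference (suc (m′ ℕ.+ m′)) 1))

    triple : ∀ a b → a ≡ + b → scale ((+ n) ℤ.* (+ m) ℤ.* a) (one ⊖ X^ n) ∼ S.ν n ⊗ (S.ν m ⊗ S.ν b) ⊗ δ
    triple a b a≡b = S.trans (scale∼ _ {(+ n) ℤ.* ((+ m) ℤ.* (+ b))} {one ⊖ X^ n} {δ}
        (≡.trans (ℤ.*-assoc (+ n) (+ m) a) (≡.cong (λ t → (+ n) ℤ.* ((+ m) ℤ.* t)) a≡b)) oneMinus∼)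
      (S.*-congʳ {δ} (S.trans (S.ι-* (+ n) ((+ m) ℤ.* (+ b))) (S.*-congˡ {S.ν n} (S.ι-* (+ m) (+ b)))))

    RHS∼ : ∀ c → sgn n ℤ.* ((1ℤ ℤ.+ sgn n) ℤ.* ((+ m) ℤ.- 1ℤ) ℤ.+ 1ℤ) ≡ c →
      RHS m n ∼ value (constᴾ c)
    RHS∼ c c≡ = assemble (constᴾ ((+ 2) ℤ.* (+ m))) (S.ν (m ℕ.+ m)) _ A _ (constᴾ c ⊗ inner)
      (S.reflexive (≡.cong constᴾ 2m≡)) (triple ((+ 2) ℤ.* (+ m) ℤ.- 1ℤ) (suc (m′ ℕ.+ m′)) 2m-1≡)
      (scale∼ _ {c} {_} {inner} c≡ (assemble (constᴾ (+ m)) (S.ν m) _ B _ (S.ν (m ℕ.+ m) ⊗ (SL.lucas n ⊖ one))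
        S.refl (triple ((+ m) ℤ.- 1ℤ) m′ m-1≡)
        (scale∼ ((+ 2) ℤ.* (+ m)) {+ (m ℕ.+ m)} {𝒜 n ⊖ one} {SL.lucas n ⊖ one} 2m≡
          (S.+-cong {𝒜 n} {SL.lucas n} {negᴾ one} {negᴾ one} (S.trans (≈⇒∼ (𝒜≋lucas n z<s)) lucas∼) S.refl))))

    sum∼RHS : (∃ λ h → p ≡ h ℕ.+ h) ⊎ (∃ λ h → suc p ≡ suc h ℕ.+ suc h) → S.Sum (suc n) term ∼ RHS m n
    sum∼RHS (inj₁ (h , p≡2h)) = S.trans (Odd.sum-odd h p≡2h) (S.sym (RHS∼ (ℤ.- 1ℤ) (coefficient-odd h m p≡2h)))
    sum∼RHS (inj₂ (h , n≡2h)) = S.trans (Even.sum-even h n≡2h) (S.sym (RHS∼ (+ suc (m′ ℕ.+ m′)) (coefficient-even h m′ n≡2h m-1≡)))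

    T0∼RHS : T0 (m * n) (+ (m′ * n)) ∼ RHS m n
    T0∼RHS = S.trans T0∼ (sum∼RHS (parity p))

theorem1p2 : (m n : ℕ) → 0 < m → 0 < n →
    CongMod (T0 (m * n) (+ ((m ∸ 1) * n))) (RHS m n) (Φ n ⊗ Φ n)
theorem1p2 (suc m′) (suc p) _ _ = witness , at diff
  where
  good : Good p
  good = all-good p
  open Modulo p (Φ (suc p) ⊗ Φ (suc p)) (cyclotomic-root p (Φ (suc p)) (Good.Φ-monic good)
    (∥-cong (≋-sym (Good.Φ-factor good)) (∥-*ˡ (Ψ p (suc p)) ∥-refl)) (Φ-regular p (λ i _ → all-good i)))
  open Q._∼_ (T0∼RHS m′)
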